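{- Let $t\not\equiv 0\pmod 4$ be a fixed positive integer and let $n$ and $k<n$ be positive integers such that $t\mid 2nk$ and such that one of the following holds: (1) $nk$ is odd, $n\geq k\geq 3$, and $\gcd(n,k-1)=1$; (2) $nk$ is odd, $n\geq k$, and $3<k<200$; (3) $nk$ is odd, $n\geq k\geq 3$, and $n\geq (k-2)(k-1)$. Set $v=2nk+t$. Then there is a family of distinct biembeddings $\Pi$ of $K_{\frac{v}{t}\times t}$ such that (a) $\mathrm{Aut}(\Pi)=\mathbb{Z}_{v}$, (b) the faces determined by $\Pi$ have lengths multiples of $k$ strictly greater than $k$, whose cardinality is at least $$\left(1-\frac{2n}{nk-(k-1)}\right)\left(1-O\left(\tfrac{1}{nk}\right)\right)(nk)!=\left(1-O\left(\tfrac1k\right)\right)\left(1-O\left(\tfrac{1}{nk}\right)\right)(nk)!,$$ where the term $\left(1-O\left(\frac1k\right)\right)=1-\frac{2n}{nk-(k-1)}$ is strictly positive for any $k\geq 3$. Moreover, if $v$ is a prime (that can occur only if $t=1$), all the biembeddings of $K_v$ in this family are $kv$-gonal.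
   Context: Asymptotic convention: $t$ is fixed and the constant implied in $O(\frac{1}{nk})$ depends only on $t$. $K_{\frac{v}{t}\times t}$ is the complete multipartite graph with $v/t$ parts of size $t$ (so it is $K_v$ when $t=1$); its vertex set is identified with $\mathbb{Z}_v$, two vertices being adjacent iff their difference is not in the subgroup $J=\frac{v}{t}\mathbb{Z}_v$ of order $t$. A (combinatorial, orientable) embedding of a connected graph $\Gamma$ is a pair $\Pi=(\Gamma,\rho)$ where $\rho$ is a permutation of the oriented edges with $\rho(x,y)=(x,\rho_x(y))$, each $\rho_x$ being a cyclic permutation of all neighbours of $x$; this is equivalent to a cellular embedding into an orientable surface. Two embeddings of the same (labelled) graph are distinct if their rotations $\rho$ are different. Face boundaries are traced by the orbits of $(x,y)\mapsto\rho(y,x)$; the length of a face is the length of the orbit. A biembedding is an embedding whose faces can be coloured with two colours so that each edge lies on one face of each colour. An embedding is $\ell$-gonal if all its faces have length $\ell$. $\mathrm{Aut}(\Pi)$ is the group of graph automorphisms $\sigma$ (acting on oriented edges by $\sigma(x,y)=(\sigma(x),\sigma(y))$) such that either $\sigma\circ\rho=\rho\circ\sigma$ or $\sigma\circ\rho=\rho^{ -1}\circ\sigma$; $\mathrm{Aut}(\Pi)=\mathbb{Z}_v$ means that it consists exactly of the translations $\tau_g(x)=x+g$, $g\in\mathbb{Z}_v$. -}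

module Defs where

open import Data.Bool.Base using (Bool)
open import Data.Fin.Base using (Fin; toℕ)
open import Data.Fin.Properties using (nonZeroIndex; toℕ-injective; toℕ-fromℕ<; toℕ≤n)
open import Data.Integer.Base as ℤ using ()
open import Data.Nat.Base
open import Data.Nat.DivMod
open import Data.Nat.Divisibility using (m%n≡0⇒n∣m)
open import Data.Nat.GeneralisedArithmetic using (iterate)
open import Data.Nat.Properties
open import Data.Product.Base using (Σ; _×_; _,_; ∃-syntax)
open import Data.Rational.Base as ℚ using (ℚ)
open import Data.Sum.Base using (_⊎_)
open import Function.Base using (_∘_)
open import Function.Bundles using (_↔_; _⇔_; Inverse; Equivalence)
open import Function.Definitions using (Injective)
open import Relation.Binary.Construct.Closure.ReflexiveTransitive using (Star)
open import Relation.Binary.PropositionalEquality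
open import Relation.Nullary.Negation.Core using (¬_)

-- Residues modulo v.  An element of Fin v witnesses that v is non-zero.

infixl 6 _⊕_ _⊖_

residue : ∀ {v} → Fin v → ℕ → Fin v
residue {v} x m = _mod_ m v {{nonZeroIndex x}}

_⊕_ : ∀ {v} → Fin v → Fin v → Fin v
x ⊕ y = residue x (toℕ x + toℕ y)

_⊖_ : ∀ {v} → Fin v → Fin v → Fin v
_⊖_ {v} x y = residue x ((v + toℕ x) ∸ toℕ y)

-- The subgroup (v/t)ℤ_v of ℤ_v; it has order t when t divides v.
InJ : (v t : ℕ) .{{_ : NonZero t}} → Fin v → Set
InJ v t z = ∃[ w ] z ≡ residue z ((v / t) * toℕ {v} w)

module _ (v : ℕ) .{{_ : NonZero v}} where
  private
    toℕ-residue : (z : Fin v) (m : ℕ) → toℕ (residue z m) ≡ m % v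
    toℕ-residue z m = toℕ-fromℕ< (m%n<n m v {{nonZeroIndex z}})

    complement-unique : ∀ p q p′ q′ → (p + q) % v ≡ 0 → (p′ + q′) % v ≡ 0 →
                        p % v ≡ p′ % v → q % v ≡ q′ % v
    complement-unique p q p′ q′ pq p′q′ pp′ = begin
      q % v                            ≡⟨ %-remove-+ʳ q (m%n≡0⇒n∣m (p′ + q′) v p′q′) ⟨
      (q + (p′ + q′)) % v              ≡⟨ cong (_% v) (+-assoc q p′ q′) ⟨
      (q + p′ + q′) % v                ≡⟨ %-distribˡ-+ (q + p′) q′ v ⟩
      ((q + p′) % v + q′ % v) % v      ≡⟨ cong (λ z → (z + q′ % v) % v) qp′ ⟩
      (0 + q′ % v) % v                 ≡⟨ m%n%n≡m%n q′ v ⟩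
      q′ % v                           ∎
      where
      open ≡-Reasoning
      qp′ : (q + p′) % v ≡ 0
      qp′ = begin
        (q + p′) % v          ≡⟨ %-distribˡ-+ q p′ v ⟩
        (q % v + p′ % v) % v  ≡⟨ cong (λ z → (q % v + z) % v) pp′ ⟨
        (q % v + p % v) % v   ≡⟨ %-distribˡ-+ q p v ⟨
        (q + p) % v           ≡⟨ cong (_% v) (+-comm q p) ⟩
        (p + q) % v           ≡⟨ pq ⟩
        0                     ∎

    difference-+ : ∀ a b → a ≤ v → b ≤ v → (((v + a) ∸ b) + ((v + b) ∸ a)) % v ≡ 0
    difference-+ a b a≤v b≤v = trans (cong (_% v) eq) (trans ([m+n]%n≡m%n v v) (n%n≡0 v))
      where
      open ≡-Reasoning
      eq : ((v + a) ∸ b) + ((v + b) ∸ a) ≡ v + v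
      eq = begin
        ((v + a) ∸ b) + ((v + b) ∸ a)
          ≡⟨ cong₂ _+_ (cong (_∸ b) (+-comm v a)) (cong (_∸ a) (+-comm v b)) ⟩
        ((a + v) ∸ b) + ((b + v) ∸ a)
          ≡⟨ cong₂ _+_ (+-∸-assoc a b≤v) (+-∸-assoc b a≤v) ⟩
        (a + (v ∸ b)) + (b + (v ∸ a))
          ≡⟨ cong (_+ (b + (v ∸ a))) (+-comm a (v ∸ b)) ⟩
        ((v ∸ b) + a) + (b + (v ∸ a))
          ≡⟨ cong (((v ∸ b) + a) +_) (+-comm b (v ∸ a)) ⟩
        ((v ∸ b) + a) + ((v ∸ a) + b)
          ≡⟨ +-assoc (v ∸ b) a _ ⟩
        (v ∸ b) + (a + ((v ∸ a) + b))
          ≡⟨ cong ((v ∸ b) +_) (+-assoc a (v ∸ a) b) ⟨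
        (v ∸ b) + ((a + (v ∸ a)) + b)
          ≡⟨ cong (λ z → (v ∸ b) + (z + b)) (m+[n∸m]≡n a≤v) ⟩
        (v ∸ b) + (v + b)
          ≡⟨ cong ((v ∸ b) +_) (+-comm v b) ⟩
        (v ∸ b) + (b + v)
          ≡⟨ +-assoc (v ∸ b) b v ⟨
        ((v ∸ b) + b) + v
          ≡⟨ cong (_+ v) (m∸n+n≡m b≤v) ⟩
        v + v ∎

    multiple-+ : ∀ m w → w ≤ v → (m * w + m * ((v ∸ w) % v)) % v ≡ 0
    multiple-+ m w w≤v = begin
      (m * w + m * r) % v          ≡⟨ cong (_% v) (*-distribˡ-+ m w r) ⟨
      (m * (w + r)) % v            ≡⟨ %-distribˡ-* m (w + r) v ⟩
      (m % v * ((w + r) % v)) % v  ≡⟨ cong (λ z → (m % v * z) % v) w+r ⟩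
      (m % v * 0) % v              ≡⟨ cong (_% v) (*-zeroʳ (m % v)) ⟩
      0 % v                        ≡⟨ m*n%n≡0 0 v ⟩
      0                            ∎
      where
      open ≡-Reasoning
      r = (v ∸ w) % v
      w+r : (w + r) % v ≡ 0
      w+r = begin
        (w + r) % v                   ≡⟨ %-distribˡ-+ w r v ⟩
        (w % v + r % v) % v           ≡⟨ cong (λ z → (w % v + z) % v) (m%n%n≡m%n (v ∸ w) v) ⟩
        (w % v + (v ∸ w) % v) % v     ≡⟨ %-distribˡ-+ w (v ∸ w) v ⟨
        (w + (v ∸ w)) % v             ≡⟨ cong (_% v) (m+[n∸m]≡n w≤v) ⟩
        v % v                         ≡⟨ n%n≡0 v ⟩
        0                             ∎

  ⊖-flip-∈J : ∀ t .{{_ : NonZero t}} (x y : Fin v) → InJ v t (x ⊖ y) → InJ v t (y ⊖ x)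
  ⊖-flip-∈J t x y (w , eq) = residue x (v ∸ toℕ w) , toℕ-injective (begin
      toℕ (y ⊖ x)                                 ≡⟨ toℕ-residue y _ ⟩
      ((v + toℕ y) ∸ toℕ x) % v                   ≡⟨ flipped ⟩
      (v / t * ((v ∸ toℕ w) % v)) % v             ≡⟨ cong (λ z → (v / t * z) % v) (toℕ-residue x _) ⟨
      (v / t * toℕ (residue x (v ∸ toℕ w))) % v   ≡⟨ toℕ-residue (y ⊖ x) _ ⟨
      toℕ (residue (y ⊖ x) (v / t * toℕ (residue x (v ∸ toℕ w)))) ∎)
    where
    open ≡-Reasoning
    flipped : ((v + toℕ y) ∸ toℕ x) % v ≡ (v / t * ((v ∸ toℕ w) % v)) % v
    flipped = complement-unique
      ((v + toℕ x) ∸ toℕ y) _ (v / t * toℕ w) _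
      (difference-+ (toℕ x) (toℕ y) (toℕ≤n x) (toℕ≤n y))
      (multiple-+ (v / t) (toℕ w) (toℕ≤n w))
      (trans (sym (toℕ-residue x _)) (trans (cong toℕ eq) (toℕ-residue (x ⊖ y) _)))

  ⊖-self-∈J : ∀ t .{{_ : NonZero t}} (x : Fin v) → InJ v t (x ⊖ x)
  ⊖-self-∈J t x = residue x 0 , toℕ-injective (begin
      toℕ (x ⊖ x)                            ≡⟨ toℕ-residue x _ ⟩
      ((v + toℕ x) ∸ toℕ x) % v              ≡⟨ cong (_% v) (m+n∸n≡m v (toℕ x)) ⟩
      v % v                                  ≡⟨ n%n≡0 v ⟩
      0                                      ≡⟨ m*n%n≡0 0 v ⟨
      0 % v                                  ≡⟨ cong (_% v) (*-zeroʳ (v / t)) ⟨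
      (v / t * 0) % v                        ≡⟨ cong (λ z → (v / t * z) % v) (m*n%n≡0 0 v) ⟨
      (v / t * (0 % v)) % v                  ≡⟨ cong (λ z → (v / t * z) % v) (toℕ-residue x _) ⟨
      (v / t * toℕ (residue x 0)) % v        ≡⟨ toℕ-residue (x ⊖ x) _ ⟨
      toℕ (residue (x ⊖ x) (v / t * toℕ (residue x 0))) ∎)
    where open ≡-Reasoning

record Graph (order : ℕ) : Set₁ where
  field
    Adj        : Fin order → Fin order → Set
    adj-sym    : ∀ {x y} → Adj x y → Adj y x
    adj-irrefl : ∀ {x} → ¬ Adj x x

-- The complete multipartite graph with v/t parts of size t (meant for t ∣ v),
-- on the vertex set ℤ_v.
Multipartite : (v t : ℕ) .{{_ : NonZero t}} → Graph v
Multipartite v t = record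
  { Adj        = λ x y → ¬ InJ v t (x ⊖ y)
  ; adj-sym    = λ {x} {y} xy yx → xy (⊖-flip-∈J v {{nonZeroIndex x}} t y x yx)
  ; adj-irrefl = λ {x} xx → xx (⊖-self-∈J v {{nonZeroIndex x}} t x)
  }

Connected : ∀ {order} → Graph order → Set
Connected Γ = ∀ x y → Star (Graph.Adj Γ) x y

-- Adjacency is irrelevant, so that an oriented edge is determined by its ends.
record OrientedEdge {order : ℕ} (Γ : Graph order) : Set where
  constructor edge
  field
    source : Fin order
    target : Fin order
    .adj   : Graph.Adj Γ source target

open OrientedEdge public

reverse : ∀ {order} {Γ : Graph order} → OrientedEdge Γ → OrientedEdge Γ
reverse {Γ = Γ} (edge x y a) = edge y x (Graph.adj-sym Γ a)

record Embedding {order : ℕ} (Γ : Graph order) : Set where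
  field
    connected : Connected Γ
    rotation  : OrientedEdge Γ ↔ OrientedEdge Γ

  open Inverse rotation public using () renaming (to to ρ; from to ρ⁻¹)

  field
    source-ρ : ∀ e → source (ρ e) ≡ source e
    -- ρ acts as a single cycle on the oriented edges leaving each vertex.
    cyclic   : ∀ e e′ → source e ≡ source e′ → ∃[ i ] iterate ρ e i ≡ e′

  -- (x , y) ↦ ρ (y , x)
  traceFace : OrientedEdge Γ → OrientedEdge Γ
  traceFace = ρ ∘ reverse

open Embedding public using (ρ; ρ⁻¹; traceFace)

Distinct : ∀ {order} {Γ : Graph order} → Embedding Γ → Embedding Γ → Set
Distinct Π Π′ = ¬ (∀ e → ρ Π e ≡ ρ Π′ e)

-- a , f a , … , f^(m-1) a are pairwise distinct and f closes them into a cycle.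
OrbitLength : {A : Set} → (A → A) → A → ℕ → Set
OrbitLength f a m =
    0 < m
  × Injective _≡_ _≡_ (λ (i : Fin m) → iterate f a (toℕ i))
  × iterate f a m ≡ a

-- The face whose boundary traverses e has length m.
FaceLength : ∀ {order} {Γ : Graph order} → Embedding Γ → OrientedEdge Γ → ℕ → Set
FaceLength Π e m = OrbitLength (traceFace Π) e m

Gonal : ∀ {order} {Γ : Graph order} → ℕ → Embedding Γ → Set
Gonal ℓ Π = ∀ e → FaceLength Π e ℓ

-- A colouring of faces is a colouring of oriented edges that is constant on the
-- orbits of traceFace; the two faces at an edge are those of e and reverse e.
IsBiembedding : ∀ {order} {Γ : Graph order} → Embedding Γ → Set
IsBiembedding {Γ = Γ} Π = ∃[ colour ] FaceColouring colour
  where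
  FaceColouring : (OrientedEdge Γ → Bool) → Set
  FaceColouring colour =
      (∀ e → colour (traceFace Π e) ≡ colour e)
    × (∀ e → colour (reverse e) ≢ colour e)

record GraphAutomorphism {order : ℕ} (Γ : Graph order) : Set where
  field
    bijection : Fin order ↔ Fin order

  open Inverse bijection public using () renaming (to to app)

  field
    adj⇔ : ∀ {x y} → Graph.Adj Γ x y ⇔ Graph.Adj Γ (app x) (app y)

  onEdges : OrientedEdge Γ → OrientedEdge Γ
  onEdges (edge x y a) = edge (app x) (app y) (Equivalence.to adj⇔ a)

open GraphAutomorphism public using (app; onEdges)

IsAut : ∀ {order} {Γ : Graph order} → Embedding Γ → GraphAutomorphism Γ → Set
IsAut Π σ =
    (∀ e → onEdges σ (ρ Π e) ≡ ρ Π (onEdges σ e))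
  ⊎ (∀ e → onEdges σ (ρ Π e) ≡ ρ⁻¹ Π (onEdges σ e))

IsTranslation : ∀ {v} {Γ : Graph v} → GraphAutomorphism Γ → Fin v → Set
IsTranslation σ g = ∀ x → app σ x ≡ x ⊕ g

-- Aut(Π) consists exactly of the translations of ℤ_v.
AutIsTranslations : ∀ {v} {Γ : Graph v} → Embedding Γ → Set
AutIsTranslations {v} {Γ} Π =
    (∀ σ → IsAut Π σ → ∃[ g ] IsTranslation σ g)
  × (∀ (g : Fin v) → Σ (GraphAutomorphism Γ) λ σ → IsTranslation σ g × IsAut Π σ)

private
  denominator>0 : ∀ n k .{{_ : NonZero n}} .{{_ : NonZero k}} → 0 < n * k ∸ (k ∸ 1)
  denominator>0 (suc n) (suc k) = m<n⇒0<n∸m (s≤s (m≤m+n k (n * suc k)))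

-- 2n / (nk - (k - 1))
lossRatio : (n k : ℕ) .{{_ : NonZero n}} .{{_ : NonZero k}} → ℚ
lossRatio n k = ℚ._/_ (ℤ.+ (2 * n)) (n * k ∸ (k ∸ 1)) {{>-nonZero (denominator>0 n k)}}

-- (1 - 2n / (nk - (k - 1))) (1 - C / (nk)) (nk)!
familyBound : (C n k : ℕ) .{{_ : NonZero n}} .{{_ : NonZero k}} → ℚ
familyBound C n k =
  (ℚ.1ℚ ℚ.- lossRatio n k) ℚ.* (ℚ.1ℚ ℚ.- ℚ._/_ (ℤ.+ C) (n * k) {{m*n≢0 n k}}) ℚ.* (ℤ.+ ((n * k) !) ℚ./ 1)

{-# OPTIONS --safe #-}
-- Write n = 2h + 1, k = 2l + 3 and identify the differences ℤ_v ∖ J with the 2nk darts of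
-- a one-vertex map: ρ (x , x + P p) = (x , x + P (succ p)), so faces are orbits of
-- succ ∘ N, where N is the dart reversal.  The map is explicit: its darts are two copies of
-- the cells (x , d) of ℤ_n × ℤ_k, the faces of one colour are the rows, those of the other
-- are the cycles of g (x , d) = (δ_d x , d + 1), where δ_0 x = −x, δ_1 x = −x − 1,
-- δ_2 x = x + 1 and δ_d x = x otherwise.  Since reflection and translation of ℤ_n have an
-- n-cycle as commutator, the composite of the two face permutations is one nk-cycle, i.e.
-- there is one vertex.  Any signed bijection from the cells onto a half of ℤ_v ∖ J then
-- yields a biembedding whose faces have length k · ord (row or column sum), so all that is
-- needed is that these sums do not vanish; flipping signs along a path through the
-- bipartite row/column graph achieves this whatever the absolute values are.
--
-- For the automorphisms: if σ (x + P p) = σ x + P (u x p), then u x commutes (or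
-- anticommutes) with succ, and N (u x p) = u (x + P p) (N p), so u (x + P p) is determined
-- by u x.  Most darts meet the translations of ℤ_n in a reflection; two such darts p, p′ in
-- the same class give u (x + P p) = u (x + P p′).  Prescribing labels with P p − P p′ = ±1
-- makes u constant, hence σ affine, and the few symmetries of the map itself are excluded
-- by the labels 1 and ±2.
--
-- Seven labels are prescribed, the other nk − 7 are permuted arbitrarily and about n/2 signs
-- are free, which gives at least (nk)! different rotations when nk is large.  For the
-- finitely many smaller nk the constant C makes the claimed bound non-positive.

module Submission where

open import Defs

open import Algebra.Bundles using (CommutativeRing)
import Algebra.Solver.Ring as RingSolver
open import Algebra.Solver.Ring.AlmostCommutativeRing
  using (AlmostCommutativeRing; fromCommutativeRing; _-Raw-AlmostCommutative⟶_)
open import Data.Bool.Base using (Bool; true; false; not)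
open import Data.Bool.Properties using (not-¬; not-involutive)
open import Data.Empty using (⊥-elim; ⊥-elim-irr)
open import Data.Fin.Base using (Fin; toℕ; zero; suc; fromℕ<; remQuot; combine; punchIn)
open import Data.Fin.Patterns using (0F; 1F; 2F)
open import Data.Fin.Permutation as Perm
  using (Permutation; _⟨$⟩ʳ_; _⟨$⟩ˡ_; lift₀; insert; insert-punchIn)
open import Data.Fin.Permutation.Components using () renaming (transpose to swap)
import Data.Fin.Properties as Fin
open import Data.Fin.Properties using (toℕ-injective; toℕ-fromℕ<; toℕ<n; toℕ≤n)
open import Data.Integer.Base as ℤ using (ℤ; +_; -[1+_])
import Data.Integer.Properties as ℤ
open import Data.List.Base using (List; []; _∷_; _++_; applyUpTo)
open import Data.List.Relation.Unary.All as All using (All; []; _∷_)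
import Data.List.Relation.Unary.All.Properties as All
open import Data.List.Relation.Unary.AllPairs using (AllPairs; []; _∷_)
import Data.List.Relation.Unary.AllPairs.Properties as AllPairs
open import Data.Maybe.Base using (Maybe; just; nothing)
open import Data.Nat.Base hiding (pred)
open import Data.Nat.Coprimality as Coprimality using (coprime-divisor)
open import Data.Nat.DivMod
open import Data.Nat.Divisibility
open import Data.Nat.GCD using (gcd; gcd[m,n]∣m; gcd[m,n]∣n; gcd[m,n]≢0)
open import Data.Nat.GeneralisedArithmetic using (iterate)
open import Data.Nat.Primality using (Prime; prime⇒irreducible)
open import Data.Nat.Properties hiding (pred-injective)
open import Data.Nat.Tactic.RingSolver using (solve-∀)
open import Data.Product.Base using (Σ; Σ-syntax; _×_; _,_; ∃-syntax; proj₁; proj₂; uncurry)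
open import Data.Product.Properties using (≡-dec)
open import Data.Rational.Base as ℚ using (ℚ; 0ℚ; 1ℚ)
import Data.Rational.Properties as ℚ
import Data.Rational.Unnormalised.Base as ℚᵘ
import Data.Rational.Unnormalised.Properties as ℚᵘ
open import Data.Sum.Base using (_⊎_; inj₁; inj₂; [_,_]′)
open import Data.Unit.Base using (⊤; tt)
open import Function.Base using (_∘_; const)
open import Function.Bundles using (_↔_; Inverse; mk↔ₛ′; mk⇔)
open import Function.Construct.Composition using (_↔-∘_)
open import Function.Construct.Symmetry using (↔-sym)
open import Level using (0ℓ)
open import Relation.Binary.Construct.Closure.ReflexiveTransitive using (Star; ε; _◅_; _◅◅_)
open import Relation.Binary.PropositionalEquality
open import Relation.Nullary using (Dec; yes; no; ¬_; contradiction)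

-- The ring ℤ_v

-- The array and the cyclic orders along its lines are fixed once and for all and only the labels
-- vary, so that the one-vertex condition is checked a single time, for f ∘ g. The price is that
-- seven labels are pinned, which costs a factor of at most (nk)⁷, while for bounded k the claimed
-- bound is a constant fraction of (nk)!. The free signs repay this: k < n gives (nk)⁷ ≤ n¹⁴, and a
-- power of 2 with exponent (n - 5)/2 is at least that from n = 257 on.
--
-- Two obstacles shape the choice of signs. Each cell lies on one row and one column, so if every
-- line is to own a cell that avoids all earlier lines, the last line can own none. Hence two lines
-- that meet twice are left for the end, and their common cells need labels whose doubles differ
-- whatever the signs; 2 and 7 serve. Moreover, the flips must spare the free signs and the signs of
-- the prescribed labels, so the owners are placed elsewhere. Only ±2 and ±7 sit on the double edge:
-- the argument against reflections uses the square of the former, and the latter matters only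
-- through its double.

module Residues (v : ℕ) .{{_ : NonZero v}} where

  infixl 7 _⊗_
  infixl 6 _⊞_

  opaque
    ⟦_⟧ : ℕ → Fin v
    ⟦ m ⟧ = m mod v

    neg : Fin v → Fin v
    neg x = ⟦ v ∸ toℕ x ⟧

    _⊞_ : Fin v → Fin v → Fin v
    x ⊞ y = x ⊕ y

    _⊗_ : Fin v → Fin v → Fin v
    x ⊗ y = ⟦ toℕ x * toℕ y ⟧

    toℕ-⟦⟧ : ∀ m → toℕ ⟦ m ⟧ ≡ m % v
    toℕ-⟦⟧ m = toℕ-fromℕ< (m%n<n m v)

    residue-⟦⟧ : ∀ (z : Fin v) m → residue z m ≡ ⟦ m ⟧
    residue-⟦⟧ z m = refl

    ⊕-⊞ : ∀ (x y : Fin v) → x ⊕ y ≡ x ⊞ y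
    ⊕-⊞ x y = refl

    ⟦⟧-cong : ∀ {a b} → a % v ≡ b % v → ⟦ a ⟧ ≡ ⟦ b ⟧
    ⟦⟧-cong {a} {b} eq = toℕ-injective (trans (toℕ-⟦⟧ a) (trans eq (sym (toℕ-⟦⟧ b))))

    ⟦⟧-toℕ : ∀ x → ⟦ toℕ x ⟧ ≡ x
    ⟦⟧-toℕ x = toℕ-injective (trans (toℕ-⟦⟧ (toℕ x)) (m<n⇒m%n≡m (toℕ<n x)))

    toℕ-⟦⟧-small : ∀ {m} → m < v → toℕ ⟦ m ⟧ ≡ m
    toℕ-⟦⟧-small {m} m<v = trans (toℕ-⟦⟧ m) (m<n⇒m%n≡m m<v)

    ⟦⟧-+ : ∀ a b → ⟦ a ⟧ ⊞ ⟦ b ⟧ ≡ ⟦ a + b ⟧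
    ⟦⟧-+ a b = ⟦⟧-cong (begin
      (toℕ ⟦ a ⟧ + toℕ ⟦ b ⟧) % v ≡⟨ cong₂ (λ x y → (x + y) % v) (toℕ-⟦⟧ a) (toℕ-⟦⟧ b) ⟩
      (a % v + b % v) % v          ≡⟨ %-distribˡ-+ a b v ⟨
      (a + b) % v                  ∎)
      where open ≡-Reasoning

    ⟦⟧-* : ∀ a b → ⟦ a ⟧ ⊗ ⟦ b ⟧ ≡ ⟦ a * b ⟧
    ⟦⟧-* a b = ⟦⟧-cong (begin
      (toℕ ⟦ a ⟧ * toℕ ⟦ b ⟧) % v ≡⟨ cong₂ (λ x y → (x * y) % v) (toℕ-⟦⟧ a) (toℕ-⟦⟧ b) ⟩
      (a % v * (b % v)) % v        ≡⟨ %-distribˡ-* a b v ⟨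
      (a * b) % v                  ∎)
      where open ≡-Reasoning

    ⟦v⟧ : ⟦ v ⟧ ≡ ⟦ 0 ⟧
    ⟦v⟧ = ⟦⟧-cong (trans (n%n≡0 v) (sym (m*n%n≡0 0 v)))

    private
      ⊞-right : ∀ x b → x ⊞ ⟦ b ⟧ ≡ ⟦ toℕ x + b ⟧
      ⊞-right x b = trans (cong (_⊞ ⟦ b ⟧) (sym (⟦⟧-toℕ x))) (⟦⟧-+ (toℕ x) b)

      ⊞-left : ∀ a y → ⟦ a ⟧ ⊞ y ≡ ⟦ a + toℕ y ⟧
      ⊞-left a y = trans (cong (⟦ a ⟧ ⊞_) (sym (⟦⟧-toℕ y))) (⟦⟧-+ a (toℕ y))

      ⊗-right : ∀ x b → x ⊗ ⟦ b ⟧ ≡ ⟦ toℕ x * b ⟧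
      ⊗-right x b = trans (cong (_⊗ ⟦ b ⟧) (sym (⟦⟧-toℕ x))) (⟦⟧-* (toℕ x) b)

      ⊗-left : ∀ a y → ⟦ a ⟧ ⊗ y ≡ ⟦ a * toℕ y ⟧
      ⊗-left a y = trans (cong (⟦ a ⟧ ⊗_) (sym (⟦⟧-toℕ y))) (⟦⟧-* a (toℕ y))

    ⊞-comm : ∀ (x y : Fin v) → x ⊞ y ≡ y ⊞ x
    ⊞-comm x y = cong ⟦_⟧ (+-comm (toℕ x) (toℕ y))

    ⊞-assoc : ∀ (x y z : Fin v) → (x ⊞ y) ⊞ z ≡ x ⊞ (y ⊞ z)
    ⊞-assoc x y z = begin
      (x ⊞ y) ⊞ z                   ≡⟨ ⊞-left _ z ⟩
      ⟦ toℕ x + toℕ y + toℕ z ⟧     ≡⟨ cong ⟦_⟧ (+-assoc (toℕ x) _ _) ⟩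
      ⟦ toℕ x + (toℕ y + toℕ z) ⟧   ≡⟨ ⊞-right x _ ⟨
      x ⊞ (y ⊞ z)                   ∎
      where open ≡-Reasoning

    ⊞-identityʳ : ∀ (x : Fin v) → x ⊞ ⟦ 0 ⟧ ≡ x
    ⊞-identityʳ x = trans (⊞-right x 0) (trans (cong ⟦_⟧ (+-identityʳ (toℕ x))) (⟦⟧-toℕ x))

    ⊞-identityˡ : ∀ (x : Fin v) → ⟦ 0 ⟧ ⊞ x ≡ x
    ⊞-identityˡ x = trans (⊞-comm ⟦ 0 ⟧ x) (⊞-identityʳ x)

    ⊞-inverseʳ : ∀ (x : Fin v) → x ⊞ neg x ≡ ⟦ 0 ⟧
    ⊞-inverseʳ x = trans (⊞-right x _) (trans (cong ⟦_⟧ (m+[n∸m]≡n (toℕ≤n x))) ⟦v⟧)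

    ⊞-inverseˡ : ∀ (x : Fin v) → neg x ⊞ x ≡ ⟦ 0 ⟧
    ⊞-inverseˡ x = trans (⊞-comm (neg x) x) (⊞-inverseʳ x)

    ⊖-neg : ∀ (x y : Fin v) → x ⊖ y ≡ x ⊞ neg y
    ⊖-neg x y = trans (cong ⟦_⟧ eq) (sym (⊞-right x _))
      where
      eq : (v + toℕ x) ∸ toℕ y ≡ toℕ x + (v ∸ toℕ y)
      eq = trans (cong (_∸ toℕ y) (+-comm v (toℕ x))) (+-∸-assoc (toℕ x) (toℕ≤n y))

    ⊗-comm : ∀ x y → x ⊗ y ≡ y ⊗ x
    ⊗-comm x y = cong ⟦_⟧ (*-comm (toℕ x) (toℕ y))

    ⊗-assoc : ∀ x y z → (x ⊗ y) ⊗ z ≡ x ⊗ (y ⊗ z)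
    ⊗-assoc x y z = begin
      (x ⊗ y) ⊗ z                     ≡⟨ ⊗-left _ z ⟩
      ⟦ toℕ x * toℕ y * toℕ z ⟧       ≡⟨ cong ⟦_⟧ (*-assoc (toℕ x) _ _) ⟩
      ⟦ toℕ x * (toℕ y * toℕ z) ⟧     ≡⟨ ⊗-right x _ ⟨
      x ⊗ (y ⊗ z)                     ∎
      where open ≡-Reasoning

    ⊗-identityˡ : ∀ x → ⟦ 1 ⟧ ⊗ x ≡ x
    ⊗-identityˡ x = trans (⊗-left 1 x) (trans (cong ⟦_⟧ (*-identityˡ (toℕ x))) (⟦⟧-toℕ x))

    ⊗-identityʳ : ∀ x → x ⊗ ⟦ 1 ⟧ ≡ x
    ⊗-identityʳ x = trans (⊗-comm x ⟦ 1 ⟧) (⊗-identityˡ x)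

    ⊗-distribˡ : ∀ x y z → x ⊗ (y ⊞ z) ≡ (x ⊗ y) ⊞ (x ⊗ z)
    ⊗-distribˡ x y z = begin
      x ⊗ (y ⊞ z)                            ≡⟨ ⊗-right x _ ⟩
      ⟦ toℕ x * (toℕ y + toℕ z) ⟧            ≡⟨ cong ⟦_⟧ (*-distribˡ-+ (toℕ x) _ _) ⟩
      ⟦ toℕ x * toℕ y + toℕ x * toℕ z ⟧      ≡⟨ ⟦⟧-+ _ _ ⟨
      (x ⊗ y) ⊞ (x ⊗ z)                      ∎
      where open ≡-Reasoning

    ⊗-distribʳ : ∀ x y z → (y ⊞ z) ⊗ x ≡ (y ⊗ x) ⊞ (z ⊗ x)
    ⊗-distribʳ x y z = trans (⊗-comm _ x) (trans (⊗-distribˡ x y z) (cong₂ _⊞_ (⊗-comm x y) (⊗-comm x z)))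

  commutativeRing : CommutativeRing 0ℓ 0ℓ
  commutativeRing = record
    { Carrier = Fin v ; _≈_ = _≡_ ; _+_ = _⊞_ ; _*_ = _⊗_ ; -_ = neg ; 0# = ⟦ 0 ⟧ ; 1# = ⟦ 1 ⟧
    ; isCommutativeRing = record
      { isRing = record
        { +-isAbelianGroup = record
          { isGroup = record
            { isMonoid = record
              { isSemigroup = record
                { isMagma = record { isEquivalence = isEquivalence ; ∙-cong = cong₂ _⊞_ }
                ; assoc = ⊞-assoc }
              ; identity = ⊞-identityˡ , ⊞-identityʳ }
            ; inverse = ⊞-inverseˡ , ⊞-inverseʳ
            ; ⁻¹-cong = cong neg }
          ; comm = ⊞-comm }
        ; *-cong = cong₂ _⊗_
        ; *-assoc = ⊗-assoc
        ; *-identity = ⊗-identityˡ , ⊗-identityʳ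
        ; distrib = ⊗-distribˡ , ⊗-distribʳ }
      ; *-comm = ⊗-comm } }

  open import Algebra.Properties.Ring (CommutativeRing.ring commutativeRing)
    using (-0#≈0#; -‿distribˡ-*; -‿distribʳ-*)
    renaming (-‿involutive to neg-involutive; -‿injective to neg-injective; -‿+-comm to neg-⊞)
    public
  open import Algebra.Properties.AbelianGroup (CommutativeRing.+-abelianGroup commutativeRing) using (∙-cancelˡ)

  ⊞-cancelˡ : ∀ x y z → x ⊞ y ≡ x ⊞ z → y ≡ z
  ⊞-cancelˡ = ∙-cancelˡ

  private
    fromℤ : ℤ → Fin v
    fromℤ (+ m)      = ⟦ m ⟧
    fromℤ -[1+ m ]   = neg ⟦ suc m ⟧

    fromℤ-neg : ∀ i → fromℤ (ℤ.- i) ≡ neg (fromℤ i)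
    fromℤ-neg (+ zero)  = sym -0#≈0#
    fromℤ-neg (+ suc m) = refl
    fromℤ-neg -[1+ m ]  = sym (neg-involutive _)

    cancel : ∀ a b → ⟦ suc a ⟧ ⊞ neg ⟦ suc b ⟧ ≡ ⟦ a ⟧ ⊞ neg ⟦ b ⟧
    cancel a b = begin
      ⟦ suc a ⟧ ⊞ neg ⟦ suc b ⟧
        ≡⟨ cong₂ (λ x y → x ⊞ neg y) (trans (cong ⟦_⟧ (+-comm 1 a)) (sym (⟦⟧-+ a 1))) (sym (⟦⟧-+ 1 b)) ⟩
      (⟦ a ⟧ ⊞ ⟦ 1 ⟧) ⊞ neg (⟦ 1 ⟧ ⊞ ⟦ b ⟧)     ≡⟨ cong ((⟦ a ⟧ ⊞ ⟦ 1 ⟧) ⊞_) (sym (neg-⊞ _ _)) ⟩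
      (⟦ a ⟧ ⊞ ⟦ 1 ⟧) ⊞ (neg ⟦ 1 ⟧ ⊞ neg ⟦ b ⟧) ≡⟨ ⊞-assoc _ _ _ ⟩
      ⟦ a ⟧ ⊞ (⟦ 1 ⟧ ⊞ (neg ⟦ 1 ⟧ ⊞ neg ⟦ b ⟧)) ≡⟨ cong (⟦ a ⟧ ⊞_) (sym (⊞-assoc _ _ _)) ⟩
      ⟦ a ⟧ ⊞ ((⟦ 1 ⟧ ⊞ neg ⟦ 1 ⟧) ⊞ neg ⟦ b ⟧)
        ≡⟨ cong (⟦ a ⟧ ⊞_) (trans (cong (_⊞ neg ⟦ b ⟧) (⊞-inverseʳ ⟦ 1 ⟧)) (⊞-identityˡ _)) ⟩
      ⟦ a ⟧ ⊞ neg ⟦ b ⟧ ∎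
      where open ≡-Reasoning

    fromℤ-⊖ : ∀ a b → fromℤ (a ℤ.⊖ b) ≡ ⟦ a ⟧ ⊞ neg ⟦ b ⟧
    fromℤ-⊖ a zero = sym (trans (cong (⟦ a ⟧ ⊞_) -0#≈0#) (⊞-identityʳ _))
    fromℤ-⊖ zero (suc b) = sym (⊞-identityˡ _)
    fromℤ-⊖ (suc a) (suc b) = trans (cong fromℤ (ℤ.[1+m]⊖[1+n]≡m⊖n a b)) (trans (fromℤ-⊖ a b) (sym (cancel a b)))

    fromℤ-+ : ∀ i j → fromℤ (i ℤ.+ j) ≡ fromℤ i ⊞ fromℤ j
    fromℤ-+ (+ a) (+ b) = sym (⟦⟧-+ a b)
    fromℤ-+ (+ a) -[1+ b ] = fromℤ-⊖ a (suc b)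
    fromℤ-+ -[1+ a ] (+ b) = trans (fromℤ-⊖ b (suc a)) (⊞-comm _ _)
    fromℤ-+ -[1+ a ] -[1+ b ] = begin
      neg ⟦ suc (suc (a + b)) ⟧           ≡⟨ cong (λ z → neg ⟦ suc z ⟧) (sym (+-suc a b)) ⟩
      neg ⟦ suc a + suc b ⟧               ≡⟨ cong neg (⟦⟧-+ (suc a) (suc b)) ⟨
      neg (⟦ suc a ⟧ ⊞ ⟦ suc b ⟧)         ≡⟨ neg-⊞ _ _ ⟨
      neg ⟦ suc a ⟧ ⊞ neg ⟦ suc b ⟧       ∎
      where open ≡-Reasoning

    fromℤ-* : ∀ i j → fromℤ (i ℤ.* j) ≡ fromℤ i ⊗ fromℤ j
    fromℤ-* (+ a) (+ b) = trans (cong fromℤ (sym (ℤ.pos-* a b))) (sym (⟦⟧-* a b))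
    fromℤ-* (+ a) -[1+ b ] = begin
      fromℤ (+ a ℤ.* -[1+ b ])       ≡⟨ cong fromℤ (sym (ℤ.neg-distribʳ-* (+ a) (+ suc b))) ⟩
      fromℤ (ℤ.- (+ a ℤ.* + suc b))  ≡⟨ fromℤ-neg (+ a ℤ.* + suc b) ⟩
      neg (fromℤ (+ a ℤ.* + suc b))  ≡⟨ cong neg (fromℤ-* (+ a) (+ suc b)) ⟩
      neg (⟦ a ⟧ ⊗ ⟦ suc b ⟧)        ≡⟨ -‿distribʳ-* _ _ ⟩
      ⟦ a ⟧ ⊗ neg ⟦ suc b ⟧          ∎
      where open ≡-Reasoning
    fromℤ-* -[1+ a ] (+ b) = begin
      fromℤ (-[1+ a ] ℤ.* + b)       ≡⟨ cong fromℤ (sym (ℤ.neg-distribˡ-* (+ suc a) (+ b))) ⟩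
      fromℤ (ℤ.- (+ suc a ℤ.* + b))  ≡⟨ fromℤ-neg (+ suc a ℤ.* + b) ⟩
      neg (fromℤ (+ suc a ℤ.* + b))  ≡⟨ cong neg (fromℤ-* (+ suc a) (+ b)) ⟩
      neg (⟦ suc a ⟧ ⊗ ⟦ b ⟧)        ≡⟨ -‿distribˡ-* _ _ ⟩
      neg ⟦ suc a ⟧ ⊗ ⟦ b ⟧          ∎
      where open ≡-Reasoning
    fromℤ-* -[1+ a ] -[1+ b ] = begin
      ⟦ suc a * suc b ⟧                 ≡⟨ ⟦⟧-* (suc a) (suc b) ⟨
      ⟦ suc a ⟧ ⊗ ⟦ suc b ⟧             ≡⟨ neg-involutive _ ⟨
      neg (neg (⟦ suc a ⟧ ⊗ ⟦ suc b ⟧)) ≡⟨ cong neg (-‿distribʳ-* _ _) ⟩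
      neg (⟦ suc a ⟧ ⊗ neg ⟦ suc b ⟧)   ≡⟨ -‿distribˡ-* _ _ ⟩
      neg ⟦ suc a ⟧ ⊗ neg ⟦ suc b ⟧     ∎
      where open ≡-Reasoning

    coefficients : CommutativeRing 0ℓ 0ℓ
    coefficients = ℤ.+-*-commutativeRing

    ring : AlmostCommutativeRing 0ℓ 0ℓ
    ring = fromCommutativeRing commutativeRing

    morphism : CommutativeRing.rawRing coefficients -Raw-AlmostCommutative⟶ ring
    morphism = record
      { ⟦_⟧ = fromℤ ; +-homo = fromℤ-+ ; *-homo = fromℤ-* ; -‿homo = fromℤ-neg
      ; 0-homo = refl ; 1-homo = refl }

    coeff≟ : ∀ i j → Maybe (fromℤ i ≡ fromℤ j)
    coeff≟ i j with i ℤ.≟ j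
    ... | yes eq = just (cong fromℤ eq)
    ... | no  _  = nothing

  open RingSolver (CommutativeRing.rawRing coefficients) ring morphism coeff≟ public
    using (solve; _:=_; _:+_; _:*_; :-_; con)

-- Orbits, orders and voltage maps

module _ {A : Set} (f : A → A) where

  iterate-suc : ∀ x i → iterate f x (suc i) ≡ f (iterate f x i)
  iterate-suc x zero    = refl
  iterate-suc x (suc i) = iterate-suc (f x) i

  iterate-+ : ∀ x i j → iterate f x (i + j) ≡ iterate f (iterate f x i) j
  iterate-+ x zero    j = refl
  iterate-+ x (suc i) j = iterate-+ (f x) i j

iterate-map : {A B : Set} {f : A → A} {g : B → B} (φ : A → B) → (∀ x → φ (f x) ≡ g (φ x)) →
              ∀ x i → φ (iterate f x i) ≡ iterate g (φ x) i
iterate-map φ comm x zero = refl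
iterate-map {f = f} {g} φ comm x (suc i) =
  trans (iterate-map φ comm (f x) i) (cong (λ y → iterate g y i) (comm x))

module Orders (v : ℕ) .{{_ : NonZero v}} where
  open Residues v

  ⟦⟧≡0⇒∣ : ∀ {m} → ⟦ m ⟧ ≡ ⟦ 0 ⟧ → v ∣ m
  ⟦⟧≡0⇒∣ {m} eq = m%n≡0⇒n∣m m v (begin
    m % v        ≡⟨ toℕ-⟦⟧ m ⟨
    toℕ ⟦ m ⟧    ≡⟨ cong toℕ eq ⟩
    toℕ ⟦ 0 ⟧    ≡⟨ toℕ-⟦⟧ 0 ⟩
    0 % v        ≡⟨ m*n%n≡0 0 v ⟩
    0            ∎)
    where open ≡-Reasoning

  ∣⇒⟦⟧≡0 : ∀ {m} → v ∣ m → ⟦ m ⟧ ≡ ⟦ 0 ⟧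
  ∣⇒⟦⟧≡0 {m} v∣m = ⟦⟧-cong (trans (n∣m⇒m%n≡0 m v v∣m) (sym (m*n%n≡0 0 v)))

  ⟦⟧-⊗ : ∀ a s → ⟦ a ⟧ ⊗ s ≡ ⟦ a * toℕ s ⟧
  ⟦⟧-⊗ a s = trans (cong (⟦ a ⟧ ⊗_) (sym (⟦⟧-toℕ s))) (⟦⟧-* a (toℕ s))

  record Order (s : Fin v) : Set where
    field
      order       : ℕ
      order>1     : 1 < order
      order-prime : Prime v → order ≡ v
      annihilates : ⟦ order ⟧ ⊗ s ≡ ⟦ 0 ⟧
      least       : ∀ a → ⟦ a ⟧ ⊗ s ≡ ⟦ 0 ⟧ → order ∣ a

    instance
      order≢0 : NonZero order
      order≢0 = >-nonZero (<-trans z<s order>1)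

    private
      multiples-distinct-≤ : ∀ {a b} → a ≤ b → b < order → ⟦ a ⟧ ⊗ s ≡ ⟦ b ⟧ ⊗ s → a ≡ b
      multiples-distinct-≤ {a} {b} a≤b b<o eq = ≤-antisym a≤b (m∸n≡0⇒m≤n (begin
        b ∸ a            ≡⟨ m<n⇒m%n≡m (≤-<-trans (m∸n≤m b a) b<o) ⟨
        (b ∸ a) % order  ≡⟨ n∣m⇒m%n≡0 (b ∸ a) order (least (b ∸ a) zero-multiple) ⟩
        0                ∎))
        where
        open ≡-Reasoning
        zero-multiple : ⟦ b ∸ a ⟧ ⊗ s ≡ ⟦ 0 ⟧
        zero-multiple = begin
          ⟦ b ∸ a ⟧ ⊗ s
            ≡⟨ solve 3 (λ x y s → x :* s := (x :+ y) :* s :+ (:- (y :* s))) refl ⟦ b ∸ a ⟧ ⟦ a ⟧ s ⟩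
          (⟦ b ∸ a ⟧ ⊞ ⟦ a ⟧) ⊗ s ⊞ neg (⟦ a ⟧ ⊗ s)
            ≡⟨ cong₂ (λ x y → x ⊗ s ⊞ neg y) (trans (⟦⟧-+ (b ∸ a) a) (cong ⟦_⟧ (m∸n+n≡m a≤b))) eq ⟩
          ⟦ b ⟧ ⊗ s ⊞ neg (⟦ b ⟧ ⊗ s)
            ≡⟨ ⊞-inverseʳ (⟦ b ⟧ ⊗ s) ⟩
          ⟦ 0 ⟧ ∎

    multiples-distinct : ∀ {a b} → a < order → b < order → ⟦ a ⟧ ⊗ s ≡ ⟦ b ⟧ ⊗ s → a ≡ b
    multiples-distinct {a} {b} a<o b<o eq with ≤-total a b
    ... | inj₁ a≤b = multiples-distinct-≤ a≤b b<o eq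
    ... | inj₂ b≤a = sym (multiples-distinct-≤ b≤a a<o (sym eq))

  -- The order is `v` divided by `gcd s v`. After this division modulus and multiplier are coprime,
  -- which gives `least`. The gcd is not `v` because `s` is not zero, so for prime `v` it is 1.
  additiveOrder : ∀ s → s ≢ ⟦ 0 ⟧ → Order s
  additiveOrder s s≢0 = record
    { order = o ; order>1 = order>1 ; order-prime = order-prime ; annihilates = annihilates ; least = least }
    where
    S g o S′ : ℕ
    S = toℕ s
    g = gcd S v
    instance
      g≢0 : NonZero g
      g≢0 = ≢-nonZero (gcd[m,n]≢0 S v (inj₂ (≢-nonZero⁻¹ v)))
    o = v / g
    S′ = S / g
    v≡ : v ≡ o * g
    v≡ = sym (m/n*n≡m (gcd[m,n]∣n S v))
    S≡ : S ≡ S′ * g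
    S≡ = sym (m/n*n≡m (gcd[m,n]∣m S v))
    coprime : Coprimality.Coprime o S′
    coprime = Coprimality.sym (Coprimality.coprime-/gcd S v)
    v∤S : v ∤ S
    v∤S v∣S = s≢0 (trans (sym (⟦⟧-toℕ s)) (∣⇒⟦⟧≡0 v∣S))
    g≢v : g ≢ v
    g≢v g≡v = v∤S (subst (_∣ S) g≡v (gcd[m,n]∣m S v))
    order>1 : 1 < o
    order>1 with o in eq
    ... | 0 = contradiction (trans v≡ (cong (_* g) eq)) (≢-nonZero⁻¹ v)
    ... | 1 = contradiction (sym (trans v≡ (trans (cong (_* g) eq) (*-identityˡ g)))) g≢v
    ... | suc (suc _) = s<s z<s
    order-prime : Prime v → o ≡ v
    order-prime pr with prime⇒irreducible pr (gcd[m,n]∣n S v)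
    ... | inj₂ g≡v = contradiction g≡v g≢v
    ... | inj₁ g≡1 = sym (trans v≡ (trans (cong (o *_) g≡1) (*-identityʳ o)))
    annihilates : ⟦ o ⟧ ⊗ s ≡ ⟦ 0 ⟧
    annihilates = trans (⟦⟧-⊗ o s) (∣⇒⟦⟧≡0 (divides S′ (begin
      o * S         ≡⟨ cong (o *_) S≡ ⟩
      o * (S′ * g)  ≡⟨ cong (o *_) (*-comm S′ g) ⟩
      o * (g * S′)  ≡⟨ *-assoc o g S′ ⟨
      o * g * S′    ≡⟨ cong (_* S′) v≡ ⟨
      v * S′        ≡⟨ *-comm v S′ ⟩
      S′ * v        ∎)))
      where open ≡-Reasoning
    least : ∀ a → ⟦ a ⟧ ⊗ s ≡ ⟦ 0 ⟧ → o ∣ a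
    least a eq = coprime-divisor coprime
      (subst (o ∣_) (*-comm a S′) (*-cancelʳ-∣ g (subst₂ _∣_ v≡ (trans (cong (a *_) S≡) (sym (*-assoc a S′ g)))
        (⟦⟧≡0⇒∣ (trans (sym (⟦⟧-⊗ a s)) eq)))))

module _ {v : ℕ} .{{_ : NonZero v}} where
  open Residues v

  sumTo : ℕ → (ℕ → Fin v) → Fin v
  sumTo zero    φ = ⟦ 0 ⟧
  sumTo (suc j) φ = φ 0 ⊞ sumTo j (φ ∘ suc)

  sumTo-cong : ∀ j {φ ψ : ℕ → Fin v} → (∀ i → i < j → φ i ≡ ψ i) → sumTo j φ ≡ sumTo j ψ
  sumTo-cong zero    eq = refl
  sumTo-cong (suc j) eq = cong₂ _⊞_ (eq 0 z<s) (sumTo-cong j (λ i i<j → eq (suc i) (s<s i<j)))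

  sumTo-neg : ∀ j (φ : ℕ → Fin v) → sumTo j (neg ∘ φ) ≡ neg (sumTo j φ)
  sumTo-neg zero    φ = sym -0#≈0#
  sumTo-neg (suc j) φ = trans (cong (neg (φ 0) ⊞_) (sumTo-neg j (φ ∘ suc))) (neg-⊞ (φ 0) _)

neg-∉J : ∀ {v t} .{{_ : NonZero v}} .{{_ : NonZero t}} {z : Fin v} → ¬ InJ v t z → ¬ InJ v t (Residues.neg v z)
neg-∉J {v} {t} {z} z∉J inJ = z∉J (subst (InJ v t) z⊖0 (⊖-flip-∈J v t ⟦ 0 ⟧ z (subst (InJ v t) (sym 0⊖z) inJ)))
  where
  open Residues v
  0⊖z : ⟦ 0 ⟧ ⊖ z ≡ neg z
  0⊖z = trans (⊖-neg ⟦ 0 ⟧ z) (⊞-identityˡ (neg z))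
  z⊖0 : z ⊖ ⟦ 0 ⟧ ≡ z
  z⊖0 = trans (⊖-neg z ⟦ 0 ⟧) (solve 1 (λ z → z :+ (:- con (+ 0)) := z) refl z)

-- A one-vertex map with voltages in ℤ_v: Pos is its set of darts, succ their cyclic order
-- around the vertex, N the reversal of darts, and P the voltage assignment.
record VoltageMap (v t : ℕ) .{{_ : NonZero v}} .{{_ : NonZero t}} : Set₁ where
  open Residues v
  field
    Pos            : Set
    succ pred N    : Pos → Pos
    succ-pred      : ∀ p → succ (pred p) ≡ p
    pred-succ      : ∀ p → pred (succ p) ≡ p
    N-involutive   : ∀ p → N (N p) ≡ p
    reach          : ∀ p q → ∃[ i ] iterate succ p i ≡ q
    P              : Pos → Fin v
    P-injective    : ∀ {p q} → P p ≡ P q → p ≡ q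
    P-N            : ∀ p → P (N p) ≡ neg (P p)
    P∉J            : ∀ p → ¬ InJ v t (P p)
    locate         : ∀ z → InJ v t z ⊎ ∃[ p ] P p ≡ z
    one            : Pos
    P-one          : P one ≡ ⟦ 1 ⟧
    colour         : Pos → Bool
    colour-succ    : ∀ p → colour (succ p) ≡ not (colour p)
    colour-N       : ∀ p → colour (N p) ≡ not (colour p)

  F : Pos → Pos
  F p = succ (N p)

  orbitSum : ℕ → Pos → Fin v
  orbitSum k p = sumTo k (λ i → P (iterate F p i))

module Derived {v t : ℕ} .{{_ : NonZero v}} .{{_ : NonZero t}} (V : VoltageMap v t) where
  open Residues v
  open Orders v
  open VoltageMap V

  Γ : Graph v
  Γ = Multipartite v t

  private
    x⊖[x⊕y] : ∀ (x y : Fin v) → x ⊖ (x ⊕ y) ≡ neg y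
    x⊖[x⊕y] x y = trans (⊖-neg x _) (trans (cong (λ z → x ⊞ neg z) (⊕-⊞ x y))
      (solve 2 (λ x y → x :+ (:- (x :+ y)) := :- y) refl x y))

    [x⊕y]⊖x : ∀ (x y : Fin v) → (x ⊕ y) ⊖ x ≡ y
    [x⊕y]⊖x x y = trans (⊖-neg _ x) (trans (cong (_⊞ neg x) (⊕-⊞ x y))
      (solve 2 (λ x y → (x :+ y) :+ (:- x) := y) refl x y))

    x⊕[y⊖x] : ∀ (x y : Fin v) → x ⊕ (y ⊖ x) ≡ y
    x⊕[y⊖x] x y = trans (⊕-⊞ x _) (trans (cong (x ⊞_) (⊖-neg y x))
      (solve 2 (λ x y → x :+ (y :+ (:- x)) := y) refl x y))

  adjacent : ∀ x p → Graph.Adj Γ x (x ⊕ P p)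
  adjacent x p inJ = P∉J (N p) (subst (InJ v t) (trans (x⊖[x⊕y] x (P p)) (sym (P-N p))) inJ)

  dart : Fin v → Pos → OrientedEdge Γ
  dart x p = edge x (x ⊕ P p) (adjacent x p)

  edge-≡ : ∀ {e e′ : OrientedEdge Γ} → source e ≡ source e′ → target e ≡ target e′ → e ≡ e′
  edge-≡ refl refl = refl

  -- The value `one` is a dummy for differences in J, which do not occur on edges; `P-direction`
  -- disposes of that case. In this form the direction depends on the two ends alone.
  direction : OrientedEdge Γ → Pos
  direction e = [ const one , proj₁ ]′ (locate (target e ⊖ source e))

  P-direction : ∀ e → P (direction e) ≡ target e ⊖ source e
  P-direction (edge x y a) with locate (y ⊖ x)
  ... | inj₂ (p , eq) = eq
  ... | inj₁ inJ      = ⊥-elim-irr (a (⊖-flip-∈J v t y x inJ))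

  direction-dart : ∀ x p → direction (dart x p) ≡ p
  direction-dart x p = P-injective (trans (P-direction (dart x p)) ([x⊕y]⊖x x (P p)))

  dart-direction : ∀ e → dart (source e) (direction e) ≡ e
  dart-direction e = edge-≡ refl (trans (cong (source e ⊕_) (P-direction e)) (x⊕[y⊖x] (source e) (target e)))

  dart-elim : (Q : OrientedEdge Γ → Set) → (∀ x p → Q (dart x p)) → ∀ e → Q e
  dart-elim Q q e = subst Q (dart-direction e) (q (source e) (direction e))

  dart-injective : ∀ {x y p q} → dart x p ≡ dart y q → x ≡ y × p ≡ q
  dart-injective {x} {y} {p} {q} eq =
    cong source eq , trans (sym (direction-dart x p)) (trans (cong direction eq) (direction-dart y q))

  private
    turn : (Pos → Pos) → OrientedEdge Γ → OrientedEdge Γ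
    turn f e = dart (source e) (f (direction e))

    turn-dart : ∀ f x p → turn f (dart x p) ≡ dart x (f p)
    turn-dart f x p = cong (λ q → dart x (f q)) (direction-dart x p)

    turn-turn : ∀ f g → (∀ p → f (g p) ≡ p) → ∀ e → turn f (turn g e) ≡ e
    turn-turn f g fg = dart-elim _ λ x p → begin
      turn f (turn g (dart x p)) ≡⟨ cong (turn f) (turn-dart g x p) ⟩
      turn f (dart x (g p))      ≡⟨ turn-dart f x (g p) ⟩
      dart x (f (g p))           ≡⟨ cong (dart x) (fg p) ⟩
      dart x p                   ∎
      where open ≡-Reasoning

    connected : Connected Γ
    connected x y = subst (Star (Graph.Adj Γ) x) end (path (toℕ (y ⊖ x)))
      where
      path : ∀ j → Star (Graph.Adj Γ) x (x ⊞ ⟦ j ⟧)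
      path zero    = subst (Star (Graph.Adj Γ) x) (sym (⊞-identityʳ x)) ε
      path (suc j) = path j ◅◅ (subst (Graph.Adj Γ _) step (adjacent (x ⊞ ⟦ j ⟧) one) ◅ ε)
        where
        step : (x ⊞ ⟦ j ⟧) ⊕ P one ≡ x ⊞ ⟦ suc j ⟧
        step = trans (⊕-⊞ _ _) (trans (cong ((x ⊞ ⟦ j ⟧) ⊞_) P-one)
          (trans (⊞-assoc x _ _) (cong (x ⊞_) (trans (⟦⟧-+ j 1) (cong ⟦_⟧ (+-comm j 1))))))
      end : x ⊞ ⟦ toℕ (y ⊖ x) ⟧ ≡ y
      end = trans (cong (x ⊞_) (⟦⟧-toℕ _)) (trans (sym (⊕-⊞ x _)) (x⊕[y⊖x] x y))

  embedding : Embedding Γ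
  embedding = record
    { connected = connected
    ; rotation  = mk↔ₛ′ (turn succ) (turn pred) (turn-turn succ pred succ-pred) (turn-turn pred succ pred-succ)
    ; source-ρ  = λ _ → refl
    ; cyclic    = cyclic
    }
    where
    iterate-turn : ∀ x p i → iterate (turn succ) (dart x p) i ≡ dart x (iterate succ p i)
    iterate-turn x p i = sym (iterate-map (dart x) (λ q → sym (turn-dart succ x q)) p i)

    cyclic : ∀ e e′ → source e ≡ source e′ → ∃[ i ] iterate (turn succ) e i ≡ e′
    cyclic = dart-elim _ λ x p → dart-elim _ λ { y q refl →
      let i , eq = reach p q in i , trans (iterate-turn x p i) (cong (dart x) eq) }

  ρ-dart : ∀ x p → ρ embedding (dart x p) ≡ dart x (succ p)
  ρ-dart = turn-dart succ

  ρ⁻¹-dart : ∀ x p → ρ⁻¹ embedding (dart x p) ≡ dart x (pred p)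
  ρ⁻¹-dart = turn-dart pred

  reverse-dart : ∀ x p → reverse (dart x p) ≡ dart (x ⊞ P p) (N p)
  reverse-dart x p = edge-≡ (⊕-⊞ x (P p)) (begin
    x                          ≡⟨ solve 2 (λ x y → x := (x :+ y) :+ (:- y)) refl x (P p) ⟩
    (x ⊞ P p) ⊞ neg (P p)      ≡⟨ cong ((x ⊞ P p) ⊞_) (P-N p) ⟨
    (x ⊞ P p) ⊞ P (N p)        ≡⟨ ⊕-⊞ _ _ ⟨
    (x ⊞ P p) ⊕ P (N p)        ∎)
    where open ≡-Reasoning

  traceFace-dart : ∀ x p → traceFace embedding (dart x p) ≡ dart (x ⊞ P p) (F p)
  traceFace-dart x p = trans (cong (ρ embedding) (reverse-dart x p)) (ρ-dart _ (N p))

  isBiembedding : IsBiembedding embedding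
  isBiembedding = (λ e → colour (direction e)) ,
    dart-elim _ (λ x p → trans (colours (traceFace-dart x p)) (begin
      colour (succ (N p))        ≡⟨ colour-succ (N p) ⟩
      not (colour (N p))         ≡⟨ cong not (colour-N p) ⟩
      not (not (colour p))       ≡⟨ not-involutive _ ⟩
      colour p                   ≡⟨ cong colour (direction-dart x p) ⟨
      colour (direction (dart x p)) ∎)) ,
    dart-elim _ (λ x p eq → not-¬ refl (begin
      colour p                                ≡⟨ cong colour (direction-dart x p) ⟨
      colour (direction (dart x p))           ≡⟨ eq ⟨
      colour (direction (reverse (dart x p))) ≡⟨ colours (reverse-dart x p) ⟩
      colour (N p)                            ≡⟨ colour-N p ⟩
      not (colour p)                          ∎))
    where
    open ≡-Reasoning
    colours : ∀ {e y q} → e ≡ dart y q → colour (direction e) ≡ colour q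
    colours {y = y} {q} refl = cong colour (direction-dart y q)

  private
    trace : Fin v × Pos → Fin v × Pos
    trace (x , p) = x ⊞ P p , F p

    trace-iterate : ∀ x p j → iterate trace (x , p) j ≡ (x ⊞ orbitSum j p , iterate F p j)
    trace-iterate x p zero    = cong (_, p) (sym (⊞-identityʳ x))
    trace-iterate x p (suc j) = trans (trace-iterate (x ⊞ P p) (F p) j) (cong (_, _) (⊞-assoc x (P p) _))

  -- Starting the closed walk one dart later only moves its first voltage to the end. The two sides
  -- come from computing `suc k` steps of `trace` in two ways.
  orbitSum-F : ∀ k p → iterate F p k ≡ p → orbitSum k (F p) ≡ orbitSum k p
  orbitSum-F k p period = begin
    orbitSum k (F p)
      ≡⟨ solve 2 (λ x y → x := (:- y) :+ ((con (+ 0) :+ y) :+ x)) refl _ (P p) ⟩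
    neg (P p) ⊞ ((⟦ 0 ⟧ ⊞ P p) ⊞ orbitSum k (F p))
      ≡⟨ cong (neg (P p) ⊞_) (cong proj₁ (begin
           (_ , _)                                        ≡⟨ trace-iterate (⟦ 0 ⟧ ⊞ P p) (F p) k ⟨
           iterate trace (⟦ 0 ⟧ , p) (suc k)              ≡⟨ iterate-suc trace _ k ⟩
           trace (iterate trace (⟦ 0 ⟧ , p) k)            ≡⟨ cong trace (trace-iterate ⟦ 0 ⟧ p k) ⟩
           trace (⟦ 0 ⟧ ⊞ orbitSum k p , iterate F p k)   ≡⟨ cong (λ q → trace (⟦ 0 ⟧ ⊞ orbitSum k p , q)) period ⟩
           trace (⟦ 0 ⟧ ⊞ orbitSum k p , p)               ∎)) ⟩
    neg (P p) ⊞ ((⟦ 0 ⟧ ⊞ orbitSum k p) ⊞ P p)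
      ≡⟨ solve 2 (λ x y → (:- y) :+ ((con (+ 0) :+ x) :+ y) := x) refl _ (P p) ⟩
    orbitSum k p ∎
    where open ≡-Reasoning

  module _ (k : ℕ) .{{_ : NonZero k}}
           (period   : ∀ p → iterate F p k ≡ p)
           (distinct : ∀ p {i j} → i < k → j < k → iterate F p i ≡ iterate F p j → i ≡ j)
           (sum≢0    : ∀ p → orbitSum k p ≢ ⟦ 0 ⟧) where

    private
      iterate-multiple : ∀ x p a → iterate trace (x , p) (a * k) ≡ (x ⊞ ⟦ a ⟧ ⊗ orbitSum k p , p)
      iterate-multiple x p zero = cong (_, p)
        (solve 2 (λ x s → x := x :+ con (+ 0) :* s) refl x (orbitSum k p))
      iterate-multiple x p (suc a) = begin
        iterate trace (x , p) (k + a * k)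
          ≡⟨ iterate-+ trace (x , p) k (a * k) ⟩
        iterate trace (iterate trace (x , p) k) (a * k)
          ≡⟨ cong (λ z → iterate trace z (a * k)) (trace-iterate x p k) ⟩
        iterate trace (x ⊞ s , iterate F p k) (a * k)
          ≡⟨ cong (λ q → iterate trace (x ⊞ s , q) (a * k)) (period p) ⟩
        iterate trace (x ⊞ s , p) (a * k)
          ≡⟨ iterate-multiple (x ⊞ s) p a ⟩
        (x ⊞ s ⊞ ⟦ a ⟧ ⊗ s , p)
          ≡⟨ cong (_, p) (solve 3 (λ x s a → (x :+ s) :+ a :* s := x :+ (con (+ 1) :+ a) :* s) refl x s ⟦ a ⟧) ⟩
        (x ⊞ (⟦ 1 ⟧ ⊞ ⟦ a ⟧) ⊗ s , p)
          ≡⟨ cong (λ z → x ⊞ z ⊗ s , p) (⟦⟧-+ 1 a) ⟩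
        (x ⊞ ⟦ suc a ⟧ ⊗ s , p) ∎
        where
        open ≡-Reasoning
        s = orbitSum k p

      iterate-divMod : ∀ x p i → iterate trace (x , p) i ≡
        ((x ⊞ ⟦ i / k ⟧ ⊗ orbitSum k p) ⊞ orbitSum (i % k) p , iterate F p (i % k))
      iterate-divMod x p i = begin
        iterate trace (x , p) i
          ≡⟨ cong (iterate trace (x , p)) (trans (m≡m%n+[m/n]*n i k) (+-comm (i % k) _)) ⟩
        iterate trace (x , p) (i / k * k + i % k)
          ≡⟨ iterate-+ trace (x , p) (i / k * k) (i % k) ⟩
        iterate trace (iterate trace (x , p) (i / k * k)) (i % k)
          ≡⟨ cong (λ z → iterate trace z (i % k)) (iterate-multiple x p (i / k)) ⟩
        iterate trace (x ⊞ ⟦ i / k ⟧ ⊗ orbitSum k p , p) (i % k)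
          ≡⟨ trace-iterate _ p (i % k) ⟩
        _ ∎
        where open ≡-Reasoning

    -- One turn around an orbit of `F` displaces the vertex by the orbit sum, so the face closes up
    -- only after as many turns as the additive order of that sum. The order exceeds 1 because the
    -- sum is not zero.
    faceLength : ∀ e → ∃[ o ] (1 < o × (Prime v → o ≡ v) × FaceLength embedding e (o * k))
    faceLength = dart-elim _ λ x p →
      let s = orbitSum k p
          open Order (additiveOrder s (sum≢0 p))
          traces : ∀ i → iterate (traceFace embedding) (dart x p) i ≡
                         (let y , q = iterate trace (x , p) i in dart y q)
          traces i = sym (iterate-map (λ (y , q) → dart y q) (λ (y , q) → sym (traceFace-dart y q)) (x , p) i)

          injective : ∀ {i j} → i < order * k → j < order * k → iterate trace (x , p) i ≡ iterate trace (x , p) j → i ≡ j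
          injective {i} {j} i< j< eq =
            let eq′  = trans (sym (iterate-divMod x p i)) (trans eq (iterate-divMod x p j))
                -- Equal darts force equal remainders modulo `k`. The partial sums then cancel, and
                -- equal multiples of `s` force equal quotients because both quotients are below the
                -- order.
                rem≡ = distinct p (m%n<n i k) (m%n<n j k) (cong proj₂ eq′)
                quo≡ = multiples-distinct (m<n*o⇒m/o<n i<) (m<n*o⇒m/o<n j<)
                         (cancel x (⟦ i / k ⟧ ⊗ s) (⟦ j / k ⟧ ⊗ s) (orbitSum (j % k) p)
                           (trans (cong (λ r → (x ⊞ ⟦ i / k ⟧ ⊗ s) ⊞ orbitSum r p) (sym rem≡)) (cong proj₁ eq′)))
            in begin
              i                    ≡⟨ m≡m%n+[m/n]*n i k ⟩
              i % k + i / k * k    ≡⟨ cong₂ (λ a b → a + b * k) rem≡ quo≡ ⟩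
              j % k + j / k * k    ≡⟨ m≡m%n+[m/n]*n j k ⟨
              j                    ∎
      in order , order>1 , order-prime ,
         >-nonZero⁻¹ (order * k) {{m*n≢0 order k}} ,
         (λ {i} {j} eq → toℕ-injective (injective (toℕ<n i) (toℕ<n j)
            (let a , b = dart-injective (trans (sym (traces (toℕ i))) (trans eq (traces (toℕ j)))) in cong₂ _,_ a b))) ,
         trans (traces (order * k)) (cong (λ (y , q) → dart y q) (trans (iterate-multiple x p order) (cong (_, p) (begin
           x ⊞ ⟦ order ⟧ ⊗ s  ≡⟨ cong (x ⊞_) annihilates ⟩
           x ⊞ ⟦ 0 ⟧          ≡⟨ ⊞-identityʳ x ⟩
           x                  ∎))))
      where
      open ≡-Reasoning
      cancel : ∀ x a b c → (x ⊞ a) ⊞ c ≡ (x ⊞ b) ⊞ c → a ≡ b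
      cancel x a b c eq = begin
        a                                  ≡⟨ solve 3 (λ x a c → a := ((x :+ a) :+ c) :+ (:- (x :+ c))) refl x a c ⟩
        ((x ⊞ a) ⊞ c) ⊞ neg (x ⊞ c)        ≡⟨ cong (_⊞ neg (x ⊞ c)) eq ⟩
        ((x ⊞ b) ⊞ c) ⊞ neg (x ⊞ c)        ≡⟨ solve 3 (λ x a c → ((x :+ a) :+ c) :+ (:- (x :+ c)) := a) refl x b c ⟩
        b                                  ∎

-- Automorphisms of derived embeddings

module _ {v t : ℕ} .{{_ : NonZero v}} .{{_ : NonZero t}} (V : VoltageMap v t) where
  open Residues v
  open VoltageMap V
  open Derived V

  -- An automorphism σ of the derived map sends the darts at x to those at σ x by
  -- u x; it is orientation preserving for step = succ and reversing for step = pred.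
  record Symmetry (step : Pos → Pos) : Set where
    field
      σ      : Fin v → Fin v
      u      : Fin v → Pos → Pos
      σ-u    : ∀ x p → σ (x ⊞ P p) ≡ σ x ⊞ P (u x p)
      u-succ : ∀ x p → u x (succ p) ≡ step (u x p)
      N-u    : ∀ x p → N (u x p) ≡ u (x ⊞ P p) (N p)
      u-injective : ∀ x {p q} → u x p ≡ u x q → p ≡ q

  module _ (τ : GraphAutomorphism Γ) where
    private
      u : Fin v → Pos → Pos
      u x p = direction (onEdges τ (dart x p))

      onEdges-dart : ∀ x p → onEdges τ (dart x p) ≡ dart (app τ x) (u x p)
      onEdges-dart x p = sym (dart-direction (onEdges τ (dart x p)))

      direction-of : ∀ {e y q} → e ≡ dart y q → direction e ≡ q
      direction-of {y = y} {q} refl = direction-dart y q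

    private
      app-injective : ∀ {x y} → app τ x ≡ app τ y → x ≡ y
      app-injective {x} {y} eq = trans (sym (Inverse.strictlyInverseʳ bijection x))
        (trans (cong (Inverse.from bijection) eq) (Inverse.strictlyInverseʳ bijection y))
        where open GraphAutomorphism τ using (bijection)

    -- With `turn` equal to `ρ` or to `ρ⁻¹` this covers both kinds of automorphism at once.
    aut⇒symmetry : (step : Pos → Pos) (turn : OrientedEdge Γ → OrientedEdge Γ) →
                   (∀ x p → turn (dart x p) ≡ dart x (step p)) →
                   (∀ e → onEdges τ (ρ embedding e) ≡ turn (onEdges τ e)) → Symmetry step
    aut⇒symmetry step turn turn-dart aut = record
      { σ = app τ
      ; u = u
      ; σ-u = λ x p → begin
          app τ (x ⊞ P p)            ≡⟨ cong (app τ) (⊕-⊞ x (P p)) ⟨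
          app τ (x ⊕ P p)            ≡⟨ cong target (onEdges-dart x p) ⟩
          app τ x ⊕ P (u x p)        ≡⟨ ⊕-⊞ _ _ ⟩
          app τ x ⊞ P (u x p)        ∎
      ; u-succ = λ x p → direction-of (begin
          onEdges τ (dart x (succ p))       ≡⟨ cong (onEdges τ) (ρ-dart x p) ⟨
          onEdges τ (ρ embedding (dart x p)) ≡⟨ aut (dart x p) ⟩
          turn (onEdges τ (dart x p))       ≡⟨ cong turn (onEdges-dart x p) ⟩
          turn (dart (app τ x) (u x p))     ≡⟨ turn-dart _ _ ⟩
          dart (app τ x) (step (u x p))     ∎)
      ; N-u = λ x p → sym (direction-of (begin
          onEdges τ (dart (x ⊞ P p) (N p))  ≡⟨ cong (onEdges τ) (reverse-dart x p) ⟨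
          onEdges τ (reverse (dart x p))    ≡⟨ edge-≡ refl refl ⟩
          reverse (onEdges τ (dart x p))    ≡⟨ cong reverse (onEdges-dart x p) ⟩
          reverse (dart (app τ x) (u x p))  ≡⟨ reverse-dart _ _ ⟩
          dart (app τ x ⊞ P (u x p)) (N (u x p)) ∎))
      ; u-injective = λ x {p} {q} eq → P-injective (⊞-cancelˡ x (P p) (P q)
          (trans (sym (⊕-⊞ x (P p))) (trans (app-injective (begin
            app τ (x ⊕ P p)       ≡⟨ cong target (onEdges-dart x p) ⟩
            app τ x ⊕ P (u x p)   ≡⟨ cong (λ r → app τ x ⊕ P r) eq ⟩
            app τ x ⊕ P (u x q)   ≡⟨ cong target (onEdges-dart x q) ⟨
            app τ (x ⊕ P q)       ∎)) (⊕-⊞ x (P q)))))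
      }
      where open ≡-Reasoning

  private
    translation : Fin v → GraphAutomorphism Γ
    translation g = record
      { bijection = mk↔ₛ′ (_⊕ g) (_⊖ g)
          (λ x → trans (⊕-⊞ _ g) (trans (cong (_⊞ g) (⊖-neg x g))
             (solve 2 (λ x g → (x :+ (:- g)) :+ g := x) refl x g)))
          (λ x → trans (⊖-neg _ g) (trans (cong (_⊞ neg g) (⊕-⊞ x g))
             (solve 2 (λ x g → (x :+ g) :+ (:- g) := x) refl x g)))
      ; adj⇔ = λ {x} {y} → mk⇔ (subst (λ z → ¬ InJ v t z) (sym (shift x y))) (subst (λ z → ¬ InJ v t z) (shift x y))
      }
      where
      shift : ∀ x y → (x ⊕ g) ⊖ (y ⊕ g) ≡ x ⊖ y
      shift x y = begin
        (x ⊕ g) ⊖ (y ⊕ g)         ≡⟨ ⊖-neg _ _ ⟩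
        (x ⊕ g) ⊞ neg (y ⊕ g)     ≡⟨ cong₂ (λ a b → a ⊞ neg b) (⊕-⊞ x g) (⊕-⊞ y g) ⟩
        (x ⊞ g) ⊞ neg (y ⊞ g)     ≡⟨ solve 3 (λ x y g → (x :+ g) :+ (:- (y :+ g)) := x :+ (:- y)) refl x y g ⟩
        x ⊞ neg y                 ≡⟨ ⊖-neg x y ⟨
        x ⊖ y                     ∎
        where open ≡-Reasoning

    translation-dart : ∀ g x p → onEdges (translation g) (dart x p) ≡ dart (x ⊕ g) p
    translation-dart g x p = edge-≡ refl (begin
      (x ⊕ P p) ⊕ g   ≡⟨ trans (⊕-⊞ _ g) (cong (_⊞ g) (⊕-⊞ x (P p))) ⟩
      (x ⊞ P p) ⊞ g   ≡⟨ solve 3 (λ x y g → (x :+ y) :+ g := (x :+ g) :+ y) refl x (P p) g ⟩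
      (x ⊞ g) ⊞ P p   ≡⟨ trans (⊕-⊞ _ (P p)) (cong (_⊞ P p) (⊕-⊞ x g)) ⟨
      (x ⊕ g) ⊕ P p   ∎)
      where open ≡-Reasoning

    translation-aut : ∀ g e → onEdges (translation g) (ρ embedding e) ≡ ρ embedding (onEdges (translation g) e)
    translation-aut g = dart-elim _ λ x p → begin
      onEdges (translation g) (ρ embedding (dart x p)) ≡⟨ cong (onEdges (translation g)) (ρ-dart x p) ⟩
      onEdges (translation g) (dart x (succ p))        ≡⟨ translation-dart g x (succ p) ⟩
      dart (x ⊕ g) (succ p)                            ≡⟨ ρ-dart (x ⊕ g) p ⟨
      ρ embedding (dart (x ⊕ g) p)                     ≡⟨ cong (ρ embedding) (translation-dart g x p) ⟨
      ρ embedding (onEdges (translation g) (dart x p)) ∎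
      where open ≡-Reasoning

  autIsTranslations : (∀ (S : Symmetry succ) x → Symmetry.σ S x ≡ x ⊞ Symmetry.σ S ⟦ 0 ⟧) → ¬ Symmetry pred →
                      AutIsTranslations embedding
  autIsTranslations rotations ¬reflection =
    (λ { τ (inj₁ aut) → app τ ⟦ 0 ⟧ ,
           λ x → trans (rotations (aut⇒symmetry τ succ (ρ embedding) ρ-dart aut) x) (sym (⊕-⊞ x _))
       ; τ (inj₂ aut) → ⊥-elim (¬reflection (aut⇒symmetry τ pred (ρ⁻¹ embedding) ρ⁻¹-dart aut)) }) ,
    (λ g → translation g , (λ x → refl) , inj₁ (translation-aut g))

-- The one-vertex map

-- The rows of the array are the cycles of f, its columns are those of g.  The dart (c , b)
-- of the cell c has the colour b.
module Skeleton (h l : ℕ) where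

  n k : ℕ
  n = suc (h + h)
  k = 3 + (l + l)

  open Residues n
  module L = Residues k

  Row Level Cell Pos : Set
  Row   = Fin n
  Level = Fin k
  Cell  = Row × Level
  Pos   = Cell × Bool

  up down : Level → Level
  up d   = d L.⊞ L.⟦ 1 ⟧
  down d = d L.⊞ L.neg L.⟦ 1 ⟧

  down-up : ∀ d → down (up d) ≡ d
  down-up d = L.solve 1 (λ d → (d L.:+ L.con (+ 1)) L.:+ (L.:- L.con (+ 1)) L.:= d) refl d

  up-down : ∀ d → up (down d) ≡ d
  up-down d = L.solve 1 (λ d → (d L.:+ (L.:- L.con (+ 1))) L.:+ L.con (+ 1) L.:= d) refl d

  up-⟦⟧ : ∀ i → up L.⟦ i ⟧ ≡ L.⟦ suc i ⟧
  up-⟦⟧ i = trans (L.⟦⟧-+ i 1) (cong L.⟦_⟧ (+-comm i 1))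

  toℕ-up : ∀ d → suc (toℕ d) < k → toℕ (up d) ≡ suc (toℕ d)
  toℕ-up d d< = trans (cong toℕ (trans (cong up (sym (L.⟦⟧-toℕ d))) (up-⟦⟧ (toℕ d)))) (L.toℕ-⟦⟧-small d<)

  up-last : ∀ d → suc (toℕ d) ≡ k → up d ≡ 0F
  up-last d d≡ = trans (trans (cong up (sym (L.⟦⟧-toℕ d))) (up-⟦⟧ (toℕ d)))
    (trans (cong L.⟦_⟧ d≡) (trans L.⟦v⟧ (L.⟦⟧-toℕ 0F)))

  up-0 : up 0F ≡ 1F
  up-0 = toℕ-injective (toℕ-up 0F (s<s z<s))

  up-1 : up 1F ≡ 2F
  up-1 = toℕ-injective (toℕ-up 1F (s<s (s<s z<s)))

  down-1 : down 1F ≡ 0F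
  down-1 = trans (cong down (sym up-0)) (down-up 0F)

  down≡0⇒ : ∀ {d} → down d ≡ 0F → d ≡ 1F
  down≡0⇒ {d} eq = trans (sym (up-down d)) (trans (cong up eq) up-0)

  up≡1⇒ : ∀ {d} → up d ≡ 1F → d ≡ 0F
  up≡1⇒ {d} eq = trans (sym (down-up d)) (trans (cong down eq) down-1)

  ± : ℕ → Row
  ± zero    = ⟦ 1 ⟧
  ± (suc i) = neg (± i)

  private
    ±-double : ∀ i → ± (i + i) ≡ ⟦ 1 ⟧
    ±-double zero    = refl
    ±-double (suc i) = trans (cong (neg ∘ ±) (+-suc i i)) (trans (neg-involutive _) (±-double i))

  -- The sign with which a translation of the rows at level 1 reappears at level d when it
  -- is transported by f ∘ g.
  orientation : Level → Row
  orientation 0F            = neg ⟦ 1 ⟧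
  orientation 1F            = ⟦ 1 ⟧
  orientation (suc (suc d)) = ± (toℕ d)

  -- The sign alternates from each level to the next except from 1 to 2. An exception is
  -- unavoidable, since the cycle of levels has odd length.
  orientation-up : ∀ d → d ≢ 1F → orientation (up d) ≡ neg (orientation d)
  orientation-up 0F _ = trans (cong orientation up-0) (sym (neg-involutive _))
  orientation-up 1F d≢1 = contradiction refl d≢1
  orientation-up (suc (suc d)) _ with m≤n⇒m<n∨m≡n (toℕ<n (suc (suc d)))
  ... | inj₂ last = trans (cong orientation (up-last (suc (suc d)) last))
        (cong neg (sym (trans (cong ± (suc-injective (suc-injective (suc-injective last)))) (±-double l))))
  ... | inj₁ inner with up (suc (suc d)) | toℕ-up (suc (suc d)) inner
  ...   | suc (suc (suc d′)) | eq = cong ± (suc-injective (suc-injective eq))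

  orientation-up-0 : orientation (up 0F) ≡ ⟦ 1 ⟧
  orientation-up-0 = cong orientation up-0

  orientation-up-1 : orientation (up 1F) ≡ ⟦ 1 ⟧
  orientation-up-1 = cong orientation up-1

  -- Taken in the order 0, 1, 2 the three non-trivial moves compose to the identity, so the cycles
  -- of `g` close after `k` steps. But f ∘ g climbs two levels at a time and, `k` being odd, meets
  -- them in the order 0, 2, ..., 1, 3, ...; in the order 0, 2, 1 the moves compose to the
  -- translation by -2.
  move unmove : Level → Row → Row
  move 0F                  x = neg x
  move 1F                  x = neg x ⊞ neg ⟦ 1 ⟧
  move 2F                  x = x ⊞ ⟦ 1 ⟧
  move (suc (suc (suc _))) x = x
  unmove 0F                  x = neg x
  unmove 1F                  x = neg x ⊞ neg ⟦ 1 ⟧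
  unmove 2F                  x = x ⊞ neg ⟦ 1 ⟧
  unmove (suc (suc (suc _))) x = x

  move-unmove : ∀ d x → move d (unmove d x) ≡ x
  move-unmove 0F x = neg-involutive x
  move-unmove 1F x = solve 1 (λ x → (:- ((:- x) :+ (:- con (+ 1)))) :+ (:- con (+ 1)) := x) refl x
  move-unmove 2F x = solve 1 (λ x → (x :+ (:- con (+ 1))) :+ con (+ 1) := x) refl x
  move-unmove (suc (suc (suc _))) x = refl

  unmove-move : ∀ d x → unmove d (move d x) ≡ x
  unmove-move 0F x = neg-involutive x
  unmove-move 1F x = solve 1 (λ x → (:- ((:- x) :+ (:- con (+ 1)))) :+ (:- con (+ 1)) := x) refl x
  unmove-move 2F x = solve 1 (λ x → (x :+ con (+ 1)) :+ (:- con (+ 1)) := x) refl x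
  unmove-move (suc (suc (suc _))) x = refl

  f f⁻¹ g g⁻¹ : Cell → Cell
  f   (x , d) = x , up d
  f⁻¹ (x , d) = x , down d
  g   (x , d) = move d x , up d
  g⁻¹ (x , d) = unmove (down d) x , down d

  f-f⁻¹ : ∀ c → f (f⁻¹ c) ≡ c
  f-f⁻¹ (x , d) = cong (x ,_) (up-down d)

  f⁻¹-f : ∀ c → f⁻¹ (f c) ≡ c
  f⁻¹-f (x , d) = cong (x ,_) (down-up d)

  g-g⁻¹ : ∀ c → g (g⁻¹ c) ≡ c
  g-g⁻¹ (x , d) = cong₂ _,_ (move-unmove (down d) x) (up-down d)

  g⁻¹-g : ∀ c → g⁻¹ (g c) ≡ c
  g⁻¹-g (x , d) = cong₂ _,_ (trans (cong (λ e → unmove e (move d x)) (down-up d)) (unmove-move d x)) (down-up d)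

  succ pred N : Pos → Pos
  succ (c , false) = c , true
  succ (c , true)  = f (g c) , false
  pred (c , false) = g⁻¹ (f⁻¹ c) , true
  pred (c , true)  = c , false
  N (c , false)    = g⁻¹ c , true
  N (c , true)     = g c , false

  succ-pred : ∀ p → succ (pred p) ≡ p
  succ-pred (c , false) = cong (_, false) (trans (cong f (g-g⁻¹ (f⁻¹ c))) (f-f⁻¹ c))
  succ-pred (c , true)  = refl

  pred-succ : ∀ p → pred (succ p) ≡ p
  pred-succ (c , false) = refl
  pred-succ (c , true)  = cong (_, true) (trans (cong g⁻¹ (f⁻¹-f (g c))) (g⁻¹-g c))

  N-involutive : ∀ p → N (N p) ≡ p
  N-involutive (c , false) = cong (_, false) (g-g⁻¹ c)
  N-involutive (c , true)  = cong (_, true) (g⁻¹-g c)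

  shiftCell : Row → Cell → Cell
  shiftCell e (x , d) = x ⊞ orientation d ⊗ e , d

  shift : Row → Pos → Pos
  shift e (c , b) = shiftCell e c , b

  move-shift-0 : ∀ x e → move 0F (x ⊞ orientation 0F ⊗ e) ≡ move 0F x ⊞ orientation (up 0F) ⊗ e
  move-shift-0 x e = trans
    (solve 2 (λ x e → :- (x :+ (:- con (+ 1)) :* e) := (:- x) :+ con (+ 1) :* e) refl x e)
    (cong (λ o → neg x ⊞ o ⊗ e) (sym orientation-up-0))

  move-shift : ∀ d → d ≢ 0F → ∀ x e → move d (x ⊞ orientation d ⊗ e) ≡ move d x ⊞ orientation (up d) ⊗ neg e
  move-shift 0F d≢0 x e = contradiction refl d≢0
  move-shift 1F d≢0 x e = trans
    (solve 2 (λ x e → (:- (x :+ con (+ 1) :* e)) :+ (:- con (+ 1)) := ((:- x) :+ (:- con (+ 1))) :+ con (+ 1) :* (:- e)) refl x e)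
    (cong (λ o → move 1F x ⊞ o ⊗ neg e) (sym orientation-up-1))
  move-shift 2F d≢0 x e = trans
    (solve 2 (λ x e → (x :+ con (+ 1) :* e) :+ con (+ 1) := (x :+ con (+ 1)) :+ (:- con (+ 1)) :* (:- e)) refl x e)
    (cong (λ o → move 2F x ⊞ o ⊗ neg e) (sym (orientation-up 2F (λ ()))))
  move-shift d@(suc (suc (suc _))) d≢0 x e = trans
    (solve 3 (λ x o e → x :+ o :* e := x :+ (:- o) :* (:- e)) refl x (orientation d) e)
    (cong (λ o → x ⊞ o ⊗ neg e) (sym (orientation-up d (λ ()))))

  -- Two exceptions cancel. `move` inverts shifts except at level 0, and passing to the next level
  -- flips the orientation except from level 1 to level 2; `g` brings a cell to level 1 exactly when
  -- it starts at level 0.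
  f-g-shift : ∀ e c → f (g (shiftCell e c)) ≡ shiftCell e (f (g c))
  f-g-shift e (x , 0F) = cong (_, up (up 0F)) (trans (move-shift-0 x e)
    (cong (λ o → move 0F x ⊞ o ⊗ e) (trans orientation-up-0 (sym (trans (cong (orientation ∘ up) up-0) orientation-up-1)))))
  f-g-shift e (x , d@(suc _)) = cong (_, up (up d)) (trans (move-shift d (λ ()) x e)
    (trans (solve 3 (λ y o e → y :+ o :* (:- e) := y :+ (:- o) :* e) refl (move d x) (orientation (up d)) e)
      (cong (λ o → move d x ⊞ o ⊗ e) (sym (orientation-up (up d) λ eq → contradiction (up≡1⇒ eq) λ ())))))

  shift-succ : ∀ e p → shift e (succ p) ≡ succ (shift e p)
  shift-succ e (c , false) = refl
  shift-succ e (c , true)  = cong (_, false) (sym (f-g-shift e c))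

  -- The darts at which N commutes with the shifts; elsewhere N inverts them.
  data Straight : Pos → Set where
    even₁ : ∀ {x} → Straight ((x , 1F) , false)
    odd₀  : ∀ {x} → Straight ((x , 0F) , true)

  straight? : ∀ p → Dec (Straight p)
  straight? ((x , 0F) , true)               = yes odd₀
  straight? ((x , 1F) , true)               = no λ ()
  straight? ((x , suc (suc _)) , true)      = no λ ()
  straight? ((x , 0F) , false)              = no λ ()
  straight? ((x , 1F) , false)              = yes even₁
  straight? ((x , suc (suc _)) , false)     = no λ ()

  N-shift-straight : ∀ {p} → Straight p → ∀ e → N (shift e p) ≡ shift e (N p)
  N-shift-straight (odd₀ {x})  e = cong (λ y → (y , up 0F) , false) (move-shift-0 x e)
  N-shift-straight (even₁ {x}) e rewrite down-1 = cong (λ y → (y , 0F) , true)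
    (solve 2 (λ x e → :- (x :+ con (+ 1) :* e) := (:- x) :+ (:- con (+ 1)) :* e) refl x e)

  private
    g-shift : ∀ e x d → d ≢ 0F → g (shiftCell e (x , d)) ≡ shiftCell (neg e) (g (x , d))
    g-shift e x d d≢0 = cong (_, up d) (move-shift d d≢0 x e)

    g⁻¹-shift : ∀ e x d → d ≢ 1F → g⁻¹ (shiftCell e (x , d)) ≡ shiftCell (neg e) (g⁻¹ (x , d))
    g⁻¹-shift e x d d≢1 = begin
      g⁻¹ (shiftCell e (x , d))                      ≡⟨ cong (g⁻¹ ∘ shiftCell e) (g-g⁻¹ (x , d)) ⟨
      g⁻¹ (shiftCell e (g (g⁻¹ (x , d))))            ≡⟨ cong (λ e → g⁻¹ (shiftCell e (g (g⁻¹ (x , d))))) (neg-involutive e) ⟨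
      g⁻¹ (shiftCell (neg (neg e)) (g (g⁻¹ (x , d)))) ≡⟨ cong g⁻¹ (g-shift (neg e) _ (down d) (d≢1 ∘ down≡0⇒)) ⟨
      g⁻¹ (g (shiftCell (neg e) (g⁻¹ (x , d))))      ≡⟨ g⁻¹-g _ ⟩
      shiftCell (neg e) (g⁻¹ (x , d))                ∎
      where open ≡-Reasoning

  N-shift : ∀ {p} → ¬ Straight p → ∀ e → N (shift e p) ≡ shift (neg e) (N p)
  N-shift {(x , d) , true} bent e = cong (_, false) (g-shift e x d (λ { refl → bent odd₀ }))
  N-shift {(x , d) , false} bent e = cong (_, true) (g⁻¹-shift e x d (λ { refl → bent even₁ }))

  colour-succ : ∀ p → proj₂ (succ p) ≡ not (proj₂ p)
  colour-succ (c , false) = refl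
  colour-succ (c , true)  = refl

  colour-N : ∀ p → proj₂ (N p) ≡ not (proj₂ p)
  colour-N (c , false) = refl
  colour-N (c , true)  = refl

-- Transitivity of the rotation on darts

module Tour (h l : ℕ) where
  open Skeleton h l
  open Residues n

  private
    infix 4 _⇝_
    _⇝_ : Cell → Cell → Set
    c ⇝ c′ = ∃[ i ] iterate succ (c , false) i ≡ (c′ , false)

    ⇝-refl : ∀ {c c′} → c ≡ c′ → c ⇝ c′
    ⇝-refl eq = 0 , cong (_, false) eq

    infixr 5 _then_
    _then_ : ∀ {a b c} → a ⇝ b → b ⇝ c → a ⇝ c
    (i , p) then (j , q) = i + j , trans (iterate-+ succ _ i j) (trans (cong (λ z → iterate succ z j) p) q)

    step : ∀ c {c′} → f (g c) ≡ c′ → c ⇝ c′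
    step c eq = 2 , cong (_, false) eq

    up-up : ∀ i → up (up L.⟦ i ⟧) ≡ L.⟦ 2 + i ⟧
    up-up i = trans (cong up (up-⟦⟧ i)) (up-⟦⟧ (suc i))

    up-up-small : ∀ d → up (up d) ≡ L.⟦ 2 + toℕ d ⟧
    up-up-small d = trans (cong (up ∘ up) (sym (L.⟦⟧-toℕ d))) (up-up (toℕ d))

    move-large : ∀ {i} → 3 ≤ i → i < k → ∀ x → move L.⟦ i ⟧ x ≡ x
    move-large {i} 3≤i i<k x with L.⟦ i ⟧ | L.toℕ-⟦⟧-small i<k
    ... | 0F | refl = contradiction 3≤i λ ()
    ... | 1F | refl = contradiction 3≤i λ { (s≤s ()) }
    ... | 2F | refl = contradiction 3≤i λ { (s≤s (s≤s ())) }
    ... | suc (suc (suc _)) | _ = refl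

    -- The index may run up to `suc k`, one beyond `k`: the walk through the even levels from 4 ends
    -- at `k + 1`, which is level 1, and the one through the odd levels from 3 ends at `k`, which is
    -- level 0.
    along : ∀ x j i → 3 ≤ i → i + (j + j) ≤ suc k → (x , L.⟦ i ⟧) ⇝ (x , L.⟦ i + (j + j) ⟧)
    along x zero    i 3≤i i≤ = ⇝-refl (cong (λ i → x , L.⟦ i ⟧) (sym (+-identityʳ i)))
    along x (suc j) i 3≤i i≤ =
      step _ (cong₂ _,_ (move-large 3≤i i<k x) (up-up i))
      then along x j (2 + i) (m≤n⇒m≤1+n (m≤n⇒m≤1+n 3≤i)) (subst (_≤ suc k) shuffle i≤)
      then ⇝-refl (cong (λ i → x , L.⟦ i ⟧) (sym shuffle))
      where
      shuffle : i + (suc j + suc j) ≡ 2 + i + (j + j)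
      shuffle = trans (+-suc i (j + suc j)) (cong suc (trans (cong (_+_ i) (+-suc j j)) (+-suc i (j + j))))
      i<k : i < k
      i<k = s≤s⁻¹ (≤-trans (m≤m+n (2 + i) (j + j)) (subst (_≤ suc k) shuffle i≤))

    -- The first return to level 0, through the levels 0, 2, 4, ..., 1, 3, .... The reflection at
    -- level 0 is undone by the one at level 1, and what remains is the translation by -2.
    loop : ∀ x → (x , 0F) ⇝ (x ⊞ neg ⟦ 2 ⟧ , 0F)
    loop x =
      step _ (cong (neg x ,_) (trans (cong up up-0) up-1))
      then step _ (cong (neg x ⊞ ⟦ 1 ⟧ ,_) (up-up-small 2F))
      then along _ l 4 (s≤s (s≤s (s≤s z≤n))) ≤-refl
      then ⇝-refl (cong (neg x ⊞ ⟦ 1 ⟧ ,_)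
             (trans (sym (L.⟦⟧-+ 1 k)) (trans (cong (L.⟦ 1 ⟧ L.⊞_) L.⟦v⟧) (trans (L.⊞-identityʳ _) (L.⟦⟧-toℕ 1F)))))
      then step _ (cong (neg (neg x ⊞ ⟦ 1 ⟧) ⊞ neg ⟦ 1 ⟧ ,_) (up-up-small 1F))
      then along _ l 3 ≤-refl (n≤1+n k)
      then ⇝-refl (cong₂ _,_
             (solve 1 (λ x → (:- ((:- x) :+ con (+ 1))) :+ (:- con (+ 1)) := x :+ (:- con (+ 2))) refl x)
             (trans L.⟦v⟧ (L.⟦⟧-toℕ 0F)))

    loops : ∀ e x → (x , 0F) ⇝ (x ⊞ neg (⟦ 2 ⟧ ⊗ ⟦ e ⟧) , 0F)
    loops zero x = ⇝-refl (cong (_, 0F) (solve 1 (λ x → x := x :+ (:- (con (+ 2) :* con (+ 0)))) refl x))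
    loops (suc e) x = loop x then loops e _ then ⇝-refl (cong (_, 0F) (begin
      (x ⊞ neg ⟦ 2 ⟧) ⊞ neg (⟦ 2 ⟧ ⊗ ⟦ e ⟧)
        ≡⟨ solve 2 (λ x e → (x :+ (:- con (+ 2))) :+ (:- (con (+ 2) :* e)) := x :+ (:- (con (+ 2) :* (con (+ 1) :+ e)))) refl x ⟦ e ⟧ ⟩
      x ⊞ neg (⟦ 2 ⟧ ⊗ (⟦ 1 ⟧ ⊞ ⟦ e ⟧))   ≡⟨ cong (λ z → x ⊞ neg (⟦ 2 ⟧ ⊗ z)) (⟦⟧-+ 1 e) ⟩
      x ⊞ neg (⟦ 2 ⟧ ⊗ ⟦ suc e ⟧)         ∎))
      where open ≡-Reasoning

  2⊗half : ⟦ 2 ⟧ ⊗ ⟦ suc h ⟧ ≡ ⟦ 1 ⟧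
  2⊗half = trans (⟦⟧-* 2 (suc h)) (trans (cong ⟦_⟧ eq) (trans (sym (⟦⟧-+ 1 n)) (trans (cong (⟦ 1 ⟧ ⊞_) ⟦v⟧) (⊞-identityʳ _))))
    where
    eq : 2 * suc h ≡ 1 + n
    eq = cong suc (trans (+-suc h _) (cong (λ z → suc (h + z)) (+-identityʳ h)))

  private
    2⊗half-level : L.⟦ 2 ⟧ L.⊗ L.⟦ 2 + l ⟧ ≡ L.⟦ 1 ⟧
    2⊗half-level = trans (L.⟦⟧-* 2 (2 + l)) (trans (cong L.⟦_⟧ eq)
      (trans (sym (L.⟦⟧-+ 1 k)) (trans (cong (L.⟦ 1 ⟧ L.⊞_) L.⟦v⟧) (L.⊞-identityʳ _))))
      where
      eq : 2 * (2 + l) ≡ 1 + k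
      eq = cong (_+_ 2) (trans (cong (_+_ l) (+-identityʳ (2 + l))) (trans (+-suc l (suc l)) (cong suc (+-suc l l))))

    -- As `n` is odd, 2 is invertible with inverse `suc h`, so repeated translation by -2 reaches
    -- every row.
    around : ∀ x y → (x , 0F) ⇝ (y , 0F)
    around x y = loops (toℕ e) x then ⇝-refl (cong (_, 0F) (begin
      x ⊞ neg (⟦ 2 ⟧ ⊗ ⟦ toℕ e ⟧)      ≡⟨ cong (λ z → x ⊞ neg (⟦ 2 ⟧ ⊗ z)) (⟦⟧-toℕ e) ⟩
      x ⊞ neg (⟦ 2 ⟧ ⊗ (⟦ suc h ⟧ ⊗ (x ⊞ neg y)))
        ≡⟨ solve 4 (λ a b x y → x :+ (:- (a :* (b :* (x :+ (:- y))))) := x :+ (:- ((a :* b) :* (x :+ (:- y))))) refl ⟦ 2 ⟧ ⟦ suc h ⟧ x y ⟩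
      x ⊞ neg ((⟦ 2 ⟧ ⊗ ⟦ suc h ⟧) ⊗ (x ⊞ neg y))  ≡⟨ cong (λ z → x ⊞ neg (z ⊗ (x ⊞ neg y))) 2⊗half ⟩
      x ⊞ neg (⟦ 1 ⟧ ⊗ (x ⊞ neg y))
        ≡⟨ solve 2 (λ x y → x :+ (:- (con (+ 1) :* (x :+ (:- y)))) := y) refl x y ⟩
      y ∎))
      where
      open ≡-Reasoning
      e : Row
      e = ⟦ suc h ⟧ ⊗ (x ⊞ neg y)

    -- Since 2 is also invertible modulo `k`, steps of two levels lead from every cell to level 0;
    -- `descend` is the same walk traced backwards from the goal. The row reached is irrelevant, as
    -- `around` corrects it.
    ascend : ∀ i x d → ∃[ y ] (x , d) ⇝ (y , d L.⊞ L.⟦ 2 ⟧ L.⊗ L.⟦ i ⟧)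
    ascend zero x d = x , ⇝-refl (cong (x ,_) (L.solve 1 (λ d → d L.:= d L.:+ L.con (+ 2) L.:* L.con (+ 0)) refl d))
    ascend (suc i) x d =
      let y , path = ascend i (move d x) (up (up d))
      in y , (step (x , d) refl then path then ⇝-refl (cong (y ,_) (begin
        up (up d) L.⊞ L.⟦ 2 ⟧ L.⊗ L.⟦ i ⟧
          ≡⟨ L.solve 2 (λ d i → ((d L.:+ L.con (+ 1)) L.:+ L.con (+ 1)) L.:+ L.con (+ 2) L.:* i L.:= d L.:+ L.con (+ 2) L.:* (L.con (+ 1) L.:+ i)) refl d L.⟦ i ⟧ ⟩
        d L.⊞ L.⟦ 2 ⟧ L.⊗ (L.⟦ 1 ⟧ L.⊞ L.⟦ i ⟧)  ≡⟨ cong (λ z → d L.⊞ L.⟦ 2 ⟧ L.⊗ z) (L.⟦⟧-+ 1 i) ⟩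
        d L.⊞ L.⟦ 2 ⟧ L.⊗ L.⟦ suc i ⟧            ∎)))
      where open ≡-Reasoning

    descend : ∀ i x d → ∃[ y ] (y , d L.⊞ L.neg (L.⟦ 2 ⟧ L.⊗ L.⟦ i ⟧)) ⇝ (x , d)
    descend zero x d = x , ⇝-refl (cong (x ,_) (L.solve 1 (λ d → d L.:+ (L.:- (L.con (+ 2) L.:* L.con (+ 0))) L.:= d) refl d))
    descend (suc i) x d =
      let c = g⁻¹ (f⁻¹ (x , d))
          y , path = descend i (proj₁ c) (proj₂ c)
      in y , (⇝-refl (cong (y ,_) (begin
        d L.⊞ L.neg (L.⟦ 2 ⟧ L.⊗ L.⟦ suc i ⟧)
          ≡⟨ cong (λ z → d L.⊞ L.neg (L.⟦ 2 ⟧ L.⊗ z)) (L.⟦⟧-+ 1 i) ⟨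
        d L.⊞ L.neg (L.⟦ 2 ⟧ L.⊗ (L.⟦ 1 ⟧ L.⊞ L.⟦ i ⟧))
          ≡⟨ L.solve 2 (λ d i → d L.:+ (L.:- (L.con (+ 2) L.:* (L.con (+ 1) L.:+ i))) L.:= ((d L.:+ (L.:- L.con (+ 1))) L.:+ (L.:- L.con (+ 1))) L.:+ (L.:- (L.con (+ 2) L.:* i))) refl d L.⟦ i ⟧ ⟩
        down (down d) L.⊞ L.neg (L.⟦ 2 ⟧ L.⊗ L.⟦ i ⟧) ∎))
        then path then step c (trans (cong f (g-g⁻¹ _)) (f-f⁻¹ _)))
      where open ≡-Reasoning

    level-0 : ∀ d → L.⟦ 2 ⟧ L.⊗ L.⟦ toℕ (L.⟦ 2 + l ⟧ L.⊗ d) ⟧ ≡ d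
    level-0 d = begin
      L.⟦ 2 ⟧ L.⊗ L.⟦ toℕ (L.⟦ 2 + l ⟧ L.⊗ d) ⟧   ≡⟨ cong (L.⟦ 2 ⟧ L.⊗_) (L.⟦⟧-toℕ _) ⟩
      L.⟦ 2 ⟧ L.⊗ (L.⟦ 2 + l ⟧ L.⊗ d)             ≡⟨ L.⊗-assoc _ _ d ⟨
      L.⟦ 2 ⟧ L.⊗ L.⟦ 2 + l ⟧ L.⊗ d               ≡⟨ cong (L._⊗ d) 2⊗half-level ⟩
      L.⟦ 1 ⟧ L.⊗ d                               ≡⟨ L.⊗-identityˡ d ⟩
      d ∎
      where open ≡-Reasoning

    reach-even : ∀ c c′ → c ⇝ c′
    reach-even (x , d) (x′ , d′) =
      let y  , path  = ascend (toℕ (L.⟦ 2 + l ⟧ L.⊗ L.neg d)) x d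
          y′ , path′ = descend (toℕ (L.⟦ 2 + l ⟧ L.⊗ d′)) x′ d′
      in path
         then ⇝-refl (cong (y ,_) (trans (cong (d L.⊞_) (level-0 (L.neg d))) (trans (L.⊞-inverseʳ d) (L.⟦⟧-toℕ 0F))))
         then around y y′
         then ⇝-refl (cong (y′ ,_) (sym (trans (cong (λ z → d′ L.⊞ L.neg z) (level-0 d′)) (trans (L.⊞-inverseʳ d′) (L.⟦⟧-toℕ 0F)))))
         then path′

    reach-from-even : ∀ c q → ∃[ i ] iterate succ (c , false) i ≡ q
    reach-from-even c (c′ , false) = reach-even c c′
    reach-from-even c (c′ , true)  =
      let i , eq = reach-even c c′ in suc i , trans (iterate-suc succ (c , false) i) (cong succ eq)

  reach : ∀ p q → ∃[ i ] iterate succ p i ≡ q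
  reach (c , false) q = reach-from-even c q
  reach (c , true)  q = let i , eq = reach-from-even (f (g c)) q in suc i , eq

-- Rigidity

-- The prescribed labels make the derived embedding rigid.
record Labelling (h l v t : ℕ) .{{_ : NonZero v}} .{{_ : NonZero t}} : Set where
  open Skeleton h l using (Row; Cell)
  open Residues v
  module R = Residues (suc (h + h))
  field
    A           : Cell → Fin v
    A-injective : ∀ {c c′} → A c ≡ A c′ → c ≡ c′
    A-sign      : ∀ c c′ → A c ≢ neg (A c′)
    A∉J         : ∀ c → ¬ InJ v t (A c)
    A-locate    : ∀ z → InJ v t z ⊎ ∃[ c ] (A c ≡ z ⊎ neg (A c) ≡ z)
    A-one       : A (R.⟦ h ⟧ , 1F) ≡ ⟦ 1 ⟧
    A-two       : A (R.⟦ 0 ⟧ , 1F) ≡ ⟦ 2 ⟧ ⊎ A (R.⟦ 0 ⟧ , 1F) ≡ neg ⟦ 2 ⟧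
    A-pair₀     : A (R.⟦ 2 ⟧ , 0F) ≡ A (R.⟦ 1 ⟧ , 0F) ⊞ ⟦ 1 ⟧
    A-pair₂     : A (R.⟦ 2 ⟧ , 2F) ≡ A (R.⟦ 1 ⟧ , 2F) ⊞ ⟦ 1 ⟧
    h>0         : 0 < h
    3≢0         : ⟦ 3 ⟧ ≢ ⟦ 0 ⟧

module Labelled {h l v t : ℕ} .{{_ : NonZero v}} .{{_ : NonZero t}} (Λ : Labelling h l v t) where
  open Skeleton h l
  open Tour h l
  open Labelling Λ
  open Residues v

  private
    -- The dart `(c , true)` is the reverse of `(g c , false)`, and reversal has to negate voltages.
    voltage : Pos → Fin v
    voltage (c , false) = A c
    voltage (c , true)  = neg (A (g c))

    g-injective : ∀ {c c′} → g c ≡ g c′ → c ≡ c′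
    g-injective {c} {c′} eq = trans (sym (g⁻¹-g c)) (trans (cong g⁻¹ eq) (g⁻¹-g c′))

    voltage-injective : ∀ {p q} → voltage p ≡ voltage q → p ≡ q
    voltage-injective {c , false} {c′ , false} eq = cong (_, false) (A-injective eq)
    voltage-injective {c , false} {c′ , true}  eq = contradiction eq (A-sign c (g c′))
    voltage-injective {c , true}  {c′ , false} eq = contradiction (sym eq) (A-sign c′ (g c))
    voltage-injective {c , true}  {c′ , true}  eq = cong (_, true) (g-injective (A-injective (neg-injective eq)))

    voltage-N : ∀ p → voltage (N p) ≡ neg (voltage p)
    voltage-N (c , false) = cong (neg ∘ A) (g-g⁻¹ c)
    voltage-N (c , true)  = sym (neg-involutive _)

    voltage∉J : ∀ p → ¬ InJ v t (voltage p)
    voltage∉J (c , false) = A∉J c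
    voltage∉J (c , true)  = neg-∉J (A∉J (g c))

    voltage-locate : ∀ z → InJ v t z ⊎ ∃[ p ] voltage p ≡ z
    voltage-locate z with A-locate z
    ... | inj₁ inJ             = inj₁ inJ
    ... | inj₂ (c , inj₁ eq)   = inj₂ ((c , false) , eq)
    ... | inj₂ (c , inj₂ eq)   = inj₂ ((g⁻¹ c , true) , trans (cong (neg ∘ A) (g-g⁻¹ c)) eq)

  voltageMap : VoltageMap v t
  voltageMap = record
    { Pos = Pos ; succ = succ ; pred = pred ; N = N
    ; succ-pred = succ-pred ; pred-succ = pred-succ ; N-involutive = N-involutive ; reach = reach
    ; P = voltage ; P-injective = voltage-injective ; P-N = voltage-N ; P∉J = voltage∉J
    ; locate = voltage-locate ; one = (R.⟦ h ⟧ , 1F) , false ; P-one = A-one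
    ; colour = proj₂ ; colour-succ = colour-succ ; colour-N = colour-N }

  open VoltageMap voltageMap using (P; P-N; P-injective; one)

  private
    shift-shift : ∀ e e′ p → shift e (shift e′ p) ≡ shift (e R.⊞ e′) p
    shift-shift e e′ ((x , d) , b) = cong (λ y → (y , d) , b)
      (R.solve 4 (λ x o e e′ → (x R.:+ o R.:* e′) R.:+ o R.:* e R.:= x R.:+ o R.:* (e R.:+ e′)) refl x (orientation d) e e′)

    shift-0 : ∀ p → shift R.⟦ 0 ⟧ p ≡ p
    shift-0 ((x , d) , b) = cong (λ y → (y , d) , b) (R.solve 2 (λ x o → x R.:+ o R.:* R.con (+ 0) R.:= x) refl x (orientation d))

    shift-inverse : ∀ e p → shift (R.neg e) (shift e p) ≡ p
    shift-inverse e p = trans (shift-shift (R.neg e) e p) (trans (cong (λ e → shift e p) (R.⊞-inverseˡ e)) (shift-0 p))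

    double≡0 : ∀ {e} → e R.⊞ e ≡ R.⟦ 0 ⟧ → e ≡ R.⟦ 0 ⟧
    double≡0 {e} eq = begin
      e                                          ≡⟨ R.⊗-identityˡ e ⟨
      R.⟦ 1 ⟧ R.⊗ e                              ≡⟨ cong (R._⊗ e) 2⊗half ⟨
      R.⟦ 2 ⟧ R.⊗ R.⟦ suc h ⟧ R.⊗ e
        ≡⟨ R.solve 2 (λ a e → R.con (+ 2) R.:* a R.:* e R.:= a R.:* (e R.:+ e)) refl R.⟦ suc h ⟧ e ⟩
      R.⟦ suc h ⟧ R.⊗ (e R.⊞ e)                  ≡⟨ cong (R.⟦ suc h ⟧ R.⊗_) eq ⟩
      R.⟦ suc h ⟧ R.⊗ R.⟦ 0 ⟧                    ≡⟨ R.solve 1 (λ a → a R.:* R.con (+ 0) R.:= R.con (+ 0)) refl R.⟦ suc h ⟧ ⟩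
      R.⟦ 0 ⟧                                    ∎
      where open ≡-Reasoning

    neg≡⇒0 : ∀ {e} → R.neg e ≡ e → e ≡ R.⟦ 0 ⟧
    neg≡⇒0 {e} eq = double≡0 (trans (cong (R._⊞ e) (sym eq)) (R.⊞-inverseˡ e))

    neg1≢1 : R.neg R.⟦ 1 ⟧ ≢ R.⟦ 1 ⟧
    neg1≢1 eq = contradiction (begin
        1               ≡⟨ R.toℕ-⟦⟧-small (s<s (≤-trans h>0 (m≤m+n h h))) ⟨
        toℕ R.⟦ 1 ⟧     ≡⟨ cong toℕ (neg≡⇒0 eq) ⟩
        toℕ R.⟦ 0 ⟧     ≡⟨ R.toℕ-⟦⟧-small z<s ⟩
        0               ∎) λ ()
      where open ≡-Reasoning

    orientation² : ∀ d → orientation d R.⊗ orientation d ≡ R.⟦ 1 ⟧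
    orientation² d = unit d
      where
      flip² : ∀ {o} → o R.⊗ o ≡ R.⟦ 1 ⟧ → R.neg o R.⊗ R.neg o ≡ R.⟦ 1 ⟧
      flip² {o} eq = trans (R.solve 1 (λ o → (R.:- o) R.:* (R.:- o) R.:= o R.:* o) refl o) eq
      unit : ∀ d → orientation d R.⊗ orientation d ≡ R.⟦ 1 ⟧
      unit 0F = flip² (R.⊗-identityˡ _)
      unit 1F = R.⊗-identityˡ _
      unit (suc (suc d)) = ±² (toℕ d)
        where
        ±² : ∀ i → ± i R.⊗ ± i ≡ R.⟦ 1 ⟧
        ±² zero    = R.⊗-identityˡ _
        ±² (suc i) = flip² (±² i)

    shift-faithful : ∀ {e e′} p → shift e p ≡ shift e′ p → e ≡ e′
    shift-faithful {e} {e′} ((x , d) , b) eq = begin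
      e                                              ≡⟨ recover e ⟨
      orientation d R.⊗ ((x R.⊞ orientation d R.⊗ e) R.⊞ R.neg x)
        ≡⟨ cong (λ p → orientation d R.⊗ (proj₁ (proj₁ p) R.⊞ R.neg x)) eq ⟩
      orientation d R.⊗ ((x R.⊞ orientation d R.⊗ e′) R.⊞ R.neg x) ≡⟨ recover e′ ⟩
      e′                                             ∎
      where
      open ≡-Reasoning
      recover : ∀ e → orientation d R.⊗ ((x R.⊞ orientation d R.⊗ e) R.⊞ R.neg x) ≡ e
      recover e = trans
        (R.solve 3 (λ x o e → o R.:* ((x R.:+ o R.:* e) R.:+ (R.:- x)) R.:= (o R.:* o) R.:* e) refl x (orientation d) e)
        (trans (cong (R._⊗ e) (orientation² d)) (R.⊗-identityˡ e))

    -- shift e commutes with succ, hence is a power of it.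
    shift-power : ∀ e → ∃[ w ] ∀ p → shift e p ≡ iterate succ p w
    shift-power e =
      let w , eq = reach one (shift e one) in w , λ p →
      let i , eqᵢ = reach one p in begin
        shift e p                            ≡⟨ cong (shift e) eqᵢ ⟨
        shift e (iterate succ one i)         ≡⟨ iterate-map (shift e) (shift-succ e) one i ⟩
        iterate succ (shift e one) i         ≡⟨ cong (λ q → iterate succ q i) eq ⟨
        iterate succ (iterate succ one w) i  ≡⟨ iterate-+ succ one w i ⟨
        iterate succ one (w + i)             ≡⟨ cong (iterate succ one) (+-comm w i) ⟩
        iterate succ one (i + w)             ≡⟨ iterate-+ succ one i w ⟩
        iterate succ (iterate succ one i) w  ≡⟨ cong (λ q → iterate succ q w) eqᵢ ⟩
        iterate succ p w                     ∎
      where open ≡-Reasoning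

    β : Row → Pos
    β x = (x , 1F) , false

    Nβ : ∀ x → N (β x) ≡ ((R.neg x , 0F) , true)
    Nβ x rewrite down-1 = refl

    shift-β : ∀ e x → shift e (β x) ≡ β (x R.⊞ e)
    shift-β e x = cong (λ y → β (x R.⊞ y)) (R.⊗-identityˡ e)

    β-shift : ∀ x y → β y ≡ shift (y R.⊞ R.neg x) (β x)
    β-shift x y = sym (trans (shift-β _ x) (cong β (R.solve 2 (λ x y → x R.:+ (y R.:+ (R.:- x)) R.:= y) refl x y)))

    β-injective : ∀ {x y} → β x ≡ β y → x ≡ y
    β-injective eq = cong (proj₁ ∘ proj₁) eq

    data Kind : Pos → Set where
      front : ∀ x → Kind (β x)
      back  : ∀ x → Kind (N (β x))

    kind : ∀ {p} → Straight p → Kind p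
    kind (even₁ {x}) = front x
    kind (odd₀ {x})  = subst Kind (trans (Nβ (R.neg x)) (cong (λ y → (y , 0F) , true) (R.neg-involutive x))) (back (R.neg x))

    straight-shift : ∀ {p q} → Straight p → Straight q → proj₂ p ≡ proj₂ q → ∃[ e ] q ≡ shift e p
    straight-shift (even₁ {x}) (even₁ {y}) _ = _ , β-shift x y
    straight-shift (odd₀ {x}) (odd₀ {y}) _ = x R.⊞ R.neg y , cong (λ z → (z , 0F) , true)
      (R.solve 2 (λ x y → y R.:= x R.:+ (R.:- R.con (+ 1)) R.:* (x R.:+ (R.:- y))) refl x y)

    -- Both maps change the colour at each step, so the hypothesis says that `i` is even, and this
    -- does not depend on the starting dart.
    same-parity : ∀ {step step′ : Pos → Pos} → (∀ p → proj₂ (step p) ≡ not (proj₂ p)) → (∀ p → proj₂ (step′ p) ≡ not (proj₂ p)) →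
             ∀ p q i → proj₂ (iterate step p i) ≡ proj₂ p → proj₂ (iterate step′ q i) ≡ proj₂ q
    same-parity flip flip′ p q i eq = trans (iterate-map proj₂ flip′ q i)
      (transfer (proj₂ p) (proj₂ q) (trans (sym (iterate-map proj₂ flip p i)) eq))
      where
      transfer : ∀ b b′ → iterate not b i ≡ b → iterate not b′ i ≡ b′
      transfer false false eq = eq
      transfer true  true  eq = eq
      transfer false true  eq = trans (sym (iterate-map not (λ _ → refl) false i)) (cong not eq)
      transfer true  false eq = trans (sym (iterate-map not (λ _ → refl) true i)) (cong not eq)

    -- δ is the effect of conjugation by u on the shifts.
    module Rigidity {step : Pos → Pos} (flip : ∀ p → proj₂ (step p) ≡ not (proj₂ p))
                    (δ : Row → Row) (δ-involutive : ∀ e → δ (δ e) ≡ e) (δ-neg : ∀ e → δ (R.neg e) ≡ R.neg (δ e))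
                    (δ-iterate : ∀ e w → (∀ p → shift e p ≡ iterate succ p w) → ∀ p → iterate step p w ≡ shift (δ e) p)
                    (S : Symmetry voltageMap step) where
      open Symmetry S

      -- The shift is a power of `succ`, which `u x` turns into the same power of `step`; by
      -- `δ-iterate` that power is again a shift.
      u-shift : ∀ x e p → u x (shift e p) ≡ shift (δ e) (u x p)
      u-shift x e p = let w , eq = shift-power e in
        trans (cong (u x) (eq p)) (trans (iterate-map (u x) (u-succ x) p w) (δ-iterate e w eq (u x p)))

      -- A single common value suffices because `succ` is transitive on darts.
      agree : ∀ {x y} p → u x p ≡ u y p → ∀ q → u x q ≡ u y q
      agree {x} {y} p eq q = let i , eqᵢ = reach p q in begin
        u x q                      ≡⟨ cong (u x) eqᵢ ⟨
        u x (iterate succ p i)     ≡⟨ iterate-map (u x) (u-succ x) p i ⟩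
        iterate step (u x p) i     ≡⟨ cong (λ r → iterate step r i) eq ⟩
        iterate step (u y p) i     ≡⟨ iterate-map (u y) (u-succ y) p i ⟨
        u y (iterate succ p i)     ≡⟨ cong (u y) eqᵢ ⟩
        u y q                      ∎
        where open ≡-Reasoning

      -- If `p` and its image are both bent, reversal inverts the shift before and after applying
      -- `u`. Hence the values of `u` at the far ends of `p` and of its shift coincide at one dart,
      -- and so everywhere.
      agree-shifted : ∀ x p → ¬ Straight p → ¬ Straight (u x p) → ∀ q → u (x ⊞ P p) q ≡ u (x ⊞ P (shift R.⟦ 1 ⟧ p)) q
      agree-shifted x p bent bent′ = agree (N (shift e p)) (begin
        u (x ⊞ P p) (N (shift e p))              ≡⟨ cong (u (x ⊞ P p)) (N-shift bent e) ⟩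
        u (x ⊞ P p) (shift (R.neg e) (N p))      ≡⟨ u-shift _ (R.neg e) (N p) ⟩
        shift (δ (R.neg e)) (u (x ⊞ P p) (N p))  ≡⟨ cong₂ shift (δ-neg e) (sym (N-u x p)) ⟩
        shift (R.neg (δ e)) (N (u x p))          ≡⟨ N-shift bent′ (δ e) ⟨
        N (shift (δ e) (u x p))                  ≡⟨ cong N (u-shift x e p) ⟨
        N (u x (shift e p))                      ≡⟨ N-u x (shift e p) ⟩
        u (x ⊞ P (shift e p)) (N (shift e p))    ∎)
        where
        open ≡-Reasoning
        e = R.⟦ 1 ⟧

      -- Crossing the edge with label 1 from both vertices carries agreement one vertex further.
      agree-next : ∀ {x y} → (∀ q → u x q ≡ u y q) → ∀ q → u (x ⊞ ⟦ 1 ⟧) q ≡ u (y ⊞ ⟦ 1 ⟧) q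
      agree-next {x} {y} eq = agree (N one) (begin
        u (x ⊞ ⟦ 1 ⟧) (N one)  ≡⟨ cong (λ z → u (x ⊞ z) (N one)) A-one ⟨
        u (x ⊞ P one) (N one)  ≡⟨ N-u x one ⟨
        N (u x one)            ≡⟨ cong N (eq one) ⟩
        N (u y one)            ≡⟨ N-u y one ⟩
        u (y ⊞ P one) (N one)  ≡⟨ cong (λ z → u (y ⊞ z) (N one)) A-one ⟩
        u (y ⊞ ⟦ 1 ⟧) (N one)  ∎)
        where open ≡-Reasoning

      -- One pair of consecutive vertices in agreement is moved around all of ℤ_v by `agree-next`;
      -- this is why the prescribed pairs of labels differ by exactly 1.
      constant-from : ∀ a → (∀ q → u a q ≡ u (a ⊞ ⟦ 1 ⟧) q) → ∀ x q → u x q ≡ u ⟦ 0 ⟧ q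
      constant-from a eq x q = subst (λ y → u y q ≡ u ⟦ 0 ⟧ q) (⟦⟧-toℕ x) (from-0 (toℕ x))
        where
        open ≡-Reasoning
        along : ∀ j q → u (a ⊞ ⟦ j ⟧) q ≡ u (a ⊞ ⟦ j ⟧ ⊞ ⟦ 1 ⟧) q
        along zero    q = subst (λ y → u y q ≡ u (y ⊞ ⟦ 1 ⟧) q) (sym (⊞-identityʳ a)) (eq q)
        along (suc j) q = subst (λ y → u y q ≡ u (y ⊞ ⟦ 1 ⟧) q)
          (trans (⊞-assoc a _ _) (cong (a ⊞_) (trans (⟦⟧-+ j 1) (cong ⟦_⟧ (+-comm j 1))))) (agree-next (along j) q)
        everywhere : ∀ y q → u y q ≡ u (y ⊞ ⟦ 1 ⟧) q
        everywhere y q = subst (λ z → u z q ≡ u (z ⊞ ⟦ 1 ⟧) q)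
          (trans (cong (a ⊞_) (⟦⟧-toℕ _)) (solve 2 (λ a y → a :+ (y :+ (:- a)) := y) refl a y)) (along (toℕ (y ⊞ neg a)) q)
        from-0 : ∀ j → u ⟦ j ⟧ q ≡ u ⟦ 0 ⟧ q
        from-0 zero    = refl
        from-0 (suc j) = trans (cong (λ y → u y q) (trans (cong ⟦_⟧ (+-comm 1 j)) (sym (⟦⟧-+ j 1))))
          (trans (sym (everywhere ⟦ j ⟧ q)) (from-0 j))

      private
        p₀ p₂ : Pos
        p₀ = (R.⟦ 2 ⟧ , 0F) , false
        p₂ = (R.⟦ 1 ⟧ , 2F) , false

      u-colour : ∀ x p q → proj₂ p ≡ proj₂ q → proj₂ (u x p) ≡ proj₂ (u x q)
      u-colour x p q eq = let i , eqᵢ = reach p q in sym (begin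
        proj₂ (u x q)                        ≡⟨ cong (proj₂ ∘ u x) eqᵢ ⟨
        proj₂ (u x (iterate succ p i))       ≡⟨ cong proj₂ (iterate-map (u x) (u-succ x) p i) ⟩
        proj₂ (iterate step (u x p) i)
          ≡⟨ same-parity {step = succ} colour-succ flip p (u x p) i (trans (cong proj₂ eqᵢ) (sym eq)) ⟩
        proj₂ (u x p)                        ∎)
        where open ≡-Reasoning

      -- p₀ and p₂ have the same colour, and there is one straight class in each colour,
      -- so at most one of them can be sent to a straight dart.
      not-both-straight : ∀ x → Straight (u x p₀) → ¬ Straight (u x p₂)
      not-both-straight x s₀ s₂ =
        let e , eq = straight-shift s₀ s₂ (u-colour x p₀ p₂ refl)
            p₂≡ : p₂ ≡ shift (δ e) p₀
            p₂≡ = u-injective x (begin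
              u x p₂                        ≡⟨ eq ⟩
              shift e (u x p₀)              ≡⟨ cong (λ e → shift e (u x p₀)) (δ-involutive e) ⟨
              shift (δ (δ e)) (u x p₀)      ≡⟨ u-shift x (δ e) p₀ ⟨
              u x (shift (δ e) p₀)          ∎)
        in contradiction (cong (proj₂ ∘ proj₁) p₂≡) λ ()
        where open ≡-Reasoning

      -- The pair at level 0 yields the first agreement unless its image is straight; in that case
      -- the pair at level 2 does, by `not-both-straight`.
      constant : ∀ x q → u x q ≡ u ⟦ 0 ⟧ q
      constant with straight? (u ⟦ 0 ⟧ p₀)
      ... | no bent = constant-from (P (shift R.⟦ 1 ⟧ p₀)) λ q → begin
            u (P (shift R.⟦ 1 ⟧ p₀)) q              ≡⟨ cong (λ y → u y q) (⊞-identityˡ _) ⟨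
            u (⟦ 0 ⟧ ⊞ P (shift R.⟦ 1 ⟧ p₀)) q      ≡⟨ agree-shifted ⟦ 0 ⟧ p₀ (λ ()) bent q ⟨
            u (⟦ 0 ⟧ ⊞ P p₀) q                      ≡⟨ cong (λ y → u y q) (trans (⊞-identityˡ _) A-pair₀) ⟩
            u (A (R.⟦ 1 ⟧ , 0F) ⊞ ⟦ 1 ⟧) q          ≡⟨ cong (λ y → u (A (y , 0F) ⊞ ⟦ 1 ⟧) q) 2-1 ⟨
            u (P (shift R.⟦ 1 ⟧ p₀) ⊞ ⟦ 1 ⟧) q      ∎
        where
        open ≡-Reasoning
        2-1 : R.⟦ 2 ⟧ R.⊞ R.neg R.⟦ 1 ⟧ R.⊗ R.⟦ 1 ⟧ ≡ R.⟦ 1 ⟧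
        2-1 = R.solve 0 (R.con (+ 2) R.:+ (R.:- R.con (+ 1)) R.:* R.con (+ 1) R.:= R.con (+ 1)) refl
      ... | yes straight = constant-from (P p₂) λ q → begin
            u (P p₂) q                              ≡⟨ cong (λ y → u y q) (⊞-identityˡ _) ⟨
            u (⟦ 0 ⟧ ⊞ P p₂) q                      ≡⟨ agree-shifted ⟦ 0 ⟧ p₂ (λ ()) (not-both-straight ⟦ 0 ⟧ straight) q ⟩
            u (⟦ 0 ⟧ ⊞ P (shift R.⟦ 1 ⟧ p₂)) q      ≡⟨ cong (λ y → u y q) (⊞-identityˡ _) ⟩
            u (P (shift R.⟦ 1 ⟧ p₂)) q              ≡⟨ cong (λ y → u (A (y , 2F)) q) 1+1 ⟩
            u (A (R.⟦ 2 ⟧ , 2F)) q                  ≡⟨ cong (λ y → u y q) A-pair₂ ⟩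
            u (P p₂ ⊞ ⟦ 1 ⟧) q                      ∎
        where
        open ≡-Reasoning
        1+1 : R.⟦ 1 ⟧ R.⊞ R.⟦ 1 ⟧ R.⊗ R.⟦ 1 ⟧ ≡ R.⟦ 2 ⟧
        1+1 = R.solve 0 (R.con (+ 1) R.:+ R.con (+ 1) R.:* R.con (+ 1) R.:= R.con (+ 2)) refl

      w : Pos → Pos
      w = u ⟦ 0 ⟧

      c : Fin v
      c = P (w one)

      w-N : ∀ p → w (N p) ≡ N (w p)
      w-N p = sym (trans (N-u ⟦ 0 ⟧ p) (constant _ (N p)))

      σ-linear : ∀ x → σ x ≡ σ ⟦ 0 ⟧ ⊞ x ⊗ c
      σ-linear x = subst (λ x → σ x ≡ σ ⟦ 0 ⟧ ⊞ x ⊗ c) (⟦⟧-toℕ x) (multiple (toℕ x))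
        where
        open ≡-Reasoning
        multiple : ∀ j → σ ⟦ j ⟧ ≡ σ ⟦ 0 ⟧ ⊞ ⟦ j ⟧ ⊗ c
        multiple zero = solve 2 (λ s c → s := s :+ con (+ 0) :* c) refl (σ ⟦ 0 ⟧) c
        multiple (suc j) = begin
          σ ⟦ suc j ⟧                           ≡⟨ cong σ (trans (cong ⟦_⟧ (+-comm 1 j)) (sym (⟦⟧-+ j 1))) ⟩
          σ (⟦ j ⟧ ⊞ ⟦ 1 ⟧)                     ≡⟨ cong (λ y → σ (⟦ j ⟧ ⊞ y)) A-one ⟨
          σ (⟦ j ⟧ ⊞ P one)                     ≡⟨ σ-u ⟦ j ⟧ one ⟩
          σ ⟦ j ⟧ ⊞ P (u ⟦ j ⟧ one)             ≡⟨ cong₂ (λ y q → y ⊞ P q) (multiple j) (constant ⟦ j ⟧ one) ⟩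
          (σ ⟦ 0 ⟧ ⊞ ⟦ j ⟧ ⊗ c) ⊞ c
            ≡⟨ solve 3 (λ s j c → (s :+ j :* c) :+ c := s :+ (con (+ 1) :+ j) :* c) refl (σ ⟦ 0 ⟧) ⟦ j ⟧ c ⟩
          σ ⟦ 0 ⟧ ⊞ (⟦ 1 ⟧ ⊞ ⟦ j ⟧) ⊗ c         ≡⟨ cong (λ y → σ ⟦ 0 ⟧ ⊞ y ⊗ c) (⟦⟧-+ 1 j) ⟩
          σ ⟦ 0 ⟧ ⊞ ⟦ suc j ⟧ ⊗ c               ∎

      P-w : ∀ p → P (w p) ≡ P p ⊗ c
      P-w p = ⊞-cancelˡ (σ ⟦ 0 ⟧) _ _ (begin
        σ ⟦ 0 ⟧ ⊞ P (w p)       ≡⟨ σ-u ⟦ 0 ⟧ p ⟨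
        σ (⟦ 0 ⟧ ⊞ P p)         ≡⟨ cong σ (⊞-identityˡ (P p)) ⟩
        σ (P p)                 ≡⟨ σ-linear (P p) ⟩
        σ ⟦ 0 ⟧ ⊞ P p ⊗ c       ∎)
        where open ≡-Reasoning

      -- Now that `w` commutes with `N`, a straight dart with a bent image would make the shifts by
      -- 1 and by -1 agree at a dart, whereas `n` is odd and greater than 1.
      w-straight : ∀ {p} → Straight p → Straight (w p)
      w-straight {p} straight with straight? (w p)
      ... | yes s    = s
      ... | no bent  = contradiction (shift-faithful (N (w p)) (begin
          shift (R.neg R.⟦ 1 ⟧) (N (w p))        ≡⟨ N-shift bent R.⟦ 1 ⟧ ⟨
          N (shift R.⟦ 1 ⟧ (w p))                ≡⟨ cong (λ e → N (shift e (w p))) (δ-involutive R.⟦ 1 ⟧) ⟨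
          N (shift (δ (δ R.⟦ 1 ⟧)) (w p))        ≡⟨ cong N (u-shift ⟦ 0 ⟧ (δ R.⟦ 1 ⟧) p) ⟨
          N (w (shift (δ R.⟦ 1 ⟧) p))            ≡⟨ w-N _ ⟨
          w (N (shift (δ R.⟦ 1 ⟧) p))            ≡⟨ cong w (N-shift-straight straight _) ⟩
          w (shift (δ R.⟦ 1 ⟧) (N p))            ≡⟨ u-shift ⟦ 0 ⟧ _ (N p) ⟩
          shift (δ (δ R.⟦ 1 ⟧)) (w (N p))        ≡⟨ cong₂ shift (δ-involutive R.⟦ 1 ⟧) (w-N p) ⟩
          shift R.⟦ 1 ⟧ (N (w p))                ∎)) neg1≢1
        where open ≡-Reasoning

    -- Since σ is affine, it remains to see that its multiplier `c` is 1. The dart `one` is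
    -- straight, so `w one` is some `β y` or the reverse of one. The first case makes `w` a shift
    -- commuting with `N`, hence the identity; the second is refuted by `not-back`.
    rotation : (S : Symmetry voltageMap succ) → ∀ x → Symmetry.σ S x ≡ x ⊞ Symmetry.σ S ⟦ 0 ⟧
    rotation S x = trans (σ-linear x) (trans (cong (λ c → σ ⟦ 0 ⟧ ⊞ x ⊗ c) c≡1)
        (solve 2 (λ s x → s :+ x :* con (+ 1) := x :+ s) refl (σ ⟦ 0 ⟧) x))
      where
      open Rigidity {succ} colour-succ (λ e → e) (λ e → refl) (λ e → refl) (λ e w eq p → sym (eq p)) S
      open Symmetry S
      open ≡-Reasoning

      q₀ : Pos
      q₀ = (R.⟦ 0 ⟧ , 0F) , false

      bent : ¬ Straight q₀
      bent ()

      -- At the bent dart `q₀` reversal inverts shifts, so a shift that commutes with it equals its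
      -- own inverse, and 2 is invertible.
      commuting-shift : ∀ (φ : Pos → Pos) b → (∀ p → φ p ≡ shift b p) → (∀ p → φ (N p) ≡ N (φ p)) → b ≡ R.⟦ 0 ⟧
      commuting-shift φ b φ≡ φ-N = neg≡⇒0 (shift-faithful (N q₀) (begin
        shift (R.neg b) (N q₀)  ≡⟨ N-shift bent b ⟨
        N (shift b q₀)          ≡⟨ cong N (φ≡ q₀) ⟨
        N (φ q₀)                ≡⟨ φ-N q₀ ⟨
        φ (N q₀)                ≡⟨ φ≡ (N q₀) ⟩
        shift b (N q₀)          ∎))

      as-shift : ∀ (φ : Pos → Pos) → (∀ p → φ (succ p) ≡ succ (φ p)) → ∀ b q → φ q ≡ shift b q → ∀ p → φ p ≡ shift b p
      as-shift φ φ-succ b q eq p = let i , eqᵢ = reach q p in begin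
        φ p                         ≡⟨ cong φ eqᵢ ⟨
        φ (iterate succ q i)        ≡⟨ iterate-map φ φ-succ q i ⟩
        iterate succ (φ q) i        ≡⟨ cong (λ r → iterate succ r i) eq ⟩
        iterate succ (shift b q) i  ≡⟨ iterate-map (shift b) (shift-succ b) q i ⟨
        shift b (iterate succ q i)  ≡⟨ cong (shift b) eqᵢ ⟩
        shift b p                   ∎

      H : Row
      H = R.⟦ h ⟧

      -- Here `w ∘ w` is a shift commuting with `N`, hence trivial; this leaves `w one ≡ N one` and
      -- the multiplier -1, so that `w` is `N` itself. But `w` commutes with shifts, while `N`
      -- inverts them at `q₀`.
      not-back : ∀ y → w one ≢ N (β y)
      not-back y eq = neg1≢1 (shift-faithful (N q₀) (begin
        shift (R.neg R.⟦ 1 ⟧) (N q₀)   ≡⟨ N-shift bent R.⟦ 1 ⟧ ⟨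
        N (shift R.⟦ 1 ⟧ q₀)           ≡⟨ w≡N (shift R.⟦ 1 ⟧ q₀) ⟨
        w (shift R.⟦ 1 ⟧ q₀)           ≡⟨ u-shift ⟦ 0 ⟧ R.⟦ 1 ⟧ q₀ ⟩
        shift R.⟦ 1 ⟧ (w q₀)           ≡⟨ cong (shift R.⟦ 1 ⟧) (w≡N q₀) ⟩
        shift R.⟦ 1 ⟧ (N q₀)           ∎))
        where
        b : Row
        b = y R.⊞ R.neg H
        w-one : w one ≡ shift b (N one)
        w-one = trans eq (trans (cong N (β-shift H y)) (N-shift-straight even₁ b))
        ww-one : w (w one) ≡ shift (b R.⊞ b) one
        ww-one = begin
          w (w one)                ≡⟨ cong w w-one ⟩
          w (shift b (N one))      ≡⟨ u-shift ⟦ 0 ⟧ b (N one) ⟩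
          shift b (w (N one))      ≡⟨ cong (shift b) (trans (w-N one) (cong N eq)) ⟩
          shift b (N (N (β y)))    ≡⟨ cong (shift b) (trans (N-involutive (β y)) (β-shift H y)) ⟩
          shift b (shift b one)    ≡⟨ shift-shift b b one ⟩
          shift (b R.⊞ b) one      ∎
        b≡0 : b ≡ R.⟦ 0 ⟧
        b≡0 = double≡0 (commuting-shift (w ∘ w) (b R.⊞ b)
          (as-shift (w ∘ w) (λ p → trans (cong w (u-succ ⟦ 0 ⟧ p)) (u-succ ⟦ 0 ⟧ (w p))) (b R.⊞ b) one ww-one)
          (λ p → trans (cong w (w-N p)) (w-N (w p))))
        c≡-1 : c ≡ neg ⟦ 1 ⟧
        c≡-1 = begin
          P (w one)              ≡⟨ cong P w-one ⟩
          P (shift b (N one))    ≡⟨ cong (λ b → P (shift b (N one))) b≡0 ⟩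
          P (shift R.⟦ 0 ⟧ (N one)) ≡⟨ cong P (shift-0 (N one)) ⟩
          P (N one)              ≡⟨ trans (P-N one) (cong neg A-one) ⟩
          neg ⟦ 1 ⟧              ∎
        w≡N : ∀ p → w p ≡ N p
        w≡N p = P-injective (begin
          P (w p)            ≡⟨ trans (P-w p) (cong (P p ⊗_) c≡-1) ⟩
          P p ⊗ neg ⟦ 1 ⟧    ≡⟨ solve 1 (λ x → x :* (:- con (+ 1)) := :- x) refl (P p) ⟩
          neg (P p)          ≡⟨ P-N p ⟨
          P (N p)            ∎)

      c≡1 : c ≡ ⟦ 1 ⟧
      c≡1 with w one in eq | kind (w-straight (even₁ {H}))
      ... | _ | back y  = contradiction eq (not-back y)
      ... | _ | front y = begin
          A (y , 1F)   ≡⟨ cong (λ x → A (x , 1F)) (trans y≡ (R.⊞-identityʳ H)) ⟩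
          A (H , 1F)   ≡⟨ A-one ⟩
          ⟦ 1 ⟧        ∎
        where
        b : Row
        b = y R.⊞ R.neg H
        b≡0 : b ≡ R.⟦ 0 ⟧
        b≡0 = commuting-shift w b (as-shift w (u-succ ⟦ 0 ⟧) b one (trans eq (β-shift H y))) w-N
        y≡ : y ≡ H R.⊞ R.⟦ 0 ⟧
        y≡ = trans (R.solve 2 (λ y H → y R.:= H R.:+ (y R.:+ (R.:- H))) refl y H) (cong (H R.⊞_) b≡0)

    -- Reversal commutes with `succ` at `β H`, because `H` is fixed by x ↦ -x - 1, and with `pred`
    -- among the `β z` only at `β O`, because 0 is the only fixed point of x ↦ -x. Up to reversal
    -- `w` must therefore exchange these two darts, and their labels are 1 and ±2.
    no-reflection : ¬ Symmetry voltageMap pred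
    no-reflection S = 3≢0 (begin
      ⟦ 3 ⟧                       ≡⟨ solve 0 (con (+ 3) := con (+ 4) :+ (:- con (+ 1))) refl ⟩
      ⟦ 4 ⟧ ⊞ neg ⟦ 1 ⟧           ≡⟨ cong (_⊞ neg ⟦ 1 ⟧) 4≡1 ⟩
      ⟦ 1 ⟧ ⊞ neg ⟦ 1 ⟧           ≡⟨ ⊞-inverseʳ _ ⟩
      ⟦ 0 ⟧                       ∎)
      where
      open ≡-Reasoning

      flip : ∀ p → proj₂ (pred p) ≡ not (proj₂ p)
      flip (c , false) = refl
      flip (c , true)  = refl

      pred-iterate : ∀ e w → (∀ p → shift e p ≡ iterate succ p w) → ∀ p → iterate pred p w ≡ shift (R.neg e) p
      pred-iterate e w eq p = begin
        iterate pred p w                                   ≡⟨ shift-inverse e _ ⟨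
        shift (R.neg e) (shift e (iterate pred p w))       ≡⟨ cong (shift (R.neg e)) (trans (eq _) (undo w p)) ⟩
        shift (R.neg e) p                                  ∎
        where
        undo : ∀ w p → iterate succ (iterate pred p w) w ≡ p
        undo zero    p = refl
        undo (suc w) p = trans (iterate-suc succ _ w) (trans (cong succ (undo w (pred p))) (succ-pred p))

      open Rigidity {pred} flip R.neg R.neg-involutive (λ e → refl) pred-iterate S
      open Symmetry S

      N-injective : ∀ {p q} → N p ≡ N q → p ≡ q
      N-injective {p} {q} eq = trans (sym (N-involutive p)) (trans (cong N eq) (N-involutive q))

      pred-injective : ∀ {p q} → pred p ≡ pred q → p ≡ q
      pred-injective {p} {q} eq = trans (sym (succ-pred p)) (trans (cong succ eq) (succ-pred q))

      N-pred-β : ∀ z → N (pred (β z)) ≡ pred (N (β (R.neg z)))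
      N-pred-β z = begin
        g (g⁻¹ (f⁻¹ (z , 1F))) , false         ≡⟨ cong (_, false) (trans (g-g⁻¹ _) (cong (z ,_) down-1)) ⟩
        (z , 0F) , false                       ≡⟨ cong (λ z → (z , 0F) , false) (R.neg-involutive z) ⟨
        pred ((R.neg (R.neg z) , 0F) , true)   ≡⟨ cong pred (Nβ (R.neg z)) ⟨
        pred (N (β (R.neg z)))                 ∎

      N-succ-β : ∀ z → N (succ (β z)) ≡ succ (N (β (R.neg z R.⊞ R.neg R.⟦ 1 ⟧)))
      N-succ-β z = begin
        (y , up 1F) , false                      ≡⟨ cong₂ (λ y d → (y , d) , false) (sym (R.neg-involutive y)) (cong up (sym up-0)) ⟩
        succ ((R.neg y , 0F) , true)             ≡⟨ cong succ (Nβ y) ⟨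
        succ (N (β y))                           ∎
        where
        y : Row
        y = R.neg z R.⊞ R.neg R.⟦ 1 ⟧

      H : Row
      H = R.⟦ h ⟧

      H-fixed : R.neg H R.⊞ R.neg R.⟦ 1 ⟧ ≡ H
      H-fixed = begin
        R.neg H R.⊞ R.neg R.⟦ 1 ⟧
          ≡⟨ R.solve 1 (λ H → (R.:- H) R.:+ (R.:- R.con (+ 1)) R.:= H R.:+ (R.:- (R.con (+ 1) R.:+ (H R.:+ H)))) refl H ⟩
        H R.⊞ R.neg (R.⟦ 1 ⟧ R.⊞ (H R.⊞ H))
          ≡⟨ cong (λ z → H R.⊞ R.neg z) (trans (cong (R.⟦ 1 ⟧ R.⊞_) (R.⟦⟧-+ h h)) (trans (R.⟦⟧-+ 1 (h + h)) R.⟦v⟧)) ⟩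
        H R.⊞ R.neg R.⟦ 0 ⟧
          ≡⟨ R.solve 1 (λ H → H R.:+ (R.:- R.con (+ 0)) R.:= H) refl H ⟩
        H ∎

      N-pred-w-one : N (pred (w one)) ≡ pred (N (w one))
      N-pred-w-one = begin
        N (pred (w one))         ≡⟨ cong N (u-succ ⟦ 0 ⟧ one) ⟨
        N (w (succ one))         ≡⟨ w-N (succ one) ⟨
        w (N (succ one))         ≡⟨ cong w (trans (N-succ-β H) (cong (succ ∘ N ∘ β) H-fixed)) ⟩
        w (succ (N one))         ≡⟨ u-succ ⟦ 0 ⟧ (N one) ⟩
        pred (w (N one))         ≡⟨ cong pred (w-N one) ⟩
        pred (N (w one))         ∎

      O : Row
      O = R.⟦ 0 ⟧

      w-O : w (β O) ≡ shift H (w one)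
      w-O = begin
        w (β O)                         ≡⟨ cong w (trans (shift-β (R.neg H) H) (cong β (R.⊞-inverseʳ H))) ⟨
        w (shift (R.neg H) one)         ≡⟨ u-shift ⟦ 0 ⟧ (R.neg H) one ⟩
        shift (R.neg (R.neg H)) (w one) ≡⟨ cong (λ e → shift e (w one)) (R.neg-involutive H) ⟩
        shift H (w one)                 ∎

      shift-H : shift H (β O) ≡ one
      shift-H = trans (shift-β H O) (cong β (R.⊞-identityˡ H))

      -- Up to a common reversal, `w` takes `one` to `β O` and `β O` back to `one`. The first gives
      -- the multiplier ±`A (O , 1F)`, the second says that multiplication by it takes `A (O , 1F)`
      -- to ±1 with the same sign.
      square : A (O , 1F) ⊗ A (O , 1F) ≡ ⟦ 1 ⟧
      square with w one in eq | kind (w-straight (even₁ {H}))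
      ... | _ | front y = begin
          A (O , 1F) ⊗ A (O , 1F)   ≡⟨ cong (A (O , 1F) ⊗_) (trans (cong P eq) (cong (λ y → A (y , 1F)) y≡O)) ⟨
          A (O , 1F) ⊗ c            ≡⟨ P-w (β O) ⟨
          P (w (β O))               ≡⟨ cong P (trans w-O (cong (shift H) (trans eq (cong β y≡O)))) ⟩
          P (shift H (β O))         ≡⟨ trans (cong P shift-H) A-one ⟩
          ⟦ 1 ⟧                     ∎
        where
        y≡O : y ≡ O
        y≡O = neg≡⇒0 (β-injective (N-injective (pred-injective (begin
          pred (N (β (R.neg y)))    ≡⟨ N-pred-β y ⟨
          N (pred (β y))            ≡⟨ subst (λ p → N (pred p) ≡ pred (N p)) eq N-pred-w-one ⟩
          pred (N (β y))            ∎))))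
      ... | _ | back y = neg-injective (begin
          neg (A (O , 1F) ⊗ A (O , 1F))
            ≡⟨ solve 1 (λ a → :- (a :* a) := a :* (:- a)) refl (A (O , 1F)) ⟩
          A (O , 1F) ⊗ neg (A (O , 1F))   ≡⟨ cong (A (O , 1F) ⊗_) (trans (cong P (trans eq (cong (N ∘ β) y≡O))) (P-N (β O))) ⟨
          A (O , 1F) ⊗ c            ≡⟨ P-w (β O) ⟨
          P (w (β O))               ≡⟨ cong P (trans w-O (cong (shift H) (trans eq (cong (N ∘ β) y≡O)))) ⟩
          P (shift H (N (β O)))     ≡⟨ cong P (N-shift-straight even₁ H) ⟨
          P (N (shift H (β O)))     ≡⟨ cong (P ∘ N) shift-H ⟩
          P (N one)                 ≡⟨ trans (P-N one) (cong neg A-one) ⟩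
          neg ⟦ 1 ⟧                 ∎)
        where
        y≡O : y ≡ O
        y≡O = neg≡⇒0 (β-injective (pred-injective (begin
          pred (β (R.neg y))                  ≡⟨ N-involutive _ ⟨
          N (N (pred (β (R.neg y))))          ≡⟨ cong N (N-pred-β (R.neg y)) ⟩
          N (pred (N (β (R.neg (R.neg y)))))  ≡⟨ cong (N ∘ pred ∘ N ∘ β) (R.neg-involutive y) ⟩
          N (pred (N (β y)))                  ≡⟨ subst (λ p → N (pred p) ≡ pred (N p)) eq N-pred-w-one ⟩
          pred (N (N (β y)))                  ≡⟨ cong pred (N-involutive (β y)) ⟩
          pred (β y)                          ∎)))

      4≡1 : ⟦ 4 ⟧ ≡ ⟦ 1 ⟧
      4≡1 with A-two
      ... | inj₁ eq = trans (sym (⟦⟧-* 2 2)) (trans (cong₂ _⊗_ (sym eq) (sym eq)) square)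
      ... | inj₂ eq = trans (sym (⟦⟧-* 2 2)) (trans (solve 1 (λ x → x :* x := (:- x) :* (:- x)) refl ⟦ 2 ⟧)
                        (trans (cong₂ _⊗_ (sym eq) (sym eq)) square))

  autIsTranslations-labelled : AutIsTranslations (Derived.embedding voltageMap)
  autIsTranslations-labelled = autIsTranslations voltageMap rotation no-reflection

-- Rows, columns and faces

module Lines (h l : ℕ) where
  open Skeleton h l
  open Residues n

  lineSum : {v : ℕ} .{{_ : NonZero v}} → (Cell → Fin v) → (Level → Row) → Fin v
  lineSum A L = sumTo k (λ i → A (L L.⟦ i ⟧ , L.⟦ i ⟧))

  -- The cycle of `g` through `(y , 0F)` leaves row `y` only at the levels 1 and 2, since the three
  -- non-trivial moves have cancelled by level 3.
  row column : Row → Level → Row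
  row x d = x
  column y 0F                  = y
  column y 1F                  = neg y
  column y 2F                  = y ⊞ neg ⟦ 1 ⟧
  column y (suc (suc (suc _))) = y

  columnOf : Level → Row → Row
  columnOf 0F                  x = x
  columnOf 1F                  x = neg x
  columnOf 2F                  x = x ⊞ ⟦ 1 ⟧
  columnOf (suc (suc (suc _))) x = x

  column-columnOf : ∀ d x → column (columnOf d x) d ≡ x
  column-columnOf 0F                  x = refl
  column-columnOf 1F                  x = neg-involutive x
  column-columnOf 2F                  x = solve 1 (λ x → (x :+ con (+ 1)) :+ (:- con (+ 1)) := x) refl x
  column-columnOf (suc (suc (suc _))) x = refl

  private
    column-up : ∀ y i → 2 ≤ toℕ i → column y (up i) ≡ y
    column-up y i 2≤i with m≤n⇒m<n∨m≡n (toℕ<n i)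
    ... | inj₂ last = cong (column y) (up-last i last)
    ... | inj₁ inner with up i | toℕ-up i inner
    ...   | 0F                  | _  = refl
    ...   | 1F                  | eq = contradiction (subst (3 ≤_) (sym eq) (s≤s 2≤i)) λ { (s≤s ()) }
    ...   | 2F                  | eq = contradiction (subst (3 ≤_) (sym eq) (s≤s 2≤i)) λ { (s≤s (s≤s ())) }
    ...   | suc (suc (suc _))   | _  = refl

  g-column : ∀ y d → g (column y d , d) ≡ (column y (up d) , up d)
  g-column y 0F = cong (_, up 0F) (sym (cong (column y) up-0))
  g-column y 1F = cong (_, up 1F) (trans (cong (_⊞ neg ⟦ 1 ⟧) (neg-involutive y)) (sym (cong (column y) up-1)))
  g-column y 2F = cong (_, up 2F) (trans (solve 1 (λ y → (y :+ (:- con (+ 1))) :+ con (+ 1) := y) refl y)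
                    (sym (column-up y 2F ≤-refl)))
  g-column y d@(suc (suc (suc _))) = cong (_, up d) (sym (column-up y d (s≤s (s≤s z≤n))))

module Faces {h l v t : ℕ} .{{_ : NonZero v}} .{{_ : NonZero t}} (Λ : Labelling h l v t) where
  open Skeleton h l
  open Lines h l
  open Labelling Λ using (A)
  open Labelled Λ
  open VoltageMap voltageMap using (F; P; orbitSum)
  open Residues v

  module _ (rows : ∀ x → lineSum A (row x) ≢ ⟦ 0 ⟧) (columns : ∀ y → lineSum A (column y) ≢ ⟦ 0 ⟧) where

    private
      -- An orbit of `F` as a periodic sequence, so that rows and columns can be treated alike. As
      -- the level advances by one at each step, `k` consecutive darts are distinct.
      record FaceOrbit : Set where
        field
          φ        : ℕ → Pos
          base     : Level
          φ-F      : ∀ j → F (φ j) ≡ φ (suc j)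
          φ-period : ∀ j → φ (j + k) ≡ φ j
          φ-level  : ∀ j → proj₂ (proj₁ (φ j)) ≡ base L.⊞ L.⟦ j ⟧
          sum≢0    : sumTo k (P ∘ φ) ≢ ⟦ 0 ⟧

        φ-iterate : ∀ j i → iterate F (φ j) i ≡ φ (j + i)
        φ-iterate j zero    = cong φ (sym (+-identityʳ j))
        φ-iterate j (suc i) = trans (cong (λ p → iterate F p i) (φ-F j)) (trans (φ-iterate (suc j) i) (cong φ (sym (+-suc j i))))

        period : ∀ j → iterate F (φ j) k ≡ φ j
        period j = trans (φ-iterate j k) (φ-period j)

        distinct : ∀ j {a b} → a < k → b < k → iterate F (φ j) a ≡ iterate F (φ j) b → a ≡ b
        distinct j {a} {b} a<k b<k eq = begin
          a                 ≡⟨ L.toℕ-⟦⟧-small a<k ⟨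
          toℕ L.⟦ a ⟧       ≡⟨ cong toℕ (L.⊞-cancelˡ (base L.⊞ L.⟦ j ⟧) _ _ (begin
              (base L.⊞ L.⟦ j ⟧) L.⊞ L.⟦ a ⟧       ≡⟨ level a ⟨
              proj₂ (proj₁ (iterate F (φ j) a))    ≡⟨ cong (proj₂ ∘ proj₁) eq ⟩
              proj₂ (proj₁ (iterate F (φ j) b))    ≡⟨ level b ⟩
              (base L.⊞ L.⟦ j ⟧) L.⊞ L.⟦ b ⟧       ∎)) ⟩
          toℕ L.⟦ b ⟧       ≡⟨ L.toℕ-⟦⟧-small b<k ⟩
          b                 ∎
          where
          open ≡-Reasoning
          level : ∀ i → proj₂ (proj₁ (iterate F (φ j) i)) ≡ (base L.⊞ L.⟦ j ⟧) L.⊞ L.⟦ i ⟧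
          level i = trans (cong (proj₂ ∘ proj₁) (φ-iterate j i)) (trans (φ-level (j + i))
            (trans (cong (base L.⊞_) (sym (L.⟦⟧-+ j i))) (sym (L.⊞-assoc base _ _))))

        orbitSum≢0 : ∀ j → orbitSum k (φ j) ≢ ⟦ 0 ⟧
        orbitSum≢0 zero    eq = sum≢0 (trans (sumTo-cong k (λ i _ → cong P (sym (φ-iterate 0 i)))) eq)
        orbitSum≢0 (suc j) eq = orbitSum≢0 j (trans (sym (Derived.orbitSum-F voltageMap k (φ j) (period j)))
          (trans (cong (orbitSum k) (φ-F j)) eq))

      level-period : ∀ j → L.⟦ j + k ⟧ ≡ L.⟦ j ⟧
      level-period j = trans (sym (L.⟦⟧-+ j k)) (trans (cong (L.⟦ j ⟧ L.⊞_) L.⟦v⟧) (L.⊞-identityʳ _))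

      rowOrbit : Row → FaceOrbit
      rowOrbit x = record
        { φ = λ j → (x , L.⟦ j ⟧) , false
        ; base = L.⟦ 0 ⟧
        ; φ-F = λ j → cong (_, false) (trans (cong f (g-g⁻¹ (x , L.⟦ j ⟧))) (cong (x ,_) (up-⟦⟧ j)))
        ; φ-period = λ j → cong (λ d → (x , d) , false) (level-period j)
        ; φ-level = λ j → sym (L.⊞-identityˡ _)
        ; sum≢0 = rows x }

      columnOrbit : Row → FaceOrbit
      columnOrbit y = record
        -- The dart `(c , true)` carries minus the label of `g c`, which is one level up; starting
        -- one level down aligns the orbit sum with the column sum.
        { φ = λ j → (column y (down L.⟦ j ⟧) , down L.⟦ j ⟧) , true
        ; base = L.neg L.⟦ 1 ⟧
        ; φ-F = λ j → cong (_, true) (trans (g-column y (down L.⟦ j ⟧)) (cong (λ d → column y d , d) (begin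
            up (down L.⟦ j ⟧)        ≡⟨ up-down _ ⟩
            L.⟦ j ⟧                  ≡⟨ down-up _ ⟨
            down (up L.⟦ j ⟧)        ≡⟨ cong down (up-⟦⟧ j) ⟩
            down L.⟦ suc j ⟧         ∎)))
        ; φ-period = λ j → cong (λ d → (column y (down d) , down d) , true) (level-period j)
        ; φ-level = λ j → L.⊞-comm _ _
        ; sum≢0 = λ eq → columns y (neg-injective (begin
            neg (lineSum A (column y))                                ≡⟨ sumTo-neg k (λ i → A (column y L.⟦ i ⟧ , L.⟦ i ⟧)) ⟨
            sumTo k (λ i → neg (A (column y L.⟦ i ⟧ , L.⟦ i ⟧)))
              ≡⟨ sumTo-cong k (λ i _ → cong (neg ∘ A) (trans (g-column y (down L.⟦ i ⟧)) (cong (λ d → column y d , d) (up-down L.⟦ i ⟧)))) ⟨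
            _                                                         ≡⟨ eq ⟩
            ⟦ 0 ⟧                                                     ≡⟨ -0#≈0# ⟨
            neg ⟦ 0 ⟧                                                 ∎)) }
        where open ≡-Reasoning

      orbitOf : ∀ p → Σ FaceOrbit λ O → ∃[ j ] FaceOrbit.φ O j ≡ p
      orbitOf ((x , d) , false) = rowOrbit x , toℕ d , cong (λ d → (x , d) , false) (L.⟦⟧-toℕ d)
      orbitOf ((x , d) , true)  = columnOrbit (columnOf d x) , toℕ (up d) ,
        trans (cong (λ d′ → (column (columnOf d x) d′ , d′) , true) (trans (cong down (L.⟦⟧-toℕ (up d))) (down-up d)))
          (cong (λ x → (x , d) , true) (column-columnOf d x))

    faceLengths : ∀ e → ∃[ o ] (1 < o × (Prime v → o ≡ v) × FaceLength (Derived.embedding voltageMap) e (o * k))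
    faceLengths = Derived.faceLength voltageMap k
      (λ p → case-orbit p (λ p → iterate F p k ≡ p) FaceOrbit.period)
      (λ p → case-orbit p (λ p → ∀ {a b} → a < k → b < k → iterate F p a ≡ iterate F p b → a ≡ b) FaceOrbit.distinct)
      (λ p → case-orbit p (λ p → orbitSum k p ≢ ⟦ 0 ⟧) FaceOrbit.orbitSum≢0)
      where
      case-orbit : ∀ p (Q : Pos → Set) → (∀ O j → Q (FaceOrbit.φ O j)) → Q p
      case-orbit p Q q = let O , j , eq = orbitOf p in subst Q eq (q O j)

-- Half systems

record HalfSystem (m v t p : ℕ) .{{_ : NonZero v}} .{{_ : NonZero t}} : Set where
  open Residues v
  field
    value           : Fin m → Fin v
    value-injective : ∀ {i j} → value i ≡ value j → i ≡ j
    value-sign      : ∀ i j → value i ≢ neg (value j)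
    value∉J         : ∀ i → ¬ InJ v t (value i)
    value-locate    : ∀ z → InJ v t z ⊎ ∃[ i ] (value i ≡ z ⊎ neg (value i) ≡ z)
    value-small     : ∀ i → toℕ i < p → value i ≡ ⟦ suc (toℕ i) ⟧

-- With q = v / t = p + 1, the non-multiples of q below v are listed in increasing order
-- by Val, and negation reverses the list.
module _ (m v t p : ℕ) .{{_ : NonZero v}} .{{_ : NonZero t}} .{{_ : NonZero p}}
         (tp : t * p ≡ m + m) (v≡ : v ≡ suc p * t) where
  open Residues v
  open Orders v using (⟦⟧≡0⇒∣)

  private
    Val : ℕ → ℕ
    Val i = suc (i % p) + i / p * suc p

    remainder< : ∀ i → suc (i % p) < suc p
    remainder< i = s<s (m%n<n i p)

    Val-% : ∀ i → Val i % suc p ≡ suc (i % p)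
    Val-% i = trans ([m+kn]%n≡m%n (suc (i % p)) (i / p) (suc p)) (m<n⇒m%n≡m (remainder< i))

    Val-/ : ∀ i → Val i / suc p ≡ i / p
    Val-/ i = trans (+-distrib-/-∣ʳ (suc (i % p)) (divides (i / p) refl))
      (cong₂ _+_ (m<n⇒m/n≡0 (remainder< i)) (m*n/n≡m (i / p) (suc p)))

    Val-injective : ∀ {i j} → Val i ≡ Val j → i ≡ j
    Val-injective {i} {j} eq = begin
      i                   ≡⟨ m≡m%n+[m/n]*n i p ⟩
      i % p + i / p * p   ≡⟨ cong₂ (λ a b → a + b * p)
                               (suc-injective (trans (sym (Val-% i)) (trans (cong (_% suc p) eq) (Val-% j))))
                               (trans (sym (Val-/ i)) (trans (cong (_/ suc p) eq) (Val-/ j))) ⟩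
      j % p + j / p * p   ≡⟨ m≡m%n+[m/n]*n j p ⟨
      j                   ∎
      where open ≡-Reasoning

    Val< : ∀ {i} → i < m + m → Val i < v
    Val< {i} i< = begin-strict
      suc (i % p) + i / p * suc p   <⟨ +-monoˡ-< (i / p * suc p) (remainder< i) ⟩
      suc (i / p) * suc p           ≤⟨ *-monoˡ-≤ (suc p) {suc (i / p)} {t} (m<n*o⇒m/o<n (subst (i <_) (sym tp) i<)) ⟩
      t * suc p                     ≡⟨ trans (*-comm t (suc p)) (sym v≡) ⟩
      v                             ∎
      where open ≤-Reasoning

    suc-p∤Val : ∀ i → suc p ∤ Val i
    suc-p∤Val i d = contradiction (trans (sym (Val-% i)) (n∣m⇒m%n≡0 (Val i) (suc p) d)) λ ()

    sole-multiple : ∀ {s} → suc s < p + p → p ∣ suc s → suc s ≡ p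
    sole-multiple s< (divides 1 eq) = trans eq (*-identityˡ p)
    sole-multiple {s} s< (divides (suc (suc c)) eq) = contradiction eq (<⇒≢ (begin-strict
      suc s               <⟨ s< ⟩
      p + p               ≤⟨ +-monoʳ-≤ p (m≤m+n p (c * p)) ⟩
      suc (suc c) * p     ∎))
      where open ≤-Reasoning

    -- If i + i′ + 1 = tp then i % p + i′ % p + 1 = p, so the two quotients add up to t − 1.
    Val-opposite : ∀ i i′ → suc (i + i′) ≡ m + m → Val i + Val i′ ≡ v
    Val-opposite i i′ eq = begin
      (suc b + a * suc p) + (suc b′ + a′ * suc p)
        ≡⟨ regroup a b a′ b′ p ⟩
      suc (suc (b + b′)) + (a + a′) * suc p
        ≡⟨ cong (λ z → suc z + (a + a′) * suc p) rems ⟩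
      suc (a + a′) * suc p
        ≡⟨ cong (_* suc p) quos ⟩
      t * suc p
        ≡⟨ trans (*-comm t (suc p)) (sym v≡) ⟩
      v ∎
      where
      open ≡-Reasoning
      a b a′ b′ : ℕ
      a = i / p
      b = i % p
      a′ = i′ / p
      b′ = i′ % p
      regroup : ∀ a b a′ b′ p → (suc b + a * suc p) + (suc b′ + a′ * suc p) ≡ suc (suc (b + b′)) + (a + a′) * suc p
      regroup = solve-∀
      total : suc (b + b′) + (a + a′) * p ≡ t * p
      total = begin
        suc (b + b′) + (a + a′) * p          ≡⟨ gather a b a′ b′ p ⟩
        suc ((b + a * p) + (b′ + a′ * p))    ≡⟨ cong suc (cong₂ _+_ (sym (m≡m%n+[m/n]*n i p)) (sym (m≡m%n+[m/n]*n i′ p))) ⟩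
        suc (i + i′)                         ≡⟨ trans eq (sym tp) ⟩
        t * p                                ∎
        where
        gather : ∀ a b a′ b′ p → suc (b + b′) + (a + a′) * p ≡ suc ((b + a * p) + (b′ + a′ * p))
        gather = solve-∀
      rems : suc (b + b′) ≡ p
      rems = sole-multiple (+-mono-≤-< (m%n<n i p) (m%n<n i′ p))
        (∣m+n∣m⇒∣n (divides t (trans (+-comm _ (suc (b + b′))) total)) (divides (a + a′) refl))
      quos : suc (a + a′) ≡ t
      quos = *-cancelʳ-≡ (suc (a + a′)) t p (trans (cong (_+ (a + a′) * p) (sym rems)) total)

    Val-locate : ∀ {z} → z < v → suc p ∣ z ⊎ ∃[ i ] (i < m + m × Val i ≡ z)
    Val-locate {z} z<v with z % suc p in eq
    ... | zero  = inj₁ (m%n≡0⇒n∣m z (suc p) eq)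
    ... | suc r = inj₂ (i , i< , Val-i)
      where
      open ≡-Reasoning
      c i : ℕ
      c = z / suc p
      i = r + c * p
      r<p : r < p
      r<p = s<s⁻¹ (subst (_< suc p) eq (m%n<n z (suc p)))
      i%p : i % p ≡ r
      i%p = trans ([m+kn]%n≡m%n r c p) (m<n⇒m%n≡m r<p)
      i/p : i / p ≡ c
      i/p = trans (+-distrib-/-∣ʳ r (divides c refl)) (cong₂ _+_ (m<n⇒m/n≡0 r<p) (m*n/n≡m c p))
      Val-i : Val i ≡ z
      Val-i = begin
        suc (i % p) + i / p * suc p   ≡⟨ cong₂ (λ r c → suc r + c * suc p) i%p i/p ⟩
        suc r + c * suc p             ≡⟨ cong (_+ c * suc p) eq ⟨
        z % suc p + c * suc p         ≡⟨ m≡m%n+[m/n]*n z (suc p) ⟨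
        z                             ∎
      c<t : c < t
      c<t = m<n*o⇒m/o<n (subst (z <_) (trans v≡ (*-comm (suc p) t)) z<v)
      i< : i < m + m
      i< = subst (i <_) tp (<-≤-trans (+-monoˡ-< (c * p) r<p) (*-monoˡ-≤ p c<t))

    q≡ : v / t ≡ suc p
    q≡ = trans (cong (_/ t) v≡) (m*n/n≡m (suc p) t)

    suc-p∣v : suc p ∣ v
    suc-p∣v = divides t (trans v≡ (*-comm (suc p) t))

    InJ⇒∣ : ∀ {z} → InJ v t z → suc p ∣ toℕ z
    InJ⇒∣ {z} (w , eq) = subst (suc p ∣_) (sym (begin
      toℕ z                          ≡⟨ cong toℕ (trans eq (residue-⟦⟧ z _)) ⟩
      toℕ ⟦ v / t * toℕ w ⟧          ≡⟨ toℕ-⟦⟧ _ ⟩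
      (v / t * toℕ w) % v            ≡⟨ cong (λ q → (q * toℕ w) % v) q≡ ⟩
      (suc p * toℕ w) % v            ∎)) (%-presˡ-∣ (m∣m*n (toℕ w)) suc-p∣v)
      where open ≡-Reasoning

    ∣⇒InJ : ∀ {z} → suc p ∣ toℕ z → InJ v t z
    ∣⇒InJ {z} (divides c eq) = ⟦ c ⟧ , sym (begin
      residue z (v / t * toℕ ⟦ c ⟧)   ≡⟨ residue-⟦⟧ z _ ⟩
      ⟦ v / t * toℕ ⟦ c ⟧ ⟧           ≡⟨ cong₂ (λ q c → ⟦ q * c ⟧) q≡ (toℕ-⟦⟧-small c<v) ⟩
      ⟦ suc p * c ⟧                   ≡⟨ cong ⟦_⟧ (trans (*-comm (suc p) c) (sym eq)) ⟩
      ⟦ toℕ z ⟧                       ≡⟨ ⟦⟧-toℕ z ⟩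
      z                               ∎)
      where
      open ≡-Reasoning
      c<v : c < v
      c<v = ≤-<-trans (subst (c ≤_) (sym eq) (m≤m*n c (suc p))) (toℕ<n z)

    val : ℕ → Fin v
    val i = ⟦ Val i ⟧

    toℕ-val : ∀ {i} → i < m + m → toℕ (val i) ≡ Val i
    toℕ-val i< = toℕ-⟦⟧-small (Val< i<)

    val-injective : ∀ {i j} → i < m + m → j < m + m → val i ≡ val j → i ≡ j
    val-injective i< j< eq = Val-injective (trans (sym (toℕ-val i<)) (trans (cong toℕ eq) (toℕ-val j<)))

    opposite-index : ∀ {i} → i < m + m → ∃[ i′ ] suc (i + i′) ≡ m + m
    opposite-index {i} i< = (m + m) ∸ suc i , m+[n∸m]≡n i<

    neg-val : ∀ {i i′} → suc (i + i′) ≡ m + m → neg (val i) ≡ val i′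
    neg-val {i} {i′} eq = ⊞-cancelˡ (val i) _ _ (begin
      val i ⊞ neg (val i)     ≡⟨ ⊞-inverseʳ (val i) ⟩
      ⟦ 0 ⟧                   ≡⟨ ⟦v⟧ ⟨
      ⟦ v ⟧                   ≡⟨ cong ⟦_⟧ (Val-opposite i i′ eq) ⟨
      ⟦ Val i + Val i′ ⟧      ≡⟨ ⟦⟧-+ (Val i) (Val i′) ⟨
      val i ⊞ val i′          ∎)
      where open ≡-Reasoning

    opposite-< : ∀ {i i′} → suc (i + i′) ≡ m + m → i′ < m + m
    opposite-< {i} {i′} eq = subst (i′ <_) eq (s≤s (m≤n+m i′ i))

    half< : ∀ {i} → i < m → i < m + m
    half< i<m = <-≤-trans i<m (m≤m+n m m)

  -- Negation reverses a list of length `m + m`, so it pairs each index below `m` with one that is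
  -- not. Hence no value is the negative of a value, itself included, and each element outside J is
  -- a value up to sign.
  halfSystem : HalfSystem m v t p
  halfSystem = record
    { value = λ i → val (toℕ i)
    ; value-injective = λ {i} {j} eq → toℕ-injective (val-injective (half< (toℕ<n i)) (half< (toℕ<n j)) eq)
    ; value-sign = λ i j eq →
        let j′ , op = opposite-index (half< (toℕ<n j))
            i≡j′ = val-injective (half< (toℕ<n i)) (opposite-< op) (trans eq (neg-val op))
        in <-irrefl (trans (cong (λ z → suc (toℕ j + z)) i≡j′) op) (+-mono-≤-< (toℕ<n j) (toℕ<n i))
    ; value∉J = λ i inJ → suc-p∤Val (toℕ i) (subst (suc p ∣_) (toℕ-val (half< (toℕ<n i))) (InJ⇒∣ inJ))
    ; value-locate = locate
    ; value-small = λ i i<p → cong ⟦_⟧ (trans (cong₂ (λ r c → suc r + c * suc p) (m<n⇒m%n≡m i<p) (m<n⇒m/n≡0 i<p)) (+-identityʳ _))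
    }
    where
    locate : ∀ z → InJ v t z ⊎ ∃[ i ] (val (toℕ i) ≡ z ⊎ neg (val (toℕ i)) ≡ z)
    locate z with Val-locate (toℕ<n z)
    ... | inj₁ d = inj₁ (∣⇒InJ d)
    ... | inj₂ (i , i< , eq) with i <? m
    ...   | yes i<m = inj₂ (fromℕ< i<m , inj₁ (trans (cong val (toℕ-fromℕ< i<m)) (trans (cong ⟦_⟧ eq) (⟦⟧-toℕ z))))
    ...   | no  i≮m =
      let i′ , op = opposite-index i<
          i′<m : i′ < m
          i′<m = +-cancelˡ-< m i′ m (subst (m + i′ <_) op (s≤s (+-monoˡ-≤ i′ (≮⇒≥ i≮m))))
      in inj₂ (fromℕ< i′<m , inj₂ (trans (cong (neg ∘ val) (toℕ-fromℕ< i′<m))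
           (trans (neg-val (trans (cong suc (+-comm i′ i)) op)) (trans (cong ⟦_⟧ eq) (⟦⟧-toℕ z)))))

-- Non-zero sums

module _ {v : ℕ} .{{_ : NonZero v}} where
  open Residues v

  sumTo-update : ∀ j {i₀} {φ ψ : ℕ → Fin v} → i₀ < j → (∀ i → i < j → i ≢ i₀ → ψ i ≡ φ i) →
                 sumTo j ψ ≡ sumTo j φ ⊞ (ψ i₀ ⊞ neg (φ i₀))
  sumTo-update (suc j) {zero} {φ} {ψ} _ eq = trans
    (cong (ψ 0 ⊞_) (sumTo-cong j λ i i<j → eq (suc i) (s<s i<j) λ ()))
    (solve 3 (λ a b s → a :+ s := (b :+ s) :+ (a :+ (:- b))) refl (ψ 0) (φ 0) _)
  sumTo-update (suc j) {suc i₀} {φ} {ψ} i₀<j eq = trans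
    (cong₂ _⊞_ (eq 0 z<s λ ()) (sumTo-update j (s<s⁻¹ i₀<j) λ i i<j i≢ → eq (suc i) (s<s i<j) (i≢ ∘ suc-injective)))
    (sym (⊞-assoc (φ 0) _ _))

  signed : Bool → Fin v → Fin v
  signed true  x = x
  signed false x = neg x

  signed-not : ∀ b x → signed (not b) x ≡ neg (signed b x)
  signed-not true  x = refl
  signed-not false x = sym (neg-involutive x)

module Signs (h l v : ℕ) .{{_ : NonZero v}} where
  open Skeleton h l
  open Lines h l
  open Residues v
  private module R = Residues n

  Signs : Set
  Signs = Cell → Bool

  _≟ᶜ_ : (c c′ : Cell) → Dec (c ≡ c′)
  _≟ᶜ_ = ≡-dec Fin._≟_ Fin._≟_

  flip : Cell → Signs → Signs
  flip c₀ σ c with c ≟ᶜ c₀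
  ... | yes _ = not (σ c)
  ... | no  _ = σ c

  flip-same : ∀ c₀ σ → flip c₀ σ c₀ ≡ not (σ c₀)
  flip-same c₀ σ with c₀ ≟ᶜ c₀
  ... | yes _  = refl
  ... | no c≢c = contradiction refl c≢c

  flip-other : ∀ {c₀ c} σ → c ≢ c₀ → flip c₀ σ c ≡ σ c
  flip-other {c₀} {c} σ c≢ with c ≟ᶜ c₀
  ... | yes eq = contradiction eq c≢
  ... | no _   = refl

  module Balancing (B : Cell → Fin v) (2B≢0 : ∀ c → B c ⊞ B c ≢ ⟦ 0 ⟧) where

    label : Signs → Cell → Fin v
    label σ c = signed (σ c) (B c)

    Σ[_] : Signs → (Level → Row) → Fin v
    Σ[ σ ] L = lineSum (label σ) L

    2label≢0 : ∀ σ c → label σ c ⊞ label σ c ≢ ⟦ 0 ⟧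
    2label≢0 σ c eq with σ c
    ... | true  = 2B≢0 c eq
    ... | false = 2B≢0 c (begin
      B c ⊞ B c                     ≡⟨ solve 1 (λ b → b :+ b := :- ((:- b) :+ (:- b))) refl (B c) ⟩
      neg (neg (B c) ⊞ neg (B c))   ≡⟨ cong neg eq ⟩
      neg ⟦ 0 ⟧                     ≡⟨ -0#≈0# ⟩
      ⟦ 0 ⟧                         ∎)
      where open ≡-Reasoning

    sum-flip-off : ∀ σ L c → L (proj₂ c) ≢ proj₁ c → Σ[ flip c σ ] L ≡ Σ[ σ ] L
    sum-flip-off σ L c off = sumTo-cong k {label (flip c σ) ∘ at} {label σ ∘ at} λ i _ →
      cong (λ b → signed b (B (at i))) (flip-other {c} {at i} σ λ { refl → off refl })
      where
      at : ℕ → Cell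
      at i = L L.⟦ i ⟧ , L.⟦ i ⟧

    sum-flip-on : ∀ σ L d → let c = (L d , d) in Σ[ flip c σ ] L ≡ Σ[ σ ] L ⊞ neg (label σ c ⊞ label σ c)
    sum-flip-on σ L d = trans
      (sumTo-update k {toℕ d} {label σ ∘ at} {label (flip c σ) ∘ at} (toℕ<n d) λ i i<k i≢ → cong (λ b → signed b (B (at i))) (flip-other {c} {at i} σ λ eq →
        i≢ (trans (sym (L.toℕ-⟦⟧-small i<k)) (cong (toℕ ∘ proj₂) eq))))
      (cong (Σ[ σ ] L ⊞_) (begin
        label (flip c σ) (at (toℕ d)) ⊞ neg (label σ (at (toℕ d)))
          ≡⟨ cong (λ c′ → label (flip c σ) c′ ⊞ neg (label σ c′)) (cong (λ d → L d , d) (L.⟦⟧-toℕ d)) ⟩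
        signed (flip c σ c) (B c) ⊞ neg (label σ c)
          ≡⟨ cong (λ b → signed b (B c) ⊞ neg (label σ c)) (flip-same c σ) ⟩
        signed (not (σ c)) (B c) ⊞ neg (label σ c)
          ≡⟨ cong (_⊞ neg (label σ c)) (signed-not (σ c) (B c)) ⟩
        neg (label σ c) ⊞ neg (label σ c)
          ≡⟨ neg-⊞ _ _ ⟩
        neg (label σ c ⊞ label σ c) ∎))
      where
      open ≡-Reasoning
      c : Cell
      c = L d , d
      at : ℕ → Cell
      at i = L L.⟦ i ⟧ , L.⟦ i ⟧

    -- The sum of the line is to be made non-zero by the sign of its owner.
    record Step : Set where
      constructor _at_
      field
        line  : Level → Row
        level : Level

      owner : Cell
      owner = line level , level
    open Step public

    -- The line of `s` avoids the owner of `s′`, so a flip made for `s′` leaves the sum of `s`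
    -- alone.
    _▷_ : Step → Step → Set
    s ▷ s′ = line s (level s′) ≢ line s′ (level s′)

    fix : Step → Signs → Signs
    fix s σ with Σ[ σ ] (line s) Fin.≟ ⟦ 0 ⟧
    ... | yes _ = flip (owner s) σ
    ... | no  _ = σ

    -- Flipping the owner subtracts twice its label, so a zero sum becomes minus a double, and no
    -- label has double zero.
    fix-sum : ∀ s σ → Σ[ fix s σ ] (line s) ≢ ⟦ 0 ⟧
    fix-sum s σ with Σ[ σ ] (line s) Fin.≟ ⟦ 0 ⟧
    ... | no ≢0 = ≢0
    ... | yes ≡0 = λ eq → 2label≢0 σ (owner s) (neg-injective (begin
      neg (label σ (owner s) ⊞ label σ (owner s))                            ≡⟨ ⊞-identityˡ _ ⟨
      ⟦ 0 ⟧ ⊞ neg (label σ (owner s) ⊞ label σ (owner s))                    ≡⟨ cong (_⊞ neg (label σ (owner s) ⊞ label σ (owner s))) ≡0 ⟨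
      Σ[ σ ] (line s) ⊞ neg (label σ (owner s) ⊞ label σ (owner s))          ≡⟨ sum-flip-on σ (line s) (level s) ⟨
      Σ[ flip (owner s) σ ] (line s)                                         ≡⟨ eq ⟩
      ⟦ 0 ⟧                                                                  ≡⟨ -0#≈0# ⟨
      neg ⟦ 0 ⟧                                                              ∎))
      where open ≡-Reasoning

    fix-off : ∀ s σ L → L (level s) ≢ line s (level s) → Σ[ fix s σ ] L ≡ Σ[ σ ] L
    fix-off s σ L off with Σ[ σ ] (line s) Fin.≟ ⟦ 0 ⟧
    ... | yes _ = sum-flip-off σ L (owner s) off
    ... | no  _ = refl

    fix-sign : ∀ s σ c → c ≢ owner s → fix s σ c ≡ σ c
    fix-sign s σ c c≢ with Σ[ σ ] (line s) Fin.≟ ⟦ 0 ⟧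
    ... | yes _ = flip-other σ c≢
    ... | no  _ = refl

    fixAll : List Step → Signs → Signs
    fixAll []       σ = σ
    fixAll (s ∷ ss) σ = fixAll ss (fix s σ)

    fixAll-off : ∀ ss σ L → All (λ s → L (level s) ≢ line s (level s)) ss → Σ[ fixAll ss σ ] L ≡ Σ[ σ ] L
    fixAll-off []       σ L []           = refl
    fixAll-off (s ∷ ss) σ L (off ∷ offs) = trans (fixAll-off ss (fix s σ) L offs) (fix-off s σ L off)

    fixAll-sign : ∀ ss σ c → All (λ s → c ≢ owner s) ss → fixAll ss σ c ≡ σ c
    fixAll-sign []       σ c []           = refl
    fixAll-sign (s ∷ ss) σ c (off ∷ offs) = trans (fixAll-sign ss (fix s σ) c offs) (fix-sign s σ c off)

    -- The head of the list is treated first, and by `_▷_` no later flip touches its line, so what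
    -- `fix` achieved for it persists.
    fixAll-sum : ∀ ss σ → AllPairs _▷_ ss → All (λ s → Σ[ fixAll ss σ ] (line s) ≢ ⟦ 0 ⟧) ss
    fixAll-sum []       σ []             = []
    fixAll-sum (s ∷ ss) σ (later ∷ rest) =
      (λ eq → fix-sum s σ (trans (sym (fixAll-off ss (fix s σ) (line s) later)) eq)) ∷ fixAll-sum ss (fix s σ) rest

    -- A row and a column through the same two cells: among three sign choices with
    -- pairwise different sums on both lines, one makes both sums non-zero.
    module _ (σ : Signs) (L L′ : Level → Row) (d d′ : Level)
             (meet : L d ≡ L′ d) (meet′ : L d′ ≡ L′ d′) where
      private
        a b : Fin v
        a = label σ (L d , d)
        b = label σ (L d′ , d′)

        -- Each of the two sums vanishes for at most one of the three choices, so at most two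
        -- choices are spoiled.
        avoid : ∀ x y z x′ y′ z′ → x ≢ y → y ≢ z → x ≢ z → x′ ≢ y′ → y′ ≢ z′ → x′ ≢ z′ →
                (x ≢ ⟦ 0 ⟧ × x′ ≢ ⟦ 0 ⟧) ⊎ (y ≢ ⟦ 0 ⟧ × y′ ≢ ⟦ 0 ⟧) ⊎ (z ≢ ⟦ 0 ⟧ × z′ ≢ ⟦ 0 ⟧)
        avoid x y z x′ y′ z′ xy yz xz xy′ yz′ xz′ with x Fin.≟ ⟦ 0 ⟧ | x′ Fin.≟ ⟦ 0 ⟧ | y Fin.≟ ⟦ 0 ⟧ | y′ Fin.≟ ⟦ 0 ⟧
        ... | no p | no q | _ | _ = inj₁ (p , q)
        ... | yes p | yes q | _ | _ = inj₂ (inj₁ ((λ e → xy (trans p (sym e))) , (λ e → xy′ (trans q (sym e)))))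
        ... | yes p | no q | _ | no r = inj₂ (inj₁ ((λ e → xy (trans p (sym e))) , r))
        ... | yes p | no q | _ | yes r = inj₂ (inj₂ ((λ e → xz (trans p (sym e))) , (λ e → yz′ (trans r (sym e)))))
        ... | no p | yes q | no r | _ = inj₂ (inj₁ (r , (λ e → xy′ (trans q (sym e)))))
        ... | no p | yes q | yes r | _ = inj₂ (inj₂ ((λ e → yz (trans r (sym e))) , (λ e → xz′ (trans q (sym e)))))

        shifted : ∀ s {a} → a ⊞ a ≢ ⟦ 0 ⟧ → s ≢ s ⊞ neg (a ⊞ a)
        shifted s {a} 2a≢0 eq = 2a≢0 (neg-injective (trans
          (sym (⊞-cancelˡ s ⟦ 0 ⟧ _ (trans (⊞-identityʳ s) eq))) (sym -0#≈0#)))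

      settle : a ⊞ a ≢ b ⊞ b →
               ∃[ τ ] (Σ[ τ ] L ≢ ⟦ 0 ⟧ × Σ[ τ ] L′ ≢ ⟦ 0 ⟧
                 × (∀ c → c ≢ (L d , d) → c ≢ (L d′ , d′) → τ c ≡ σ c)
                 × (∀ M → M d ≢ L d → M d′ ≢ L d′ → Σ[ τ ] M ≡ Σ[ σ ] M))
      settle 2a≢2b
        with avoid (s L) (s L ⊞ neg (a ⊞ a)) (s L ⊞ neg (b ⊞ b)) (s L′) (s L′ ⊞ neg (a ⊞ a)) (s L′ ⊞ neg (b ⊞ b))
               (shifted (s L) 2a≢0) (λ eq → 2a≢2b (neg-injective (⊞-cancelˡ (s L) _ _ eq))) (shifted (s L) 2b≢0)
               (shifted (s L′) 2a≢0) (λ eq → 2a≢2b (neg-injective (⊞-cancelˡ (s L′) _ _ eq))) (shifted (s L′) 2b≢0)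
        where
        s : (Level → Row) → Fin v
        s = Σ[ σ ]
        2a≢0 : a ⊞ a ≢ ⟦ 0 ⟧
        2a≢0 = 2label≢0 σ (L d , d)
        2b≢0 : b ⊞ b ≢ ⟦ 0 ⟧
        2b≢0 = 2label≢0 σ (L d′ , d′)
      ... | inj₁ (p , q) = σ , p , q , (λ _ _ _ → refl) , (λ _ _ _ → refl)
      ... | inj₂ (inj₁ (p , q)) = flip (L d , d) σ ,
            (λ eq → p (trans (sym (sum-flip-on σ L d)) eq)) ,
            (λ eq → q (trans (sym (subst (λ x → Σ[ flip (x , d) σ ] L′ ≡ Σ[ σ ] L′ ⊞ neg (label σ (x , d) ⊞ label σ (x , d)))
               (sym meet) (sum-flip-on σ L′ d))) eq)) ,
            (λ c c≢ _ → flip-other σ c≢) ,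
            (λ M M≢ _ → sum-flip-off σ M _ M≢)
      ... | inj₂ (inj₂ (p , q)) = flip (L d′ , d′) σ ,
            (λ eq → p (trans (sym (sum-flip-on σ L d′)) eq)) ,
            (λ eq → q (trans (sym (subst (λ x → Σ[ flip (x , d′) σ ] L′ ≡ Σ[ σ ] L′ ⊞ neg (label σ (x , d′) ⊞ label σ (x , d′)))
               (sym meet′) (sum-flip-on σ L′ d′))) eq)) ,
            (λ c _ c≢ → flip-other σ c≢) ,
            (λ M _ M≢ → sum-flip-off σ M _ M≢)

-- The bipartite row/column graph of the array, whose edges are the cells, is exhausted by
-- a path ending in the double edge formed by the cells (0 , 0) and (0 , 1); every line off
-- that double edge owns one cell, which is on no line treated before it.
module Schedule (h′ l v : ℕ) .{{_ : NonZero v}} where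
  h : ℕ
  h = suc h′
  open Skeleton h l
  open Lines h l
  open Signs h l v
  open Residues v using () renaming (⟦_⟧ to ⟦_⟧ᵛ; _⊞_ to _⊞ᵛ_)
  open Residues n

  ⟦⟧-≢ : ∀ {a b} → a < n → b < n → a ≢ b → ⟦ a ⟧ ≢ ⟦ b ⟧
  ⟦⟧-≢ a<n b<n a≢b eq = a≢b (trans (sym (toℕ-⟦⟧-small a<n)) (trans (cong toℕ eq) (toℕ-⟦⟧-small b<n)))

  ⟦⟧-≢-neg : ∀ {a b} → 0 < a → a + b < n → ⟦ a ⟧ ≢ neg ⟦ b ⟧
  ⟦⟧-≢-neg {a} {b} 0<a a+b<n eq = ⟦⟧-≢ a+b<n z<s (m<n⇒n≢0 (<-≤-trans 0<a (m≤m+n a b)))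
    (trans (sym (⟦⟧-+ a b)) (trans (cong (_⊞ ⟦ b ⟧) eq) (⊞-inverseˡ ⟦ b ⟧)))

  ⟦suc⟧-1 : ∀ i → ⟦ suc i ⟧ ⊞ neg ⟦ 1 ⟧ ≡ ⟦ i ⟧
  ⟦suc⟧-1 i = trans (cong (_⊞ neg ⟦ 1 ⟧) (sym (⟦⟧-+ 1 i)))
    (solve 1 (λ i → (con (+ 1) :+ i) :+ (:- con (+ 1)) := i) refl ⟦ i ⟧)

  -- The cells whose signs must survive balancing. They contain those with the labels 1 and 3 to 6,
  -- where the sign matters for rigidity, and those that carry the free signs.
  data Kept : Cell → Set where
    kept₀ : ∀ {i} → 0 < i → i ≤ h → Kept (⟦ i ⟧ , 0F)
    kept₁ : Kept (⟦ h ⟧ , 1F)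
    kept₂ : ∀ {i} → 0 < i → i < h → Kept (⟦ i ⟧ , 2F)

  private
    h<n : h < n
    h<n = s≤s (m≤m+n h h)

    ≤h⇒<n : ∀ {i} → i ≤ h → i < n
    ≤h⇒<n i≤h = ≤-<-trans i≤h h<n

  module _ (B : Cell → Fin v) (2B≢0 : ∀ c → B c ⊞ᵛ B c ≢ ⟦ 0 ⟧ᵛ) where
    open Balancing B 2B≢0

    private
      lowRow lowColumn highColumn highRow : ℕ → Step
      lowRow i     = row ⟦ suc i ⟧ at 1F
      lowColumn i  = column ⟦ suc i ⟧ at 1F
      highColumn r = column ⟦ r ⟧ at 0F
      highRow r    = row ⟦ r ⟧ at 2F

      -- Row `h` cannot follow the pattern of the lower rows: its cell at level 1 bears the label 1,
      -- whose sign is kept. Hence it owns its cell at level 2.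
      middleRow : Step
      middleRow = row ⟦ h ⟧ at 2F

      high : ℕ → ℕ → List Step
      high zero    r = []
      high (suc m) r = highColumn r ∷ highRow r ∷ high m (suc r)

      high-all : ∀ {Q : Step → Set} m r → (∀ j → r ≤ j → j < r + m → Q (highColumn j)) →
                 (∀ j → r ≤ j → j < r + m → Q (highRow j)) → All Q (high m r)
      high-all zero    r q q′ = []
      high-all (suc m) r q q′ =
        q r ≤-refl (m<m+n r z<s) ∷ q′ r ≤-refl (m<m+n r z<s) ∷
        high-all m (suc r) (λ j r<j j< → q j (<⇒≤ r<j) (subst (j <_) (sym (+-suc r m)) j<))
                           (λ j r<j j< → q′ j (<⇒≤ r<j) (subst (j <_) (sym (+-suc r m)) j<))

      high-lookup : ∀ {Q : Step → Set} m r → All Q (high m r) → ∀ j → r ≤ j → j < r + m → Q (highColumn j) × Q (highRow j)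
      high-lookup zero    r [] j r≤j j< = contradiction (subst (j <_) (+-identityʳ r) j<) (≤⇒≯ r≤j)
      high-lookup (suc m) r (q ∷ q′ ∷ qs) j r≤j j< with m≤n⇒m<n∨m≡n r≤j
      ... | inj₁ r<j  = high-lookup m (suc r) qs j r<j (subst (j <_) (+-suc r m) j<)
      ... | inj₂ refl = q , q′

      lows : List Step
      lows = applyUpTo lowColumn h

      -- The owners of the low rows and columns lie on high lines: the cell `(x , 1F)` is on column
      -- -x, and `(h , 2F)` is on column h + 1. The high lines alternate, as `(r , 0F)` is on row r
      -- and `(r , 2F)` on column r + 1, and the last of them, row 2h, leads to column 0.
      steps : List Step
      steps = applyUpTo lowRow h′ ++ middleRow ∷ lows ++ high h (suc h)

      tail-all : ∀ {Q : Step → Set} → (∀ {i} → i < h → Q (lowColumn i)) →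
                 (∀ j → suc h ≤ j → j < n → Q (highColumn j)) → (∀ j → suc h ≤ j → j < n → Q (highRow j)) →
                 All Q (lows ++ high h (suc h))
      tail-all q q′ q″ = All.++⁺ (All.applyUpTo⁺₁ lowColumn h q) (high-all h (suc h) q′ q″)

      steps-all : ∀ {Q : Step → Set} → (∀ {i} → i < h′ → Q (lowRow i)) → Q middleRow → (∀ {i} → i < h → Q (lowColumn i)) →
                  (∀ j → suc h ≤ j → j < n → Q (highColumn j)) → (∀ j → suc h ≤ j → j < n → Q (highRow j)) → All Q steps
      steps-all q qm q₁ q₂ q₃ = All.++⁺ (All.applyUpTo⁺₁ lowRow h′ q) (qm ∷ tail-all q₁ q₂ q₃)

      low-high : ∀ {i j} → i ≤ h → suc h ≤ j → j < n → ⟦ i ⟧ ≢ ⟦ j ⟧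
      low-high i≤h h<j j<n = ⟦⟧-≢ (≤h⇒<n i≤h) j<n (<⇒≢ (≤-<-trans i≤h h<j))

      low-neg : ∀ {i j} → suc i ≤ h → suc j ≤ h → ⟦ suc i ⟧ ≢ neg ⟦ suc j ⟧
      low-neg i<h j<h = ⟦⟧-≢-neg z<s (s≤s (+-mono-≤ i<h j<h))

      ordered : AllPairs _▷_ steps
      ordered = AllPairs.++⁺
        (AllPairs.applyUpTo⁺₁ lowRow h′ λ i<j j<h′ → let j<h = s≤s (<⇒≤ j<h′) in
          ⟦⟧-≢ (≤h⇒<n (≤-trans (s≤s (<⇒≤ i<j)) j<h)) (≤h⇒<n j<h) (<⇒≢ (s<s i<j)))
        (tail-all (λ {i} i<h → low-neg ≤-refl i<h) (λ j → low-high ≤-refl) (λ j → low-high ≤-refl)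
          ∷ AllPairs.++⁺
              (AllPairs.applyUpTo⁺₁ lowColumn h λ i<j j<h eq →
                ⟦⟧-≢ (≤h⇒<n (<-trans i<j j<h)) (≤h⇒<n j<h) (<⇒≢ (s<s i<j)) (neg-injective eq))
              (high-ordered h (suc h) (s≤s z≤n) ≤-refl)
              (All.applyUpTo⁺₁ lowColumn h λ {i} i<h → high-all h (suc h)
                (λ j → low-high i<h)
                (λ j h<j j<n eq → low-high (<⇒≤ i<h) h<j j<n (trans (sym (⟦suc⟧-1 i)) eq))))
        (All.applyUpTo⁺₁ lowRow h′ λ {i} i<h′ → let i<h = s≤s (<⇒≤ i<h′) in
          ⟦⟧-≢ (≤h⇒<n i<h) h<n (<⇒≢ (s<s i<h′))
          ∷ tail-all (λ j<h → low-neg i<h j<h) (λ j → low-high i<h) (λ j → low-high i<h))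
        where
        high-ordered : ∀ m r → 0 < r → r + m ≤ n → AllPairs _▷_ (high m r)
        high-ordered zero    r         _   _    = []
        high-ordered (suc m) r@(suc r′) 0<r r+m≤n =
          ((λ eq → below ≤-refl r<n (trans (sym (⟦suc⟧-1 r′)) eq))
            ∷ high-all m (suc r) (λ j r<j j< → below r<j (j<n j<))
                (λ j r<j j< eq → below (<⇒≤ r<j) (j<n j<) (trans (sym (⟦suc⟧-1 r′)) eq)))
          ∷ high-all m (suc r) (λ j r<j j< → below r<j (j<n j<)) (λ j r<j j< → below r<j (j<n j<))
          ∷ high-ordered m (suc r) z<s r+m≤n′
          where
          r+m≤n′ : suc r + m ≤ n
          r+m≤n′ = subst (_≤ n) (+-suc r m) r+m≤n
          r<n : r < n
          r<n = <-≤-trans (m<m+n r z<s) r+m≤n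
          j<n : ∀ {j} → j < suc r + m → j < n
          j<n j< = <-≤-trans j< r+m≤n′
          below : ∀ {i j} → i < j → j < n → ⟦ i ⟧ ≢ ⟦ j ⟧
          below i<j j<n = ⟦⟧-≢ (<-trans i<j j<n) j<n (<⇒≢ i<j)

      positive : ∀ {i} → 0 < i → i < n → ⟦ i ⟧ ≢ ⟦ 0 ⟧
      positive 0<i i<n = ⟦⟧-≢ i<n z<s (m<n⇒n≢0 0<i)

      neg-positive : ∀ {i} → 0 < i → i < n → neg ⟦ i ⟧ ≢ ⟦ 0 ⟧
      neg-positive 0<i i<n eq = positive 0<i i<n (trans (sym (neg-involutive _)) (trans (cong neg eq) -0#≈0#))

      Missing : Step → Set
      Missing s = line s 0F ≢ ⟦ 0 ⟧ × line s 1F ≢ ⟦ 0 ⟧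

      -- Lets `settle` flip a cell of the double edge at the end without disturbing the sums already
      -- made non-zero.
      missing : All Missing steps
      missing = steps-all
        (λ i<h′ → twice (positive z<s (≤h⇒<n (s≤s (<⇒≤ i<h′)))))
        (twice (positive z<s h<n))
        (λ i<h → positive z<s (≤h⇒<n i<h) , neg-positive z<s (≤h⇒<n i<h))
        (λ j h<j j<n → positive (<-trans z<s h<j) j<n , neg-positive (<-trans z<s h<j) j<n)
        (λ j h<j j<n → twice (positive (<-trans z<s h<j) j<n))
        where
        twice : ∀ {Q : Set} → Q → Q × Q
        twice q = q , q

      kept-unowned : ∀ {c} → Kept c → All (λ s → c ≢ owner s) steps
      kept-unowned {c} kept = steps-all (λ {i} → lr kept i) (mr kept) (λ {i} → lc kept i) (hc kept) (hr kept)
        where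
        lr : ∀ {c} → Kept c → ∀ i → i < h′ → c ≢ owner (lowRow i)
        lr (kept₀ _ _) i i<h′ ()
        lr kept₁ i i<h′ eq = ⟦⟧-≢ h<n (≤h⇒<n (s≤s (<⇒≤ i<h′))) (>⇒≢ (s<s i<h′)) (cong proj₁ eq)
        lr (kept₂ _ _) i i<h′ ()
        mr : ∀ {c} → Kept c → c ≢ owner middleRow
        mr (kept₀ _ _) ()
        mr kept₁ ()
        mr (kept₂ _ i<h) eq = ⟦⟧-≢ (≤h⇒<n (<⇒≤ i<h)) h<n (<⇒≢ i<h) (cong proj₁ eq)
        lc : ∀ {c} → Kept c → ∀ i → i < h → c ≢ owner (lowColumn i)
        lc (kept₀ _ _) i i<h ()
        lc kept₁ i i<h eq = low-neg ≤-refl i<h (cong proj₁ eq)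
        lc (kept₂ _ _) i i<h ()
        hc : ∀ {c} → Kept c → ∀ j → suc h ≤ j → j < n → c ≢ owner (highColumn j)
        hc (kept₀ _ i≤h) j h<j j<n eq = low-high i≤h h<j j<n (cong proj₁ eq)
        hc kept₁ j h<j j<n ()
        hc (kept₂ _ _) j h<j j<n ()
        hr : ∀ {c} → Kept c → ∀ j → suc h ≤ j → j < n → c ≢ owner (highRow j)
        hr (kept₀ _ _) j h<j j<n ()
        hr kept₁ j h<j j<n ()
        hr (kept₂ _ i<h) j h<j j<n eq = low-high (<⇒≤ i<h) h<j j<n (cong proj₁ eq)

      kept-≢₀ : ∀ {c} → Kept c → c ≢ (⟦ 0 ⟧ , 0F)
      kept-≢₀ (kept₀ 0<i i≤h) eq = positive 0<i (≤h⇒<n i≤h) (cong proj₁ eq)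
      kept-≢₀ kept₁ ()
      kept-≢₀ (kept₂ _ _) ()

      kept-≢₁ : ∀ {c} → Kept c → c ≢ (⟦ 0 ⟧ , 1F)
      kept-≢₁ (kept₀ _ _) ()
      kept-≢₁ kept₁ eq = positive z<s h<n (cong proj₁ eq)
      kept-≢₁ (kept₂ _ _) ()

    -- The hypothesis is about every choice of signs because the signs on the double edge after the
    -- preceding steps are not known.
    balance : (∀ τ → label τ (⟦ 0 ⟧ , 0F) ⊞ᵛ label τ (⟦ 0 ⟧ , 0F) ≢ label τ (⟦ 0 ⟧ , 1F) ⊞ᵛ label τ (⟦ 0 ⟧ , 1F)) → ∀ σ →
              ∃[ τ ] ((∀ x → Σ[ τ ] (row x) ≢ ⟦ 0 ⟧ᵛ) × (∀ y → Σ[ τ ] (column y) ≢ ⟦ 0 ⟧ᵛ) × (∀ c → Kept c → τ c ≡ σ c))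
    balance 2a≢2b σ =
      let σ′ = fixAll steps σ
          τ , row₀ , column₀ , same , unaffected =
            settle σ′ (row ⟦ 0 ⟧) (column ⟦ 0 ⟧) 0F 1F refl (sym -0#≈0#) (2a≢2b σ′)
          sums : All (λ s → Σ[ τ ] (line s) ≢ ⟦ 0 ⟧ᵛ) steps
          sums = All.zipWith (λ { {s} (sum≢0 , miss₀ , miss₁) eq → sum≢0 (trans (sym (unaffected (line s) miss₀ miss₁)) eq) })
                   (fixAll-sum steps σ ordered , missing)
          lowRows , rest = All.++⁻ (applyUpTo lowRow h′) sums
          rowₘ = All.head rest
          lowColumns , highs = All.++⁻ lows (All.tail rest)
          rows : ∀ i → i < n → Σ[ τ ] (row ⟦ i ⟧) ≢ ⟦ 0 ⟧ᵛ
          rows = λ { zero i<n → row₀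
                   ; (suc i) i<n → [ (λ i<h′ → All.applyUpTo⁻ lowRow h′ lowRows i<h′)
                                   , (λ h′≤i → [ (λ h′<i → proj₂ (high-lookup h (suc h) highs (suc i) (s≤s h′<i) i<n))
                                               , (λ { refl → rowₘ }) ]′ (m≤n⇒m<n∨m≡n h′≤i)) ]′ (<-≤-connex i h′) }
          columns : ∀ i → i < n → Σ[ τ ] (column ⟦ i ⟧) ≢ ⟦ 0 ⟧ᵛ
          columns = λ { zero i<n → column₀
                      ; (suc i) i<n → [ (λ i<h → All.applyUpTo⁻ lowColumn h lowColumns i<h)
                                      , (λ h≤i → proj₁ (high-lookup h (suc h) highs (suc i) (s≤s h≤i) i<n)) ]′ (<-≤-connex i h) }
      in τ ,
         (λ x → subst (λ x → Σ[ τ ] (row x) ≢ ⟦ 0 ⟧ᵛ) (⟦⟧-toℕ x) (rows (toℕ x) (toℕ<n x))) ,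
         (λ y → subst (λ y → Σ[ τ ] (column y) ≢ ⟦ 0 ⟧ᵛ) (⟦⟧-toℕ y) (columns (toℕ y) (toℕ<n y))) ,
         (λ c kept → trans (same c (kept-≢₀ kept) (kept-≢₁ kept)) (fixAll-sign steps σ c (kept-unowned kept)))

-- Counting

remQuot-injective : ∀ {m} n {i j : Fin (m * n)} → remQuot {m} n i ≡ remQuot n j → i ≡ j
remQuot-injective {m} n {i} {j} eq =
  trans (sym (Fin.combine-remQuot {m} n i)) (trans (cong (uncurry combine) eq) (Fin.combine-remQuot {m} n j))

-- The factorial number system: the leading digit is the image of 0, the others encode the
-- permutation of the remaining points.
decodePermutation : ∀ m → Fin (m !) → Permutation m m
decodePermutation zero    c = Perm.id
decodePermutation (suc m) c = let i , c′ = remQuot {suc m} (m !) c in insert 0F i (decodePermutation m c′)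

decodePermutation-injective : ∀ m c c′ → (∀ i → decodePermutation m c ⟨$⟩ʳ i ≡ decodePermutation m c′ ⟨$⟩ʳ i) → c ≡ c′
decodePermutation-injective zero    0F 0F eq = refl
decodePermutation-injective (suc m) c  c′ eq = remQuot-injective {suc m} (m !) (cong₂ _,_ first rest)
  where
  open ≡-Reasoning
  i i′ : Fin (suc m)
  i  = proj₁ (remQuot {suc m} (m !) c)
  i′ = proj₁ (remQuot {suc m} (m !) c′)
  d d′ : Fin (m !)
  d  = proj₂ (remQuot {suc m} (m !) c)
  d′ = proj₂ (remQuot {suc m} (m !) c′)
  first : i ≡ i′
  first = eq 0F
  rest : d ≡ d′
  rest = decodePermutation-injective m d d′ λ j → Fin.punchIn-injective i _ _ (begin
    punchIn i (decodePermutation m d ⟨$⟩ʳ j)          ≡⟨ insert-punchIn 0F i (decodePermutation m d) j ⟨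
    decodePermutation (suc m) c ⟨$⟩ʳ suc j            ≡⟨ eq (suc j) ⟩
    decodePermutation (suc m) c′ ⟨$⟩ʳ suc j           ≡⟨ insert-punchIn 0F i′ (decodePermutation m d′) j ⟩
    punchIn i′ (decodePermutation m d′ ⟨$⟩ʳ j)        ≡⟨ cong (λ i → punchIn i (decodePermutation m d′ ⟨$⟩ʳ j)) first ⟨
    punchIn i (decodePermutation m d′ ⟨$⟩ʳ j)         ∎)

isZero : Fin 2 → Bool
isZero 0F = true
isZero 1F = false

isZero-injective : ∀ {a b} → isZero a ≡ isZero b → a ≡ b
isZero-injective {0F} {0F} eq = refl
isZero-injective {0F} {1F} ()
isZero-injective {1F} {0F} ()
isZero-injective {1F} {1F} eq = refl

decodeBits : ∀ e → Fin (2 ^ e) → ℕ → Bool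
decodeBits zero    c _       = true
decodeBits (suc e) c zero    = isZero (proj₁ (remQuot {2} (2 ^ e) c))
decodeBits (suc e) c (suc j) = decodeBits e (proj₂ (remQuot {2} (2 ^ e) c)) j

decodeBits-injective : ∀ e c c′ → (∀ j → j < e → decodeBits e c j ≡ decodeBits e c′ j) → c ≡ c′
decodeBits-injective zero    0F 0F eq = refl
decodeBits-injective (suc e) c  c′ eq = remQuot-injective {2} (2 ^ e) (cong₂ _,_
  (isZero-injective (eq 0 z<s)) (decodeBits-injective e _ _ λ j j<e → eq (suc j) (s<s j<e)))

lift : ∀ r {m} → Permutation m m → Permutation (r + m) (r + m)
lift zero    π = π
lift (suc r) π = lift₀ (lift r π)

lift-injective : ∀ r {m} {π π′ : Permutation m m} → (∀ i → lift r π ⟨$⟩ʳ i ≡ lift r π′ ⟨$⟩ʳ i) → ∀ i → π ⟨$⟩ʳ i ≡ π′ ⟨$⟩ʳ i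
lift-injective zero    eq = eq
lift-injective (suc r) eq = lift-injective r λ i → Fin.suc-injective (eq (suc i))

lift-fixes : ∀ r {m} (π : Permutation m m) i → toℕ i < r → lift r π ⟨$⟩ʳ i ≡ i
lift-fixes (suc r) π zero    _   = refl
lift-fixes (suc r) π (suc i) i<r = cong suc (lift-fixes r π i (s<s⁻¹ i<r))

module _ {A : Set} {N : ℕ} where

  Numbers : (A ↔ Fin N) → ℕ → List A → Set
  Numbers θ r []       = ⊤
  Numbers θ r (x ∷ xs) = toℕ (Inverse.to θ x) ≡ r × Numbers θ (suc r) xs

  private
    length+ : ℕ → List A → ℕ
    length+ r []       = r
    length+ r (x ∷ xs) = length+ (suc r) xs

    r≤length+ : ∀ r xs → r ≤ length+ r xs
    r≤length+ r []       = ≤-refl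
    r≤length+ r (x ∷ xs) = ≤-trans (n≤1+n r) (r≤length+ (suc r) xs)

    swap-left : ∀ (i j : Fin N) → swap i j i ≡ j
    swap-left i j with i Fin.≟ i
    ... | yes _  = refl
    ... | no i≢i = contradiction refl i≢i

    swap-other : ∀ (i j k : Fin N) → k ≢ i → k ≢ j → swap i j k ≡ k
    swap-other i j k k≢i k≢j with k Fin.≟ i
    ... | yes eq = contradiction eq k≢i
    ... | no _ with k Fin.≟ j
    ...   | yes eq = contradiction eq k≢j
    ...   | no _   = refl

  -- One transposition puts `x` in place `r`. The last clause is the invariant that protects the
  -- numbers below `r` already assigned; the elements of the list itself are exempt from it.
  renumber-from : ∀ (θ : A ↔ Fin N) r xs → AllPairs _≢_ xs → length+ r xs ≤ N →
             ∃[ θ′ ] (Numbers θ′ r xs × (∀ y → toℕ (Inverse.to θ y) < r → All (_≢_ y) xs → Inverse.to θ′ y ≡ Inverse.to θ y))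
  renumber-from θ r [] [] r≤N = θ , tt , λ y _ _ → refl
  renumber-from θ r (x ∷ xs) (x∉xs ∷ unique) len≤N =
    let θ′ , numbers , keeps = renumber-from θ₁ (suc r) xs unique len≤N
    in θ′ ,
       (trans (cong toℕ (keeps x (subst (_< suc r) (sym at-x) ≤-refl) x∉xs)) at-x , numbers) ,
       λ { y y<r (y≢x ∷ y∉xs) →
             let θ₁y = swap-other (θ.to x) r′ (θ.to y) (y≢x ∘ θ-injective) λ eq → <⇒≢ y<r (trans (cong toℕ eq) (Fin.toℕ-fromℕ< r<N))
             in trans (keeps y (subst (_< suc r) (sym (cong toℕ θ₁y)) (m<n⇒m<1+n y<r)) y∉xs) θ₁y }
    where
    module θ = Inverse θ
    r<N : r < N
    r<N = ≤-trans (r≤length+ (suc r) xs) len≤N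
    r′ : Fin N
    r′ = fromℕ< r<N
    θ₁ : A ↔ Fin N
    θ₁ = Perm.transpose (θ.to x) r′ ↔-∘ θ
    at-x : toℕ (Inverse.to θ₁ x) ≡ r
    at-x = trans (cong toℕ (swap-left (θ.to x) r′)) (Fin.toℕ-fromℕ< r<N)
    θ-injective : ∀ {y z} → θ.to y ≡ θ.to z → y ≡ z
    θ-injective {y} {z} eq = trans (sym (θ.strictlyInverseʳ y)) (trans (cong θ.from eq) (θ.strictlyInverseʳ z))

  renumber : (θ : A ↔ Fin N) (xs : List A) → AllPairs _≢_ xs → length+ 0 xs ≤ N → ∃[ θ′ ] Numbers θ′ 0 xs
  renumber θ xs unique len≤N = let θ′ , numbers , _ = renumber-from θ 0 xs unique len≤N in θ′ , numbers

-- The family of labelled embeddings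

Biembeddings : (v t k N : ℕ) .{{_ : NonZero t}} → Set
Biembeddings v t k N =
  Σ[ Π ∈ (Fin N → Embedding (Multipartite v t)) ]
  (∀ i j → i ≢ j → Distinct (Π i) (Π j))
  × (∀ i → IsBiembedding (Π i))
  × (∀ i → AutIsTranslations (Π i))
  × (∀ i e → ∃[ m ] FaceLength (Π i) e m × k ∣ m × k < m)
  × (Prime v → ∀ i → Gonal (k * v) (Π i))

-- The seven prescribed labels leave M′ = nk − 7 of the nk label values to be permuted
-- freely; the signs of the e cells (i , 0), 3 ≤ i ≤ h, are free as well.
module Family (e l v t p M′ : ℕ) .{{_ : NonZero v}} .{{_ : NonZero t}} .{{_ : NonZero p}}
              (e>0 : 0 < e) (tp : t * p ≡ (7 + M′) + (7 + M′)) (v≡ : v ≡ suc p * t) (p≥18 : 18 ≤ p)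
              (size : suc ((2 + e) + (2 + e)) * (3 + (l + l)) ≡ 7 + M′) where

  private
    M : ℕ
    M = 7 + M′

  open Schedule (suc e) l v
  open Skeleton h l
  open Lines h l
  open Signs h l v
  open Residues v
  private
    module R = Residues n

    opaque
      values : HalfSystem M v t p
      values = halfSystem M v t p tp v≡

  open HalfSystem values

  private
    v>18 : 18 < v
    v>18 = subst (18 <_) (sym v≡) (≤-trans (s≤s p≥18) (m≤m*n (suc p) t))

    ⟦⟧≢0 : ∀ {a} → 0 < a → a ≤ 18 → ⟦ a ⟧ ≢ ⟦ 0 ⟧
    ⟦⟧≢0 {a} 0<a a≤18 eq = m<n⇒n≢0 0<a (trans (sym (toℕ-⟦⟧-small (≤-<-trans a≤18 v>18)))
      (trans (cong toℕ eq) (toℕ-⟦⟧-small (<-trans z<s v>18))))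

    small : ∀ {a} → a ≤ 2 → a < n
    small a≤2 = s≤s (≤-trans a≤2 (≤-trans (m≤m+n 2 e) (m≤m+n h h)))

    h<n : h < n
    h<n = s≤s (m≤m+n h h)

    -- In this order the cells receive the absolute labels 1 to 7: 1 connects the graph and anchors
    -- the rotation, 2 excludes reflections, (3, 4) and (5, 6) are the pairs at the levels 0 and 2,
    -- and 7 joins 2 on the double edge.
    prescribed : List Cell
    prescribed = (R.⟦ h ⟧ , 1F) ∷ (R.⟦ 0 ⟧ , 1F) ∷ (R.⟦ 1 ⟧ , 0F) ∷ (R.⟦ 2 ⟧ , 0F) ∷
                 (R.⟦ 1 ⟧ , 2F) ∷ (R.⟦ 2 ⟧ , 2F) ∷ (R.⟦ 0 ⟧ , 0F) ∷ []

    prescribed-distinct : AllPairs _≢_ prescribed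
    prescribed-distinct =
      (rows≢ h<n z<s (λ ()) ∷ levels≢ (λ ()) ∷ levels≢ (λ ()) ∷ levels≢ (λ ()) ∷ levels≢ (λ ()) ∷ levels≢ (λ ()) ∷ []) ∷
      (levels≢ (λ ()) ∷ levels≢ (λ ()) ∷ levels≢ (λ ()) ∷ levels≢ (λ ()) ∷ levels≢ (λ ()) ∷ []) ∷
      (rows≢ (small (s≤s z≤n)) (small ≤-refl) (λ ()) ∷ levels≢ (λ ()) ∷ levels≢ (λ ()) ∷ rows≢ (small (s≤s z≤n)) z<s (λ ()) ∷ []) ∷
      (levels≢ (λ ()) ∷ levels≢ (λ ()) ∷ rows≢ (small ≤-refl) z<s (λ ()) ∷ []) ∷
      (rows≢ (small (s≤s z≤n)) (small ≤-refl) (λ ()) ∷ levels≢ (λ ()) ∷ []) ∷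
      (levels≢ (λ ()) ∷ []) ∷ [] ∷ []
      where
      rows≢ : ∀ {a b} {d d′ : Level} → a < n → b < n → a ≢ b → (R.⟦ a ⟧ , d) ≢ (R.⟦ b ⟧ , d′)
      rows≢ a<n b<n a≢b eq = ⟦⟧-≢ a<n b<n a≢b (cong proj₁ eq)
      levels≢ : ∀ {x x′ : Row} {d d′ : Level} → d ≢ d′ → (x , d) ≢ (x′ , d′)
      levels≢ d≢d′ eq = d≢d′ (cong proj₂ eq)

    cells : Cell ↔ Fin M
    cells = Perm.cast-id size ↔-∘ ↔-sym (Fin.*↔× {n} {k})

    opaque
      numbering : ∃[ θ ] Numbers {Cell} {M} θ 0 prescribed
      numbering = renumber cells prescribed prescribed-distinct (m≤m+n 7 M′)

    θ : Cell ↔ Fin M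
    θ = proj₁ numbering

    θ-numbers : Numbers {Cell} {M} θ 0 prescribed
    θ-numbers = proj₂ numbering

  signed-value : ∀ b b′ {i j} → signed b (value i) ≡ signed b′ (value j) → i ≡ j × b ≡ b′
  signed-value true  true  eq = value-injective eq , refl
  signed-value true  false eq = contradiction eq (value-sign _ _)
  signed-value false true  eq = contradiction (sym eq) (value-sign _ _)
  signed-value false false eq = value-injective (neg-injective eq) , refl

  private
    signed∉J : ∀ b i → ¬ InJ v t (signed b (value i))
    signed∉J true  i = value∉J i
    signed∉J false i = neg-∉J (value∉J i)

    double≢0 : ∀ x → x ≢ neg x → x ⊞ x ≢ ⟦ 0 ⟧
    double≢0 x x≢-x eq = x≢-x (begin
      x                     ≡⟨ solve 1 (λ b → b := (b :+ b) :+ (:- b)) refl x ⟩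
      (x ⊞ x) ⊞ neg x       ≡⟨ cong (_⊞ neg x) eq ⟩
      ⟦ 0 ⟧ ⊞ neg x         ≡⟨ ⊞-identityˡ (neg x) ⟩
      neg x                 ∎)
      where open ≡-Reasoning

  opaque
    permute : Fin (M′ !) → Permutation M M
    permute code = lift 7 (decodePermutation M′ code)

    permute-fixes : ∀ code i → toℕ i < 7 → permute code ⟨$⟩ʳ i ≡ i
    permute-fixes code = lift-fixes 7 (decodePermutation M′ code)

    permute-injective : ∀ {code code′} → (∀ i → permute code ⟨$⟩ʳ i ≡ permute code′ ⟨$⟩ʳ i) → code ≡ code′
    permute-injective {code} {code′} eq = decodePermutation-injective M′ code code′
      (lift-injective 7 {π = decodePermutation M′ code} {decodePermutation M′ code′} eq)

  module Member (code : Fin (M′ !)) (bits : Fin (2 ^ e)) where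
    π : Permutation M M
    π = permute code

    B : Cell → Fin v
    B c = value (π ⟨$⟩ʳ Inverse.to θ c)

    -- The free signs start at row 3, since the rows 1 and 2 hold prescribed labels at level 0 and
    -- row 0 lies on the double edge.
    bitFrom3 : ℕ → Bool
    bitFrom3 (suc (suc (suc j))) = decodeBits e bits j
    bitFrom3 _                   = true

    σ : Signs
    σ (x , 0F)    = bitFrom3 (toℕ x)
    σ (x , suc _) = true

    2B≢0 : ∀ c → B c ⊞ B c ≢ ⟦ 0 ⟧
    2B≢0 c = double≢0 (B c) (value-sign (π ⟨$⟩ʳ Inverse.to θ c) (π ⟨$⟩ʳ Inverse.to θ c))

    B-prescribed : ∀ {c r} → r < 7 → toℕ (Inverse.to θ c) ≡ r → B c ≡ ⟦ suc r ⟧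
    B-prescribed {c} {r} r<7 θc≡r = begin
      value (π ⟨$⟩ʳ Inverse.to θ c)   ≡⟨ cong value (permute-fixes code (Inverse.to θ c) (subst (_< 7) (sym θc≡r) r<7)) ⟩
      value (Inverse.to θ c)
        ≡⟨ value-small (Inverse.to θ c) (subst (_< p) (sym θc≡r) (<-≤-trans r<7 (≤-trans (m≤m+n 7 11) p≥18))) ⟩
      ⟦ suc (toℕ (Inverse.to θ c)) ⟧  ≡⟨ cong (⟦_⟧ ∘ suc) θc≡r ⟩
      ⟦ suc r ⟧                       ∎
      where open ≡-Reasoning

    open Balancing B 2B≢0 using (label; Σ[_])

    -- The doubles ±14 and ±4 differ by ±10 or ±18, and `v` exceeds 18; this is one reason for the
    -- bound on `p`.
    7≢2 : ∀ τ → label τ (R.⟦ 0 ⟧ , 0F) ⊞ label τ (R.⟦ 0 ⟧ , 0F) ≢ label τ (R.⟦ 0 ⟧ , 1F) ⊞ label τ (R.⟦ 0 ⟧ , 1F)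
    7≢2 τ eq = let _ , n₂ , _ , _ , _ , _ , n₇ , _ = θ-numbers in doubles (τ (R.⟦ 0 ⟧ , 0F)) (τ (R.⟦ 0 ⟧ , 1F)) (begin
        signed b₇ ⟦ 7 ⟧ ⊞ signed b₇ ⟦ 7 ⟧   ≡⟨ cong (λ x → signed b₇ x ⊞ signed b₇ x) (B-prescribed (m≤m+n 7 0) n₇) ⟨
        _                                   ≡⟨ eq ⟩
        _                                   ≡⟨ cong (λ x → signed b₂ x ⊞ signed b₂ x) (B-prescribed (m≤m+n 2 5) n₂) ⟩
        signed b₂ ⟦ 2 ⟧ ⊞ signed b₂ ⟦ 2 ⟧   ∎)
      where
      open ≡-Reasoning
      b₇ b₂ : Bool
      b₇ = τ (R.⟦ 0 ⟧ , 0F)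
      b₂ = τ (R.⟦ 0 ⟧ , 1F)
      ⟦10⟧≢0 : ⟦ 10 ⟧ ≢ ⟦ 0 ⟧
      ⟦10⟧≢0 = ⟦⟧≢0 z<s (m≤m+n 10 8)
      ⟦18⟧≢0 : ⟦ 18 ⟧ ≢ ⟦ 0 ⟧
      ⟦18⟧≢0 = ⟦⟧≢0 z<s ≤-refl
      doubles : ∀ b b′ → signed b ⟦ 7 ⟧ ⊞ signed b ⟦ 7 ⟧ ≢ signed b′ ⟦ 2 ⟧ ⊞ signed b′ ⟦ 2 ⟧
      doubles true true eq = ⟦10⟧≢0 (begin
        ⟦ 10 ⟧                                    ≡⟨ solve 0 (con (+ 10) := (con (+ 7) :+ con (+ 7)) :+ (:- (con (+ 2) :+ con (+ 2)))) refl ⟩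
        (⟦ 7 ⟧ ⊞ ⟦ 7 ⟧) ⊞ neg (⟦ 2 ⟧ ⊞ ⟦ 2 ⟧)     ≡⟨ cong (_⊞ neg (⟦ 2 ⟧ ⊞ ⟦ 2 ⟧)) eq ⟩
        (⟦ 2 ⟧ ⊞ ⟦ 2 ⟧) ⊞ neg (⟦ 2 ⟧ ⊞ ⟦ 2 ⟧)     ≡⟨ ⊞-inverseʳ _ ⟩
        ⟦ 0 ⟧                                     ∎)
      doubles true false eq = ⟦18⟧≢0 (begin
        ⟦ 18 ⟧                                    ≡⟨ solve 0 (con (+ 18) := (con (+ 7) :+ con (+ 7)) :+ (con (+ 2) :+ con (+ 2))) refl ⟩
        (⟦ 7 ⟧ ⊞ ⟦ 7 ⟧) ⊞ (⟦ 2 ⟧ ⊞ ⟦ 2 ⟧)         ≡⟨ cong (_⊞ (⟦ 2 ⟧ ⊞ ⟦ 2 ⟧)) eq ⟩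
        (neg ⟦ 2 ⟧ ⊞ neg ⟦ 2 ⟧) ⊞ (⟦ 2 ⟧ ⊞ ⟦ 2 ⟧)
          ≡⟨ solve 0 (((:- con (+ 2)) :+ (:- con (+ 2))) :+ (con (+ 2) :+ con (+ 2)) := con (+ 0)) refl ⟩
        ⟦ 0 ⟧                                     ∎)
      doubles false true eq = ⟦18⟧≢0 (begin
        ⟦ 18 ⟧
          ≡⟨ solve 0 (con (+ 18) := (:- ((:- con (+ 7)) :+ (:- con (+ 7)))) :+ (con (+ 2) :+ con (+ 2))) refl ⟩
        neg (neg ⟦ 7 ⟧ ⊞ neg ⟦ 7 ⟧) ⊞ (⟦ 2 ⟧ ⊞ ⟦ 2 ⟧)  ≡⟨ cong (λ x → neg x ⊞ (⟦ 2 ⟧ ⊞ ⟦ 2 ⟧)) eq ⟩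
        neg (⟦ 2 ⟧ ⊞ ⟦ 2 ⟧) ⊞ (⟦ 2 ⟧ ⊞ ⟦ 2 ⟧)          ≡⟨ ⊞-inverseˡ _ ⟩
        ⟦ 0 ⟧                                          ∎)
      doubles false false eq = ⟦10⟧≢0 (begin
        ⟦ 10 ⟧
          ≡⟨ solve 0 (con (+ 10) := (:- ((:- con (+ 7)) :+ (:- con (+ 7)))) :+ ((:- con (+ 2)) :+ (:- con (+ 2)))) refl ⟩
        neg (neg ⟦ 7 ⟧ ⊞ neg ⟦ 7 ⟧) ⊞ (neg ⟦ 2 ⟧ ⊞ neg ⟦ 2 ⟧)   ≡⟨ cong (λ x → neg x ⊞ (neg ⟦ 2 ⟧ ⊞ neg ⟦ 2 ⟧)) eq ⟩
        neg (neg ⟦ 2 ⟧ ⊞ neg ⟦ 2 ⟧) ⊞ (neg ⟦ 2 ⟧ ⊞ neg ⟦ 2 ⟧)   ≡⟨ ⊞-inverseˡ _ ⟩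
        ⟦ 0 ⟧                                                   ∎)

    opaque
      balanced : ∃[ τ ] ((∀ x → Σ[ τ ] (row x) ≢ ⟦ 0 ⟧) × (∀ y → Σ[ τ ] (column y) ≢ ⟦ 0 ⟧) × (∀ c → Kept c → τ c ≡ σ c))
      balanced = balance B 2B≢0 7≢2 σ

    τ : Signs
    τ = proj₁ balanced

    τ-kept : ∀ c → Kept c → τ c ≡ σ c
    τ-kept = proj₂ (proj₂ (proj₂ balanced))

    A : Cell → Fin v
    A = label τ

    index-injective : ∀ {c c′} → π ⟨$⟩ʳ Inverse.to θ c ≡ π ⟨$⟩ʳ Inverse.to θ c′ → c ≡ c′
    index-injective {c} {c′} eq = begin
      c                                       ≡⟨ Inverse.strictlyInverseʳ θ c ⟨
      Inverse.from θ (Inverse.to θ c)         ≡⟨ cong (Inverse.from θ) θc≡θc′ ⟩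
      Inverse.from θ (Inverse.to θ c′)        ≡⟨ Inverse.strictlyInverseʳ θ c′ ⟩
      c′                                      ∎
      where
      open ≡-Reasoning
      θc≡θc′ : Inverse.to θ c ≡ Inverse.to θ c′
      θc≡θc′ = trans (sym (Perm.inverseˡ π)) (trans (cong (π ⟨$⟩ˡ_) eq) (Perm.inverseˡ π))

    A-sign : ∀ c c′ → A c ≢ neg (A c′)
    A-sign c c′ eq =
      let i≡j , b≡ = signed-value (τ c) (not (τ c′)) (trans eq (sym (signed-not (τ c′) (B c′))))
      in not-¬ (cong τ (index-injective {c} {c′} i≡j)) b≡

    A-locate : ∀ z → InJ v t z ⊎ ∃[ c ] (A c ≡ z ⊎ neg (A c) ≡ z)
    A-locate z = [ inj₁ , (λ (i , ±value) → inj₂ (cellOf i , up-to-sign (τ (cellOf i)) (B-cellOf i) ±value)) ]′ (value-locate z)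
      where
      cellOf : Fin M → Cell
      cellOf i = Inverse.from θ (π ⟨$⟩ˡ i)
      B-cellOf : ∀ i → B (cellOf i) ≡ value i
      B-cellOf i = cong value (trans (cong (π ⟨$⟩ʳ_) (Inverse.strictlyInverseˡ θ (π ⟨$⟩ˡ i))) (Perm.inverseʳ π))
      up-to-sign : ∀ b {x y} → x ≡ y → y ≡ z ⊎ neg y ≡ z → signed b x ≡ z ⊎ neg (signed b x) ≡ z
      up-to-sign true  x≡y (inj₁ eq) = inj₁ (trans x≡y eq)
      up-to-sign true  x≡y (inj₂ eq) = inj₂ (trans (cong neg x≡y) eq)
      up-to-sign false x≡y (inj₁ eq) = inj₂ (trans (neg-involutive _) (trans x≡y eq))
      up-to-sign false x≡y (inj₂ eq) = inj₁ (trans (cong neg x≡y) eq)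

    A-prescribed : ∀ {c r} → Kept c → σ c ≡ true → r < 7 → toℕ (Inverse.to θ c) ≡ r → A c ≡ ⟦ suc r ⟧
    A-prescribed {c} kept σc r<7 θc = trans (cong (λ b → signed b (B c)) (trans (τ-kept c kept) σc)) (B-prescribed r<7 θc)

    A∉J : ∀ c → ¬ InJ v t (A c)
    A∉J c = signed∉J (τ c) (π ⟨$⟩ʳ Inverse.to θ c)

    σ-bit : ∀ {j} → 3 + j < n → σ (R.⟦ 3 + j ⟧ , 0F) ≡ decodeBits e bits j
    σ-bit j<n = cong bitFrom3 (R.toℕ-⟦⟧-small j<n)

    σ-small : ∀ {i} → i ≤ 2 → σ (R.⟦ i ⟧ , 0F) ≡ true
    σ-small i≤2 = trans (cong bitFrom3 (R.toℕ-⟦⟧-small (small i≤2))) (≤2 i≤2)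
      where
      ≤2 : ∀ {i} → i ≤ 2 → bitFrom3 i ≡ true
      ≤2 z≤n             = refl
      ≤2 (s≤s z≤n)       = refl
      ≤2 (s≤s (s≤s z≤n)) = refl

    suc-pair : ∀ {c c′ r} → A c ≡ ⟦ suc r ⟧ → A c′ ≡ ⟦ r ⟧ → A c ≡ A c′ ⊞ ⟦ 1 ⟧
    suc-pair {r = r} eq eq′ = trans eq (trans (cong ⟦_⟧ (+-comm 1 r)) (trans (sym (⟦⟧-+ r 1)) (cong (_⊞ ⟦ 1 ⟧) (sym eq′))))

    labelling : Labelling h l v t
    labelling = let n₁ , n₂ , n₃ , n₄ , n₅ , n₆ , n₇ , _ = θ-numbers in record
      { A = A
      ; A-injective = λ {c} {c′} eq → index-injective (proj₁ (signed-value (τ c) (τ c′) eq))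
      ; A-sign = A-sign
      ; A∉J = A∉J
      ; A-locate = A-locate
      ; A-one = A-prescribed kept₁ refl z<s n₁
      -- This cell lies on the double edge, so its sign may have been flipped and only ±2 is
      -- available.
      ; A-two = up-to-sign (τ (R.⟦ 0 ⟧ , 1F)) (B-prescribed (m≤m+n 2 5) n₂)
      ; A-pair₀ = suc-pair (A-prescribed (kept₀ z<s (m≤m+n 2 e)) (σ-small ≤-refl) (m≤m+n 4 3) n₄)
                           (A-prescribed (kept₀ z<s (s≤s z≤n)) (σ-small (s≤s z≤n)) (m≤m+n 3 4) n₃)
      -- Row 2 is kept at level 2 only when `2 < h`, that is, when `0 < e`.
      ; A-pair₂ = suc-pair (A-prescribed (kept₂ z<s (s≤s (s≤s e>0))) refl (m≤m+n 6 1) n₆)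
                           (A-prescribed (kept₂ z<s (s≤s (s≤s z≤n))) refl (m≤m+n 5 2) n₅)
      ; h>0 = z<s
      ; 3≢0 = ⟦⟧≢0 z<s (m≤m+n 3 15)
      }
      where
      up-to-sign : ∀ b {x} → x ≡ ⟦ 2 ⟧ → signed b x ≡ ⟦ 2 ⟧ ⊎ signed b x ≡ neg ⟦ 2 ⟧
      up-to-sign true  eq = inj₁ eq
      up-to-sign false eq = inj₂ (cong neg eq)

  -- Both labellings put the label 1 on the same dart. Starting from the edge from 0 to 1, the
  -- rotation at 0 therefore spells out the voltages of all darts in the order given by `succ`.
  labels-from-rotation : (Λ Λ′ : Labelling h l v t) →
    (∀ (e : OrientedEdge (Multipartite v t)) → ρ (Derived.embedding (Labelled.voltageMap Λ)) e ≡ ρ (Derived.embedding (Labelled.voltageMap Λ′)) e) →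
    ∀ c → Labelling.A Λ c ≡ Labelling.A Λ′ c
  labels-from-rotation Λ Λ′ same c =
    let w , eq = Tour.reach h l one (c , false) in
    ⊞-cancelˡ ⟦ 0 ⟧ _ _ (trans (sym (⊕-⊞ _ _)) (trans
      (cong target (subst (λ p → D.dart ⟦ 0 ⟧ p ≡ D′.dart ⟦ 0 ⟧ p) eq (along w))) (⊕-⊞ _ _)))
    where
    module D  = Derived (Labelled.voltageMap Λ)
    module D′ = Derived (Labelled.voltageMap Λ′)
    one : Pos
    one = (R.⟦ h ⟧ , 1F) , false
    along : ∀ w → D.dart ⟦ 0 ⟧ (iterate succ one w) ≡ D′.dart ⟦ 0 ⟧ (iterate succ one w)
    along zero    = D.edge-≡ refl (cong (⟦ 0 ⟧ ⊕_) (trans (Labelling.A-one Λ) (sym (Labelling.A-one Λ′))))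
    along (suc w) = begin
      D.dart ⟦ 0 ⟧ (iterate succ one (suc w))                  ≡⟨ cong (D.dart ⟦ 0 ⟧) (iterate-suc succ one w) ⟩
      D.dart ⟦ 0 ⟧ (succ (iterate succ one w))                 ≡⟨ D.ρ-dart ⟦ 0 ⟧ (iterate succ one w) ⟨
      ρ D.embedding (D.dart ⟦ 0 ⟧ (iterate succ one w))        ≡⟨ same (D.dart ⟦ 0 ⟧ (iterate succ one w)) ⟩
      ρ D′.embedding (D.dart ⟦ 0 ⟧ (iterate succ one w))       ≡⟨ cong (ρ D′.embedding) (along w) ⟩
      ρ D′.embedding (D′.dart ⟦ 0 ⟧ (iterate succ one w))      ≡⟨ D′.ρ-dart ⟦ 0 ⟧ (iterate succ one w) ⟩
      D′.dart ⟦ 0 ⟧ (succ (iterate succ one w))                ≡⟨ cong (D′.dart ⟦ 0 ⟧) (iterate-suc succ one w) ⟨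
      D′.dart ⟦ 0 ⟧ (iterate succ one (suc w))                 ∎
      where open ≡-Reasoning

  module _ (code code′ : Fin (M′ !)) (bits bits′ : Fin (2 ^ e)) where
    private
      module X  = Member code bits
      module X′ = Member code′ bits′

    -- A signed value determines both index and sign. The indices recover the permutation; balancing
    -- may have altered other signs, but the kept ones still spell out the bits.
    labels-determine : (∀ c → X.A c ≡ X′.A c) → code ≡ code′ × bits ≡ bits′
    labels-determine same =
      permute-injective same-index ,
      decodeBits-injective e bits bits′ same-bit
      where
      open ≡-Reasoning
      parts : ∀ c → X.π ⟨$⟩ʳ Inverse.to θ c ≡ X′.π ⟨$⟩ʳ Inverse.to θ c × X.τ c ≡ X′.τ c
      parts c = signed-value (X.τ c) (X′.τ c) (same c)
      same-index : ∀ i → X.π ⟨$⟩ʳ i ≡ X′.π ⟨$⟩ʳ i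
      same-index i = subst (λ i → X.π ⟨$⟩ʳ i ≡ X′.π ⟨$⟩ʳ i) (Inverse.strictlyInverseˡ θ i) (proj₁ (parts (Inverse.from θ i)))
      same-bit : ∀ j → j < e → decodeBits e bits j ≡ decodeBits e bits′ j
      same-bit j j<e = begin
        decodeBits e bits j           ≡⟨ X.σ-bit (≤h⇒<n 3+j≤h) ⟨
        X.σ (R.⟦ 3 + j ⟧ , 0F)        ≡⟨ X.τ-kept (R.⟦ 3 + j ⟧ , 0F) (kept₀ z<s 3+j≤h) ⟨
        X.τ (R.⟦ 3 + j ⟧ , 0F)        ≡⟨ proj₂ (parts (R.⟦ 3 + j ⟧ , 0F)) ⟩
        X′.τ (R.⟦ 3 + j ⟧ , 0F)       ≡⟨ X′.τ-kept (R.⟦ 3 + j ⟧ , 0F) (kept₀ z<s 3+j≤h) ⟩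
        X′.σ (R.⟦ 3 + j ⟧ , 0F)       ≡⟨ X′.σ-bit (≤h⇒<n 3+j≤h) ⟩
        decodeBits e bits′ j          ∎
        where
        3+j≤h : 3 + j ≤ h
        3+j≤h = s≤s (s≤s j<e)
        ≤h⇒<n : ∀ {i} → i ≤ h → i < n
        ≤h⇒<n i≤h = ≤-<-trans i≤h h<n

  private
    codeOf : Fin (M′ ! * 2 ^ e) → Fin (M′ !)
    codeOf i = proj₁ (remQuot {M′ !} (2 ^ e) i)

    bitsOf : Fin (M′ ! * 2 ^ e) → Fin (2 ^ e)
    bitsOf i = proj₂ (remQuot {M′ !} (2 ^ e) i)

    memberLabelling : Fin (M′ ! * 2 ^ e) → Labelling h l v t
    memberLabelling i = Member.labelling (codeOf i) (bitsOf i)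

  opaque
    member : Fin (M′ ! * 2 ^ e) → Embedding (Multipartite v t)
    member i = Derived.embedding (Labelled.voltageMap (memberLabelling i))

    member-distinct : ∀ i j → i ≢ j → Distinct (member i) (member j)
    member-distinct i j i≢j same =
      let code≡ , bits≡ = labels-determine (codeOf i) (codeOf j) (bitsOf i) (bitsOf j)
                          (labels-from-rotation (memberLabelling i) (memberLabelling j) same)
      in i≢j (remQuot-injective {M′ !} (2 ^ e) (cong₂ _,_ code≡ bits≡))

    member-biembedding : ∀ i → IsBiembedding (member i)
    member-biembedding i = Derived.isBiembedding (Labelled.voltageMap (memberLabelling i))

    member-aut : ∀ i → AutIsTranslations (member i)
    member-aut i = Labelled.autIsTranslations-labelled (memberLabelling i)

    member-faces : ∀ i e → ∃[ o ] (1 < o × (Prime v → o ≡ v) × FaceLength (member i) e (o * k))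
    member-faces i =
      let rows , columns , _ = proj₂ (Member.balanced (codeOf i) (bitsOf i))
      in Faces.faceLengths (memberLabelling i) rows columns

  biembeddings : Biembeddings v t k (M′ ! * 2 ^ e)
  biembeddings = member , member-distinct , member-biembedding , member-aut ,
    (λ i d → let o , 1<o , _ , face = member-faces i d in
       o * k , face , divides o refl , subst (_< o * k) (*-identityˡ k) (*-monoˡ-< k 1<o)) ,
    (λ v-prime i d → let o , _ , o≡v , face = member-faces i d in
       subst (FaceLength (member i) d) (trans (cong (_* k) (o≡v v-prime)) (*-comm v k)) face)

-- The claimed cardinality

cross-mono-≤ : ∀ {a b p q} .{{_ : NonZero p}} .{{_ : NonZero q}} → a * q ≤ b * p → (+ a) ℚ./ p ℚ.≤ (+ b) ℚ./ q
cross-mono-≤ {a} {b} {suc p} {suc q} aq≤bp = ℚ.toℚᵘ-cancel-≤ (begin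
  ℚ.toℚᵘ ((+ a) ℚ./ suc p)      ≃⟨ ℚ.toℚᵘ-fromℚᵘ (ℚᵘ.mkℚᵘ (+ a) p) ⟩
  ℚᵘ.mkℚᵘ (+ a) p               ≤⟨ ℚᵘ.*≤* (subst₂ ℤ._≤_ (ℤ.pos-* a (suc q)) (ℤ.pos-* b (suc p)) (ℤ.+≤+ aq≤bp)) ⟩
  ℚᵘ.mkℚᵘ (+ b) q               ≃⟨ ℚ.toℚᵘ-fromℚᵘ (ℚᵘ.mkℚᵘ (+ b) q) ⟨
  ℚ.toℚᵘ ((+ b) ℚ./ suc q)      ∎)
  where open ℚᵘ.≤-Reasoning

cross-mono-< : ∀ {a b p q} .{{_ : NonZero p}} .{{_ : NonZero q}} → a * q < b * p → (+ a) ℚ./ p ℚ.< (+ b) ℚ./ q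
cross-mono-< {a} {b} {suc p} {suc q} aq<bp = ℚ.toℚᵘ-cancel-< (begin-strict
  ℚ.toℚᵘ ((+ a) ℚ./ suc p)      ≃⟨ ℚ.toℚᵘ-fromℚᵘ (ℚᵘ.mkℚᵘ (+ a) p) ⟩
  ℚᵘ.mkℚᵘ (+ a) p               <⟨ ℚᵘ.*<* (subst₂ ℤ._<_ (ℤ.pos-* a (suc q)) (ℤ.pos-* b (suc p)) (ℤ.+<+ aq<bp)) ⟩
  ℚᵘ.mkℚᵘ (+ b) q               ≃⟨ ℚ.toℚᵘ-fromℚᵘ (ℚᵘ.mkℚᵘ (+ b) q) ⟨
  ℚ.toℚᵘ ((+ b) ℚ./ suc q)      ∎)
  where open ℚᵘ.≤-Reasoning

0≤/ : ∀ a p .{{_ : NonZero p}} → 0ℚ ℚ.≤ (+ a) ℚ./ p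
0≤/ a p = cross-mono-≤ {0} {a} {1} {p} z≤n

p<1⇒0<1-p : ∀ {p} → p ℚ.< 1ℚ → 0ℚ ℚ.< 1ℚ ℚ.- p
p<1⇒0<1-p {p} p<1 = subst (ℚ._< 1ℚ ℚ.- p) (ℚ.+-inverseʳ p) (ℚ.+-monoˡ-< (ℚ.- p) p<1)

0≤p⇒1-p≤1 : ∀ {p} → 0ℚ ℚ.≤ p → 1ℚ ℚ.- p ℚ.≤ 1ℚ
0≤p⇒1-p≤1 {p} 0≤p = subst (1ℚ ℚ.- p ℚ.≤_) (ℚ.+-identityʳ 1ℚ) (ℚ.+-monoʳ-≤ 1ℚ (ℚ.neg-antimono-≤ 0≤p))

1≤p⇒1-p≤0 : ∀ {p} → 1ℚ ℚ.≤ p → 1ℚ ℚ.- p ℚ.≤ 0ℚ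
1≤p⇒1-p≤0 {p} 1≤p = subst (1ℚ ℚ.- p ℚ.≤_) (ℚ.+-inverseʳ p) (ℚ.+-monoˡ-≤ (ℚ.- p) 1≤p)

module _ (n k : ℕ) .{{_ : NonZero n}} .{{_ : NonZero k}} (3≤k : 3 ≤ k) (k<n : k < n) where
  private
    d : ℕ
    d = n * k ∸ (k ∸ 1)

    d+k≡ : d + k ≡ suc (n * k)
    d+k≡ = begin
      d + k                                 ≡⟨ cong (_+_ d) (sym (m∸n+n≡m (≤-trans (s≤s z≤n) 3≤k))) ⟩
      d + ((k ∸ 1) + 1)                     ≡⟨ +-assoc d (k ∸ 1) 1 ⟨
      d + (k ∸ 1) + 1                       ≡⟨ cong (_+ 1) (m∸n+n≡m (≤-trans (m∸n≤m k 1) (m≤n*m k n))) ⟩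
      n * k + 1                             ≡⟨ +-comm (n * k) 1 ⟩
      suc (n * k)                           ∎
      where open ≡-Reasoning

    2n<d : 2 * n < d
    2n<d = +-cancelʳ-< k (2 * n) d (subst (2 * n + k <_) (sym d+k≡) (s≤s (begin
      2 * n + k     ≤⟨ +-monoʳ-≤ (2 * n) (<⇒≤ k<n) ⟩
      2 * n + n     ≡⟨ +-comm (2 * n) n ⟩
      3 * n         ≤⟨ *-monoˡ-≤ n 3≤k ⟩
      k * n         ≡⟨ *-comm k n ⟩
      n * k         ∎)))
      where open ≤-Reasoning

    instance
      d≢0 : NonZero d
      d≢0 = >-nonZero (≤-<-trans z≤n 2n<d)

  lossRatio<1 : lossRatio n k ℚ.< 1ℚ
  lossRatio<1 = cross-mono-< {2 * n} {1} {d} {1} (subst₂ _<_ (sym (*-identityʳ (2 * n))) (sym (*-identityˡ d)) 2n<d)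

  0≤lossRatio : 0ℚ ℚ.≤ lossRatio n k
  0≤lossRatio = 0≤/ (2 * n) d

  -- Clearing denominators with `d + k ≡ suc (n * k)` leaves 4k ≤ 2nk + 4, and `3 ≤ k < n` gives 4 ≤
  -- n.
  lossRatio≤4/k : lossRatio n k ℚ.≤ (+ 4) ℚ./ k
  lossRatio≤4/k = cross-mono-≤ {2 * n} {4} {d} {k} (+-cancelʳ-≤ (4 * k) (2 * n * k) (4 * d) (begin
      2 * n * k + 4 * k               ≡⟨ cong (_+ 4 * k) (*-assoc 2 n k) ⟩
      2 * (n * k) + 4 * k             ≤⟨ +-monoʳ-≤ (2 * (n * k)) (begin
          4 * k                         ≤⟨ *-monoˡ-≤ k (≤-trans (s≤s 3≤k) k<n) ⟩
          n * k                         ≤⟨ m≤m+n (n * k) (n * k + 4) ⟩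
          n * k + (n * k + 4)           ∎) ⟩
      2 * (n * k) + (n * k + (n * k + 4))   ≡⟨ regroup (n * k) ⟩
      4 * suc (n * k)                 ≡⟨ cong (4 *_) d+k≡ ⟨
      4 * (d + k)                     ≡⟨ *-distribˡ-+ 4 d k ⟩
      4 * d + 4 * k                   ∎))
    where
    open ≤-Reasoning
    regroup : ∀ x → 2 * x + (x + (x + 4)) ≡ 4 * suc x
    regroup = solve-∀

  private
    instance
      nk≢0 : NonZero (n * k)
      nk≢0 = m*n≢0 n k

    loss total : ℚ
    loss  = 1ℚ ℚ.- lossRatio n k
    total = (+ ((n * k) !)) ℚ./ 1

    instance
      loss≥0 : ℚ.NonNegative loss
      loss≥0 = ℚ.nonNegative (ℚ.<⇒≤ (p<1⇒0<1-p lossRatio<1))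

      total≥0 : ℚ.NonNegative total
      total≥0 = ℚ.nonNegative (0≤/ ((n * k) !) 1)

  familyBound≤! : ∀ C → familyBound C n k ℚ.≤ (+ ((n * k) !)) ℚ./ 1
  familyBound≤! C = begin
    loss ℚ.* (1ℚ ℚ.- (+ C) ℚ./ (n * k)) ℚ.* total
      ≤⟨ ℚ.*-monoʳ-≤-nonNeg total (ℚ.*-monoˡ-≤-nonNeg loss (0≤p⇒1-p≤1 (0≤/ C (n * k)))) ⟩
    loss ℚ.* 1ℚ ℚ.* total         ≡⟨ cong (ℚ._* total) (ℚ.*-identityʳ loss) ⟩
    loss ℚ.* total                ≤⟨ ℚ.*-monoʳ-≤-nonNeg total (0≤p⇒1-p≤1 0≤lossRatio) ⟩
    1ℚ ℚ.* total                  ≡⟨ ℚ.*-identityˡ total ⟩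
    total                         ∎
    where open ℚ.≤-Reasoning

  familyBound≤0 : ∀ C → n * k ≤ C → familyBound C n k ℚ.≤ 0ℚ
  familyBound≤0 C nk≤C = begin
    loss ℚ.* (1ℚ ℚ.- (+ C) ℚ./ (n * k)) ℚ.* total
      ≤⟨ ℚ.*-monoʳ-≤-nonNeg total (ℚ.*-monoˡ-≤-nonNeg loss (1≤p⇒1-p≤0
           (cross-mono-≤ {1} {C} {1} {n * k} (subst₂ _≤_ (sym (*-identityˡ (n * k))) (sym (*-identityʳ C)) nk≤C)))) ⟩
    loss ℚ.* 0ℚ ℚ.* total         ≡⟨ cong (ℚ._* total) (ℚ.*-zeroʳ loss) ⟩
    0ℚ ℚ.* total                  ≡⟨ ℚ.*-zeroˡ total ⟩
    0ℚ                            ∎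
    where open ℚ.≤-Reasoning

-- Powers of two against the factorial

private
  -- With n = 5 + 2e, `fits` bounds the binary logarithm of n by `suc L`, and the 14 in `short` is
  -- the exponent in (nk)⁷ ≤ n¹⁴. The field `steep` carries the induction on `e` past the points
  -- where `L` has to grow.
  record LogBound (e : ℕ) : Set where
    field
      L       : ℕ
      fits    : 5 + 2 * e ≤ 2 ^ suc L
      short   : 14 * suc L ≤ e
      steep   : 14 * suc L + 16 ≤ 2 ^ L

  -- `L` grows only when `fits` would fail. Then e + 3 is at least `2 ^ L`, and `steep` converts
  -- this into `short` for the new `L`.
  logBound-suc : ∀ e → LogBound e → LogBound (suc e)
  logBound-suc e record { L = L ; fits = fits ; short = short ; steep = steep } with 5 + 2 * suc e ≤? 2 ^ suc L
  ... | yes fits′ = record { L = L ; fits = fits′ ; short = m≤n⇒m≤1+n short ; steep = steep }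
  ... | no  ¬fits = record { L = suc L ; fits = fits′ ; short = short′ ; steep = steep′ }
    where
    open ≤-Reasoning
    next : ∀ e → 5 + 2 * suc e ≡ (5 + 2 * e) + 2
    next = solve-∀
    next-odd : ∀ e → 5 + 2 * suc e ≡ suc (2 * (3 + e))
    next-odd = solve-∀
    next-short : ∀ L → 14 * suc (suc L) + 2 ≡ 14 * suc L + 16
    next-short = solve-∀
    next-steep : ∀ L → 14 * suc (suc L) + 16 ≡ (14 * suc L + 16) + 14
    next-steep = solve-∀
    fits′ : 5 + 2 * suc e ≤ 2 ^ suc (suc L)
    fits′ = begin
      5 + 2 * suc e                 ≡⟨ next e ⟩
      (5 + 2 * e) + 2               ≤⟨ +-mono-≤ fits (^-monoʳ-≤ 2 {1} {suc L} (s≤s z≤n)) ⟩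
      2 ^ suc L + 2 ^ suc L         ≡⟨ cong (_+_ (2 ^ suc L)) (+-identityʳ (2 ^ suc L)) ⟨
      2 ^ suc (suc L)               ∎
    short′ : 14 * suc (suc L) ≤ suc e
    short′ = +-cancelʳ-≤ 2 (14 * suc (suc L)) (suc e) (begin
      14 * suc (suc L) + 2          ≡⟨ next-short L ⟩
      14 * suc L + 16               ≤⟨ steep ⟩
      2 ^ L                         ≤⟨ *-cancelˡ-≤ {2 ^ L} {3 + e} 2 (s≤s⁻¹ (subst (2 ^ suc L <_) (next-odd e) (≰⇒> ¬fits))) ⟩
      3 + e                         ≡⟨ +-comm 2 (suc e) ⟩
      suc e + 2                     ∎)
    steep′ : 14 * suc (suc L) + 16 ≤ 2 ^ suc L
    steep′ = begin
      14 * suc (suc L) + 16         ≡⟨ next-steep L ⟩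
      (14 * suc L + 16) + 14        ≤⟨ +-monoʳ-≤ (14 * suc L + 16) (m≤n+m 14 (14 * suc L + 2)) ⟩
      (14 * suc L + 16) + (14 * suc L + 2 + 14)   ≡⟨ cong (_+_ (14 * suc L + 16)) (+-assoc (14 * suc L) 2 14) ⟩
      (14 * suc L + 16) + (14 * suc L + 16)       ≤⟨ +-mono-≤ steep steep ⟩
      2 ^ L + 2 ^ L                 ≡⟨ cong (_+_ (2 ^ L)) (+-identityʳ (2 ^ L)) ⟨
      2 ^ suc L                     ∎

  logBound : ∀ i → LogBound (i + 126)
  -- The smallest large n is 257, which lies between 2⁸ and 2⁹, and 14 · 9 = 126 makes `short` an
  -- equality.
  logBound zero = record { L = 8 ; fits = ≤ᵇ⇒≤ 257 512 _ ; short = ≤-refl ; steep = ≤ᵇ⇒≤ 142 256 _ }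
  logBound (suc i) = logBound-suc (i + 126) (logBound i)

  !≤^*! : ∀ r m {s} → s ≡ r + m → s ! ≤ s ^ r * m !
  !≤^*! zero    m refl = ≤-reflexive (sym (*-identityˡ (m !)))
  !≤^*! (suc r) m refl = begin
    suc (r + m) * (r + m) !                     ≤⟨ *-monoʳ-≤ (suc (r + m)) (!≤^*! r m refl) ⟩
    suc (r + m) * ((r + m) ^ r * m !)           ≤⟨ *-monoʳ-≤ (suc (r + m)) (*-monoˡ-≤ (m !) (^-monoˡ-≤ r (n≤1+n (r + m)))) ⟩
    suc (r + m) * (suc (r + m) ^ r * m !)       ≡⟨ *-assoc (suc (r + m)) (suc (r + m) ^ r) (m !) ⟨
    suc (r + m) ^ suc r * m !                   ∎
    where open ≤-Reasoning

-- The 2^e free signs make up for the seven labels that are not permuted.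
factorial-bound : ∀ i n k M′ → n ≡ 5 + 2 * (i + 126) → k < n → n * k ≡ 7 + M′ → (n * k) ! ≤ M′ ! * 2 ^ (i + 126)
factorial-bound i n k M′ n≡ k<n size = begin
  (n * k) !                      ≤⟨ !≤^*! 7 M′ size ⟩
  (n * k) ^ 7 * M′ !             ≤⟨ *-monoˡ-≤ (M′ !) [nk]^7≤ ⟩
  2 ^ (i + 126) * M′ !           ≡⟨ *-comm (2 ^ (i + 126)) (M′ !) ⟩
  M′ ! * 2 ^ (i + 126)           ∎
  where
  open ≤-Reasoning
  open LogBound (logBound i) renaming (L to L-1)
  L : ℕ
  L = suc L-1
  n≤2^L : n ≤ 2 ^ L
  n≤2^L = subst (_≤ 2 ^ L) (sym n≡) fits
  fourteen : ∀ L → 14 * L ≡ (L + L) * 7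
  fourteen = solve-∀
  [nk]^7≤ : (n * k) ^ 7 ≤ 2 ^ (i + 126)
  [nk]^7≤ = begin
    (n * k) ^ 7               ≤⟨ ^-monoˡ-≤ 7 (*-mono-≤ n≤2^L (≤-trans (<⇒≤ k<n) n≤2^L)) ⟩
    (2 ^ L * 2 ^ L) ^ 7       ≡⟨ cong (_^ 7) (^-distribˡ-+-* 2 L L) ⟨
    (2 ^ (L + L)) ^ 7         ≡⟨ ^-*-assoc 2 (L + L) 7 ⟩
    2 ^ ((L + L) * 7)         ≤⟨ ^-monoʳ-≤ 2 (subst (_≤ i + 126) (fourteen L) short) ⟩
    2 ^ (i + 126)             ∎

-- Assembly of the family

odd⇒2m+1 : ∀ n → ¬ (2 ∣ n) → ∃[ m ] n ≡ suc (m + m)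
odd⇒2m+1 zero          odd = contradiction (2 ∣0) odd
odd⇒2m+1 (suc zero)    odd = 0 , refl
odd⇒2m+1 (suc (suc n)) odd =
  let m , eq = odd⇒2m+1 n (odd ∘ ∣m∣n⇒∣m+n ∣-refl)
  in suc m , cong (_+_ 2) (trans eq (sym (+-suc m m)))

-- For nk ≤ errorConstant t the claimed cardinality is not positive; 256² forces n > 256, so
-- that the signs outnumber (nk)⁷, and 9t forces v / t > 18, so that the labels are small.
opaque
  errorConstant : ℕ → ℕ
  errorConstant t = 256 * 256 + 9 * t

  256²≤errorConstant : ∀ t → 256 * 256 ≤ errorConstant t
  256²≤errorConstant t = m≤m+n (256 * 256) (9 * t)

  9t≤errorConstant : ∀ t → 9 * t ≤ errorConstant t
  9t≤errorConstant t = m≤n+m (9 * t) (256 * 256)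

EmbeddingFamily : (n k t : ℕ) .{{_ : NonZero n}} .{{_ : NonZero k}} .{{_ : NonZero t}} → Set
EmbeddingFamily n k t =
  let v = 2 * n * k + t in
  Σ[ N ∈ ℕ ] Σ[ Π ∈ (Fin N → Embedding (Multipartite v t)) ]
  (∀ i j → i ≢ j → Distinct (Π i) (Π j))
  × (∀ i → IsBiembedding (Π i))
  × (∀ i → AutIsTranslations (Π i))
  × (∀ i e → ∃[ m ] FaceLength (Π i) e m × k ∣ m × k < m)
  × familyBound (errorConstant t) n k ℚ.≤ (+ N) ℚ./ 1
  × (Prime v → t ≡ 1 × (∀ i → Gonal (k * v) (Π i)))

prime⇒t≡1 : ∀ n k t .{{_ : NonZero n}} .{{_ : NonZero k}} → t ∣ 2 * n * k → Prime (2 * n * k + t) → t ≡ 1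
prime⇒t≡1 n k t t∣2nk v-prime with prime⇒irreducible v-prime (∣m∣n⇒∣m+n t∣2nk ∣-refl)
... | inj₁ t≡1 = t≡1
... | inj₂ t≡v = contradiction t≡v (<⇒≢ (m<n+m t (>-nonZero⁻¹ (2 * n * k) {{m*n≢0 (2 * n) k {{m*n≢0 2 n}}}})))

largeFamily : ∀ e l t p {n k M′} .{{_ : NonZero t}} → n ≡ suc ((2 + e) + (2 + e)) → k ≡ 3 + (l + l) →
  0 < e → 2 * n * k ≡ p * t → n * k ≡ 7 + M′ → 18 ≤ p → Biembeddings (2 * n * k + t) t k (M′ ! * 2 ^ e)
largeFamily e l t p {n} {k} {M′} n≡ k≡ e>0 2nk≡ size p≥18 = subst (λ k → Biembeddings v t k (M′ ! * 2 ^ e)) (sym k≡) biembeddings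
  where
  v : ℕ
  v = 2 * n * k + t
  instance
    v≢0 : NonZero v
    v≢0 = >-nonZero (<-≤-trans (>-nonZero⁻¹ t) (m≤n+m t (2 * n * k)))
    p≢0 : NonZero p
    p≢0 = >-nonZero (≤-trans (s≤s z≤n) p≥18)
  tp : t * p ≡ (7 + M′) + (7 + M′)
  tp = begin
    t * p                     ≡⟨ *-comm t p ⟩
    p * t                     ≡⟨ 2nk≡ ⟨
    2 * n * k                 ≡⟨ *-assoc 2 n k ⟩
    2 * (n * k)               ≡⟨ cong (_+_ (n * k)) (+-identityʳ (n * k)) ⟩
    n * k + n * k             ≡⟨ cong₂ _+_ size size ⟩
    (7 + M′) + (7 + M′)       ∎
    where open ≡-Reasoning
  v≡ : v ≡ suc p * t
  v≡ = trans (cong (_+ t) 2nk≡) (+-comm (p * t) t)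
  open Family e l v t p M′ e>0 tp v≡ p≥18 (trans (sym (cong₂ _*_ n≡ k≡)) size) using (biembeddings)

module _ (n k t p : ℕ) .{{_ : NonZero n}} .{{_ : NonZero k}} .{{_ : NonZero t}}
         (odd : ¬ (2 ∣ n * k)) (3≤k : 3 ≤ k) (k<n : k < n) (2nk≡ : 2 * n * k ≡ p * t) where
  private
    t∣2nk : t ∣ 2 * n * k
    t∣2nk = divides p 2nk≡

    smallFamily : n * k ≤ errorConstant t → EmbeddingFamily n k t
    smallFamily small = 0 , (λ ()) , (λ ()) , (λ ()) , (λ ()) , (λ ()) , familyBound≤0 n k 3≤k k<n (errorConstant t) small ,
      λ v-prime → prime⇒t≡1 n k t t∣2nk v-prime , λ ()

    module _ (large : ¬ (n * k ≤ errorConstant t)) where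
      open ≤-Reasoning
      shape-n : (∃[ a ] n ≡ suc (a + a)) → ∃[ i ] n ≡ suc ((2 + (i + 126)) + (2 + (i + 126)))
      -- Here n = 2a + 1 and e = a - 2, so e ≥ 126 means a ≥ 128; for smaller a both n and k are at
      -- most 256, and nk does not exceed 256².
      shape-n (a , n≡) with 128 ≤? a
      ... | yes 128≤a = a ∸ 128 , trans n≡ (cong (λ a → suc (a + a)) (begin-equality
              a                         ≡⟨ m∸n+n≡m 128≤a ⟨
              a ∸ 128 + 128             ≡⟨ +-assoc (a ∸ 128) 126 2 ⟨
              (a ∸ 128 + 126) + 2       ≡⟨ +-comm (a ∸ 128 + 126) 2 ⟩
              2 + (a ∸ 128 + 126)       ∎))
      ... | no 128≰a = contradiction (begin
              n * k                     ≤⟨ *-mono-≤ n≤256 (≤-trans (<⇒≤ k<n) n≤256) ⟩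
              256 * 256                 ≤⟨ 256²≤errorConstant t ⟩
              errorConstant t                   ∎) large
        where
        n≤256 : n ≤ 256
        n≤256 = begin
          n                 ≡⟨ n≡ ⟩
          suc (a + a)       ≤⟨ s≤s (+-mono-≤ (s≤s⁻¹ (≰⇒> 128≰a)) (s≤s⁻¹ (≰⇒> 128≰a))) ⟩
          255               ≤⟨ n≤1+n 255 ⟩
          256               ∎

      shape-k : (∃[ b ] k ≡ suc (b + b)) → ∃[ l ] k ≡ 3 + (l + l)
      shape-k (zero  , k≡) = contradiction (subst (3 ≤_) k≡ 3≤k) λ { (s≤s ()) }
      shape-k (suc l , k≡) = l , trans k≡ (cong (_+_ 2) (+-suc l l))

      size : n * k ≡ 7 + (n * k ∸ 7)
      size = sym (m+[n∸m]≡n (begin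
        7                   ≤⟨ ≤ᵇ⇒≤ 7 (256 * 256) _ ⟩
        256 * 256           ≤⟨ 256²≤errorConstant t ⟩
        errorConstant t             ≤⟨ <⇒≤ (≰⇒> large) ⟩
        n * k               ∎))

      -- From p t = 2nk and nk ≥ 9t.
      p≥18 : 18 ≤ p
      p≥18 = ≰⇒> λ p≤17 → contradiction (begin-strict
        17 * t              <⟨ *-monoˡ-< t (≤-refl {18}) ⟩
        18 * t              ≡⟨ *-assoc 2 9 t ⟩
        2 * (9 * t)         ≤⟨ *-monoʳ-≤ 2 (≤-trans (9t≤errorConstant t) (<⇒≤ (≰⇒> large))) ⟩
        2 * (n * k)         ≡⟨ *-assoc 2 n k ⟨
        2 * n * k           ≡⟨ 2nk≡ ⟩
        p * t               ≤⟨ *-monoˡ-≤ t p≤17 ⟩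
        17 * t              ∎) (<-irrefl refl)

      count : ∀ i → n ≡ suc ((2 + (i + 126)) + (2 + (i + 126))) →
              familyBound (errorConstant t) n k ℚ.≤ (+ ((n * k ∸ 7) ! * 2 ^ (i + 126))) ℚ./ 1
      count i n≡ = ℚ.≤-trans (familyBound≤! n k 3≤k k<n (errorConstant t))
        (cross-mono-≤ {(n * k) !} {(n * k ∸ 7) ! * 2 ^ (i + 126)} {1} {1}
          (*-monoˡ-≤ 1 (factorial-bound i n k (n * k ∸ 7) (trans n≡ (five (i + 126))) k<n size)))
        where
        five : ∀ e → suc ((2 + e) + (2 + e)) ≡ 5 + 2 * e
        five = solve-∀

      largeCase : (∃[ i ] n ≡ suc ((2 + (i + 126)) + (2 + (i + 126)))) → (∃[ l ] k ≡ 3 + (l + l)) → EmbeddingFamily n k t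
      largeCase (i , n≡) (l , k≡) =
        let Π , distinct , biembedding , aut , faces , gonal =
              largeFamily (i + 126) l t p n≡ k≡ (≤-trans (s≤s z≤n) (m≤n+m 126 i)) 2nk≡ size p≥18
        in (n * k ∸ 7) ! * 2 ^ (i + 126) , Π , distinct , biembedding , aut , faces , count i n≡ ,
           λ v-prime → prime⇒t≡1 n k t t∣2nk v-prime , gonal v-prime

  embeddingFamily : EmbeddingFamily n k t
  embeddingFamily = by-size (n * k ≤? errorConstant t)
    where
    by-size : Dec (n * k ≤ errorConstant t) → EmbeddingFamily n k t
    by-size (yes small) = smallFamily small
    by-size (no large)  = largeCase large (shape-n large (odd⇒2m+1 n (odd ∘ ∣m⇒∣m*n k))) (shape-k large (odd⇒2m+1 k (odd ∘ ∣n⇒∣m*n n)))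

corollary4p11 : (∃[ D ] ∀ n k .{{_ : NonZero n}} .{{_ : NonZero k}} → 3 ≤ k → k < n →
    0ℚ ℚ.< 1ℚ ℚ.- lossRatio n k × lossRatio n k ℚ.≤ (+ D) ℚ./ k)
    ×
    (∀ t .{{_ : NonZero t}} → ¬ (4 ∣ t) →
    ∃[ C ] ∀ n k .{{_ : NonZero n}} .{{_ : NonZero k}} → k < n →
    t ∣ 2 * n * k →
    ( (¬ (2 ∣ n * k) × n ≥ k × k ≥ 3 × gcd n (k ∸ 1) ≡ 1)
    ⊎ (¬ (2 ∣ n * k) × n ≥ k × 3 < k × k < 200)
    ⊎ (¬ (2 ∣ n * k) × n ≥ k × k ≥ 3 × n ≥ (k ∸ 2) * (k ∸ 1)) ) →
    let v = 2 * n * k + t in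
    Σ[ N ∈ ℕ ] Σ[ Π ∈ (Fin N → Embedding (Multipartite v t)) ]
    (∀ i j → i ≢ j → Distinct (Π i) (Π j))
    × (∀ i → IsBiembedding (Π i))
    × (∀ i → AutIsTranslations (Π i))
    × (∀ i e → ∃[ m ] FaceLength (Π i) e m × k ∣ m × k < m)
    × familyBound C n k ℚ.≤ (+ N) ℚ./ 1
    × (Prime v → t ≡ 1 × (∀ i → Gonal (k * v) (Π i))))
corollary4p11 =
  (4 , λ n k 3≤k k<n → p<1⇒0<1-p (lossRatio<1 n k 3≤k k<n) , lossRatio≤4/k n k 3≤k k<n) ,
  λ t _ → errorConstant t , λ { n k k<n (divides p 2nk≡) cases →
    let odd , 3≤k = oddness cases in embeddingFamily n k t p odd 3≤k k<n 2nk≡ }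
  where
  oddness : ∀ {n k} →
    ( (¬ (2 ∣ n * k) × n ≥ k × k ≥ 3 × gcd n (k ∸ 1) ≡ 1)
    ⊎ (¬ (2 ∣ n * k) × n ≥ k × 3 < k × k < 200)
    ⊎ (¬ (2 ∣ n * k) × n ≥ k × k ≥ 3 × n ≥ (k ∸ 2) * (k ∸ 1)) ) → ¬ (2 ∣ n * k) × 3 ≤ k
  oddness (inj₁ (odd , _ , 3≤k , _))        = odd , 3≤k
  oddness (inj₂ (inj₁ (odd , _ , 3<k , _))) = odd , <⇒≤ 3<k
  oddness (inj₂ (inj₂ (odd , _ , 3≤k , _))) = odd , 3≤k
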